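{- Let $F$ be a field such that elements of $F$ can be efficiently represented and manipulated and such that the roots in $F[z]$ of polynomials over $F[z]$ can be found efficiently. Let $p(z)\in F[z]$ have degree $\deg_z p(z)=n>0$, and let $f(x)$ be a monic polynomial in $x$ of degree $d$ over $F[z]$, with coefficients given modulo $p(z)$. Let $0<\beta\le 1$. Then in polynomial time one can find all $w(z)\in F[z]$ such that \[ \deg_z w(z) < \beta^2 n/d \] and \[ \deg_z \gcd\big(f(w(z)),p(z)\big)\ \ge\ \beta n . \]
   Context: $F[z]$ is the ring of univariate polynomials over the field $F$. The polynomial $f(x)=\sum_{i=0}^d f_i(z)x^i$ has coefficients $f_i(z)\in F[z]$, is monic in $x$, and matters only modulo $p(z)$; $f(w(z))$ denotes substitution of $w(z)$ for $x$. "Polynomial time" means time polynomial in the size of the input (in particular in $n$ and $d$), where operations in $F$ and root finding in $F[z]$ of polynomials over $F[z]$ are assumed to be efficient. For finite fields root finding is done by a randomized algorithm, so the overall algorithm is then randomized.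
   Formalization: The parameter β with 0 < β ≤ 1, which is part of the algorithm's input, is taken to be rational rather than real. -}

module Defs where

open import Level using (Level; _⊔_; 0ℓ) renaming (suc to lsuc)
open import Algebra.Apartness.Bundles using (HeytingField)
open import Algebra.Bundles.Raw using (RawRing)
import Algebra.Definitions.RawMagma as Divisibility
open import Data.Bool.Base using (Bool; true; false; not; if_then_else_)
open import Data.Integer.Base using (∣_∣)
open import Data.List.Base using (List; []; _∷_; map; foldr; sum)
open import Data.List.Relation.Unary.Any using (Any)
open import Data.Nat.Base using (ℕ; zero; suc; _<_; _≤_)
import Data.Nat.Base as ℕ
open import Data.Nat.GeneralisedArithmetic using (fold)
open import Data.Nat.Logarithm using (⌊log₂_⌋)
open import Data.Product.Base using (Σ-syntax; ∃-syntax; _×_; _,_; proj₁; proj₂)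
open import Data.Rational.Base using (ℚ; ↥_; ↧ₙ_)
open import Function.Bundles using (_⇔_)
open import Relation.Binary.Core using (Rel)
open import Relation.Binary.Definitions using (Decidable)
open import Relation.Nullary.Decidable.Core using (yes; no; does)
open import Relation.Nullary.Negation.Core using (¬_)

-- Univariate polynomials over R are coefficient lists, constant term first.
-- Lists differing by trailing zeros represent the same polynomial, so the
-- equality is coefficientwise.

module Polynomial {c ℓ : Level} (R : RawRing c ℓ) where
  open RawRing R

  Poly : Set c
  Poly = List Carrier

  coeff : Poly → ℕ → Carrier
  coeff []      _       = 0#
  coeff (a ∷ _) zero    = a
  coeff (_ ∷ p) (suc i) = coeff p i

  infix  4 _≋_
  infixl 6 _+ₚ_
  infixl 7 _*ₚ_

  _≋_ : Rel Poly ℓ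
  p ≋ q = ∀ i → coeff p i ≈ coeff q i

  _+ₚ_ : Poly → Poly → Poly
  []      +ₚ q       = q
  (a ∷ p) +ₚ []      = a ∷ p
  (a ∷ p) +ₚ (b ∷ q) = (a + b) ∷ (p +ₚ q)

  _*ₚ_ : Poly → Poly → Poly
  []      *ₚ q = []
  (a ∷ p) *ₚ q = map (a *_) q +ₚ (0# ∷ (p *ₚ q))

  rawRing : RawRing c ℓ
  rawRing = record
    { Carrier = Poly
    ; _≈_     = _≋_
    ; _+_     = _+ₚ_
    ; _*_     = _*ₚ_
    ; -_      = map -_
    ; 0#      = []
    ; 1#      = 1# ∷ []
    }

  -- The zero polynomial has no degree; read its degree as -∞.
  HasDegree : Poly → ℕ → Set ℓ
  HasDegree p n = ¬ (coeff p n ≈ 0#) × (∀ m → n < m → coeff p m ≈ 0#)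

  MonicOfDegree : Poly → ℕ → Set ℓ
  MonicOfDegree p n = (coeff p n ≈ 1#) × (∀ m → n < m → coeff p m ≈ 0#)

  eval : Poly → Carrier → Carrier
  eval p x = foldr (λ a v → a + x * v) 0# p

module GCD {c ℓ : Level} (R : RawRing c ℓ) where
  open RawRing R
  open Divisibility *-rawMagma public using (_∣_)

  record IsGCD (g a b : Carrier) : Set (c ⊔ ℓ) where
    field
      divides₁ : g ∣ a
      divides₂ : g ∣ b
      greatest : ∀ h → h ∣ a → h ∣ b → h ∣ g

-- A field with decidable apartness: a # b is then the same as ¬ (a ≈ b), so
-- this is a field with an equality test.

record DiscreteField (ℓ₁ ℓ₂ : Level) : Set (lsuc (0ℓ ⊔ ℓ₁ ⊔ ℓ₂)) where
  field
    heytingField : HeytingField 0ℓ ℓ₁ ℓ₂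
  open HeytingField heytingField public
  field
    _#?_ : Decidable _#_

  rawRing : RawRing 0ℓ ℓ₁
  rawRing = record
    { Carrier = Carrier ; _≈_ = _≈_ ; _+_ = _+_ ; _*_ = _*_
    ; -_ = -_ ; 0# = 0# ; 1# = 1# }

  -- With the convention 0⁻¹ = 0; #⇒invertible inverts a - 0.
  inverse : Carrier → Carrier
  inverse a with a #? 0#
  ... | yes a#0 = proj₁ (#⇒invertible a#0)
  ... | no  _   = 0#

  F[z] : RawRing 0ℓ ℓ₁
  F[z] = Polynomial.rawRing rawRing

  F[z][x] : RawRing 0ℓ ℓ₁
  F[z][x] = Polynomial.rawRing F[z]

-- Data are immutable linked structures on a pointer machine whose cells hold
-- field elements, booleans and binary natural numbers.

infixr 5 _×̇_
infix  2 _⇒_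
infixr 9 _∘_

data Ty : Set where
  𝔽 bool nat : Ty
  _×̇_        : Ty → Ty → Ty
  list       : Ty → Ty

-- A program is a fixed piece of syntax, not containing field elements and not
-- depending on the input size. The only control flow is branching and
-- iteration whose number of rounds is computed before the loop starts.

data _⇒_ : Ty → Ty → Set where
  id    : ∀ {A} → A ⇒ A
  _∘_   : ∀ {A B C} → B ⇒ C → A ⇒ B → A ⇒ C
  ⟨_,_⟩ : ∀ {A B C} → A ⇒ B → A ⇒ C → A ⇒ B ×̇ C
  fst   : ∀ {A B} → A ×̇ B ⇒ A
  snd   : ∀ {A B} → A ×̇ B ⇒ B

  cond  : ∀ {A B} → A ⇒ bool → A ⇒ B → A ⇒ B → A ⇒ B
  tt ff : ∀ {A} → A ⇒ bool

  nil   : ∀ {A B} → A ⇒ list B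
  cons  : ∀ {A} → A ×̇ list A ⇒ list A
  match : ∀ {A B C} → A ⇒ C → A ×̇ B ×̇ list B ⇒ C → A ×̇ list B ⇒ C
  foldl : ∀ {A B C} → A ⇒ C → A ×̇ B ×̇ C ⇒ C → A ×̇ list B ⇒ C
  iter  : ∀ {A C} → A ⇒ C → A ×̇ C ⇒ C → A ×̇ nat ⇒ C

  lit                : ∀ {A} → ℕ → A ⇒ nat
  addℕ subℕ mulℕ     : nat ×̇ nat ⇒ nat
  leqℕ               : nat ×̇ nat ⇒ bool

  zeroF oneF  : ∀ {A} → A ⇒ 𝔽
  addF mulF   : 𝔽 ×̇ 𝔽 ⇒ 𝔽
  negF invF   : 𝔽 ⇒ 𝔽
  isZeroF     : 𝔽 ⇒ bool

  -- all roots in F[z] of a polynomial over F[z]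
  roots : list (list 𝔽) ⇒ list (list 𝔽)

module Data {ℓ₁ ℓ₂ : Level} (F : DiscreteField ℓ₁ ℓ₂) where

  ⟦_⟧ : Ty → Set
  ⟦ 𝔽 ⟧      = DiscreteField.Carrier F
  ⟦ bool ⟧   = Bool
  ⟦ nat ⟧    = ℕ
  ⟦ A ×̇ B ⟧  = ⟦ A ⟧ × ⟦ B ⟧
  ⟦ list A ⟧ = List ⟦ A ⟧

  -- Naturals are measured by their bit length, field elements count as one.
  size : ∀ A → ⟦ A ⟧ → ℕ
  size 𝔽        _       = 1
  size bool     _       = 1
  size nat      n       = 1 ℕ.+ ⌊log₂ n ⌋
  size (A ×̇ B)  (a , b) = size A a ℕ.+ size B b
  size (list A) as      = 1 ℕ.+ sum (map (size A) as)

-- "Roots in F[z] of polynomials over F[z] can be found efficiently": the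
-- search takes time polynomial in the size of the polynomial, the time
-- includes writing down the answer, and on every nonzero polynomial the answer
-- lists exactly the roots.

record RootFinder {ℓ₁ ℓ₂ : Level} (F : DiscreteField ℓ₁ ℓ₂) : Set ℓ₁ where
  open DiscreteField F using (F[z]; F[z][x])
  open Data F
  module K[z]    = RawRing F[z]
  module K[z][x] = RawRing F[z][x]
  field
    findRoots    : K[z][x].Carrier → List K[z].Carrier
    findRoots-⇔  : ∀ Q → ¬ (Q K[z][x].≈ K[z][x].0#) → ∀ w →
                   Any (w K[z].≈_) (findRoots Q) ⇔
                   (Polynomial.eval F[z] Q w K[z].≈ K[z].0#)
    time         : K[z][x].Carrier → ℕ
    output≤time  : ∀ Q → size (list (list 𝔽)) (findRoots Q) ≤ time Q
    time-bounded : ∃[ C ] ∃[ k ] ∀ Q →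
                   time Q ≤ C ℕ.* size (list (list 𝔽)) Q ℕ.^ k

module Machine {ℓ₁ ℓ₂ : Level} (F : DiscreteField ℓ₁ ℓ₂) (R : RootFinder F) where
  open DiscreteField F using (Carrier; _+_; _*_; -_; 0#; 1#; _#?_; inverse)
  open RootFinder R using (findRoots; time)
  open Data F public

  loop : {B C : Set} → (B → C → C) → C → List B → C
  loop f c []       = c
  loop f c (b ∷ bs) = loop f (f b c) bs

  run : ∀ {A B} → A ⇒ B → ⟦ A ⟧ → ⟦ B ⟧
  run id            a              = a
  run (g ∘ f)       a              = run g (run f a)
  run ⟨ f , g ⟩     a              = run f a , run g a
  run fst           (a , _)        = a
  run snd           (_ , b)        = b
  run (cond t f g)  a              = if run t a then run f a else run g a
  run tt            _              = true
  run ff            _              = false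
  run nil           _              = []
  run cons          (a , as)       = a ∷ as
  run (match f g)   (a , [])       = run f a
  run (match f g)   (a , (b ∷ bs)) = run g (a , b , bs)
  run (foldl z s)   (a , bs)       = loop (λ b c → run s (a , b , c)) (run z a) bs
  run (iter z s)    (a , n)        = fold (run z a) (λ c → run s (a , c)) n
  run (lit n)       _              = n
  run addℕ          (m , n)        = m ℕ.+ n
  run subℕ          (m , n)        = m ℕ.∸ n
  run mulℕ          (m , n)        = m ℕ.* n
  run leqℕ          (m , n)        = m ℕ.≤ᵇ n
  run zeroF         _              = 0#
  run oneF          _              = 1#
  run addF          (a , b)        = a + b
  run mulF          (a , b)        = a * b
  run negF          a              = - a
  run invF          a              = inverse a
  run isZeroF       a              = not (does (a #? 0#))
  run roots         Q              = findRoots Q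

  -- Time spent in the rounds of foldl and iter; t is the time of one round.
  loopCost : {B C : Set} → (B → C → C) → (B → C → ℕ) → C → List B → ℕ
  loopCost f t c []       = 0
  loopCost f t c (b ∷ bs) = 1 ℕ.+ t b c ℕ.+ loopCost f t (f b c) bs

  iterCost : {C : Set} → (C → C) → (C → ℕ) → C → ℕ → ℕ
  iterCost f t c zero    = 0
  iterCost f t c (suc n) = 1 ℕ.+ t (fold c f n) ℕ.+ iterCost f t c n

  -- Running time. Pairing, projecting and list operations move pointers and
  -- cost one unit, as do the field operations. An operation on natural numbers
  -- is charged their bit length (with unit-cost multiplication, repeated
  -- squaring would produce numbers of exponential length). A root search is
  -- charged the running time of the root finder.
  cost : ∀ {A B} → A ⇒ B → ⟦ A ⟧ → ℕ
  cost (g ∘ f)      a              = 1 ℕ.+ cost f a ℕ.+ cost g (run f a)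
  cost ⟨ f , g ⟩    a              = 1 ℕ.+ cost f a ℕ.+ cost g a
  cost (cond t f g) a              =
    1 ℕ.+ cost t a ℕ.+ (if run t a then cost f a else cost g a)
  cost (match f g)  (a , [])       = 1 ℕ.+ cost f a
  cost (match f g)  (a , (b ∷ bs)) = 1 ℕ.+ cost g (a , b , bs)
  cost (foldl z s)  (a , bs)       =
    1 ℕ.+ cost z a ℕ.+
    loopCost (λ b c → run s (a , b , c)) (λ b c → cost s (a , b , c)) (run z a) bs
  cost (iter z s)   (a , n)        =
    1 ℕ.+ cost z a ℕ.+
    iterCost (λ c → run s (a , c)) (λ c → cost s (a , c)) (run z a) n
  cost (lit n)      _              = size nat n
  cost addℕ         mn             = size (nat ×̇ nat) mn
  cost subℕ         mn             = size (nat ×̇ nat) mn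
  cost mulℕ         mn             = size (nat ×̇ nat) mn
  cost leqℕ         mn             = size (nat ×̇ nat) mn
  cost roots        Q              = 1 ℕ.+ time Q
  cost id           _              = 1
  cost fst          _              = 1
  cost snd          _              = 1
  cost tt           _              = 1
  cost ff           _              = 1
  cost nil          _              = 1
  cost cons         _              = 1
  cost zeroF        _              = 1
  cost oneF         _              = 1
  cost addF         _              = 1
  cost mulF         _              = 1
  cost negF         _              = 1
  cost invF         _              = 1
  cost isZeroF      _              = 1

-- An instance is p(z), the coefficients of f(x), and the fraction β in lowest
-- terms; a solution is a list of polynomials w(z).

Instance Solution : Ty
Instance = list 𝔽 ×̇ list (list 𝔽) ×̇ nat ×̇ nat
Solution = list (list 𝔽)

module Problem {ℓ₁ ℓ₂ : Level} (F : DiscreteField ℓ₁ ℓ₂) (R : RootFinder F) where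
  open DiscreteField F using (rawRing; F[z]; F[z][x])
  open Machine F R public
  open GCD F[z] public
  open Polynomial rawRing public using (HasDegree; _≋_)
  open Polynomial F[z] public using (coeff; MonicOfDegree) renaming (eval to _at_)

  K[z] K[z][x] : Set
  K[z]    = RawRing.Carrier F[z]
  K[z][x] = RawRing.Carrier F[z][x]

  infix 4 _≡_mod_ _∈_

  -- f and f′ have the same coefficients modulo p
  _≡_mod_ : K[z][x] → K[z][x] → K[z] → Set ℓ₁
  f ≡ f′ mod p = ∀ i → p ∣ (coeff f i +  - coeff f′ i)
    where open RawRing F[z] using (_+_; -_)

  -- membership up to equality of polynomials
  _∈_ : K[z] → List K[z] → Set ℓ₁
  w ∈ ws = Any (w ≋_) ws

  encode : K[z] → K[z][x] → ℚ → ⟦ Instance ⟧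
  encode p f β = p , f , ∣ ↥ β ∣ , ↧ₙ β

{-# OPTIONS --safe #-}

-- Let g be a common divisor of f(w) and p of degree e, and let deg w ≤ ω with ω
-- n d < e². For k = e(e+1) every polynomial Q(x) in the ideal (f, p)ᵏ has gᵏ ∣
-- Q(w), so Q(w) = 0 as soon as the coefficient of xʳ in Q has degree less than
-- ke − rω for all r. Such a Q ≠ 0 is found by linear algebra over F alone: give
-- x a weight W that bounds the degrees of the coefficients of f. Then the
-- products xʲ zᵃ fⁱ pᵏ⁻ⁱ, with j < d and without p for i ≥ k, are linearly
-- independent, because their leading monomials are distinct, and their weight
-- is that of the leading monomial. Those of weight less than a large L
-- outnumber the coefficients that have to vanish, so elimination leaves a
-- nonzero combination; its roots contain w. All pairs (e, ω) with e, ω ≤ n are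
-- tried, and the roots found are tested against the two conditions.

module Submission where

open import Defs
open import Algebra.Bundles using (CommutativeRing)
open import Algebra.Bundles.Raw using (RawRing)
import Algebra.Definitions.RawMagma as RawMagmaDefinitions
import Algebra.Definitions.RawSemiring as RawSemiringDefinitions
import Algebra.Properties.CommutativeSemigroup as CommutativeSemigroupProperties
import Algebra.Properties.Group as GroupProperties
import Algebra.Properties.Monoid.Divisibility as MonoidDivisibility
import Algebra.Properties.Ring as RingProperties
import Algebra.Properties.Semiring.Exp as Exponentiation
open import Data.Bool.Base using (Bool; true; false; if_then_else_; not; T)
import Data.Integer.Base as ℤ
import Data.Integer.Properties as ℤₚ
open import Data.List.Base using (List; []; _∷_; map; foldr; length; _++_; drop; null; concatMap; downFrom)
open import Data.List.Properties using (length-map; length-drop; length-++; map-++; map-id)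
import Data.List.Relation.Unary.All as All
open import Data.List.Relation.Unary.All using (All; []; _∷_)
import Data.List.Relation.Unary.All.Properties as Allₚ
import Data.List.Relation.Unary.Any as Any
open import Data.List.Relation.Unary.Any using (Any; here)
import Data.List.Relation.Unary.Any.Properties as Anyₚ
import Data.Nat.Base as ℕ
open import Data.Nat.Base using (ℕ; zero; suc; z≤n; s≤s; NonZero)
open import Data.Nat.Coprimality using (Coprime)
import Data.Nat.ListAction as List
open import Data.Nat.Logarithm using (⌊log₂_⌋; ⌊log₂⌋-mono-≤; ⌊log₂[2^n]⌋≡n)
import Data.Nat.Properties as ℕₚ
open import Data.Nat.Tactic.RingSolver using (solve-∀)
open import Data.Product.Base using (_×_; _,_; proj₁; proj₂; Σ-syntax; ∃-syntax)
import Data.Rational.Base as ℚ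
import Data.Rational.Properties as ℚₚ
import Data.Rational.Unnormalised.Base as ℚᵘ
open import Data.Rational.Unnormalised.Base using (ℚᵘ; mkℚᵘ)
import Data.Rational.Unnormalised.Properties as ℚᵘₚ
open import Data.Sum.Base using (_⊎_; inj₁; inj₂)
open import Data.Unit.Base using (tt)
import Function.Base as Function
open import Function.Bundles using (_⇔_; mk⇔; Equivalence)
open import Level using (Level; _⊔_; 0ℓ)
open import Relation.Binary.Core using (Rel)
open import Relation.Binary.Definitions using (tri<; tri≈; tri>)
import Relation.Binary.PropositionalEquality as ≡
open import Relation.Binary.PropositionalEquality.Core using (_≡_; subst)
import Relation.Binary.Reasoning.Setoid as SetoidReasoning
open import Relation.Nullary.Decidable.Core using (yes; no; Dec; does)
open import Relation.Nullary.Negation.Core using (contradiction; ¬_)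

-- Polynomials over a commutative ring

-- The bounds of the theorem enter through one integer inequality only: with β = a/b, ω < β²n/d and
-- e ≥ βn yield ω n d < e². The counting compares two totals over m = n d (e+1) powers of x: the
-- z-degrees that powers of p cost the products, about n d k²/2, and the coefficients that may stay
-- nonzero, about m k e - ω m²/2. When ω n d is close to e², this m is close to the best value ke/ω,
-- and the gap of at least 1 between ω n d and e², multiplied by e+1, absorbs all rounding. Any
-- bound W on the coefficients of f will do, because it enters both counts in the same way and
-- cancels.
--
-- Two obstacles shape the rest. A representative of f modulo p need be neither monic nor of degree
-- d, so divisibility tests first recover one that is. And pairing doubles data at constant cost, so
-- a loop could build results of exponential size in few steps. Each loop is therefore compared with
-- the function that it computes, whose values are bounded directly; exponents and loop bounds are
-- unary, and polynomials are measured by a norm that is subadditive for products and takes the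
-- maximum for sums.

module PolynomialRing {c ℓ : Level} (A : CommutativeRing c ℓ) where
  open CommutativeRing A hiding (_-_)
  open Polynomial rawRing public hiding (rawRing)
  open SetoidReasoning setoid
  open CommutativeSemigroupProperties +-commutativeSemigroup using (interchange; x∙yz≈y∙xz)
  open CommutativeSemigroupProperties *-commutativeSemigroup using () renaming (x∙yz≈y∙xz to x*yz≈y*xz)
  open GroupProperties +-group using (ε⁻¹≈ε)

  coeff-+ : ∀ p q i → coeff (p +ₚ q) i ≈ coeff p i + coeff q i
  coeff-+ []      q       i       = sym (+-identityˡ _)
  coeff-+ (a ∷ p) []      i       = sym (+-identityʳ _)
  coeff-+ (a ∷ p) (b ∷ q) zero    = refl
  coeff-+ (a ∷ p) (b ∷ q) (suc i) = coeff-+ p q i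

  coeff-map-* : ∀ a p i → coeff (map (a *_) p) i ≈ a * coeff p i
  coeff-map-* a []      i       = sym (zeroʳ a)
  coeff-map-* a (b ∷ p) zero    = refl
  coeff-map-* a (b ∷ p) (suc i) = coeff-map-* a p i

  coeff-neg : ∀ p i → coeff (map -_ p) i ≈ - coeff p i
  coeff-neg []      i       = sym ε⁻¹≈ε
  coeff-neg (b ∷ p) zero    = refl
  coeff-neg (b ∷ p) (suc i) = coeff-neg p i

  coeff-∷* : ∀ a p q i →
             coeff ((a ∷ p) *ₚ q) i ≈ a * coeff q i + coeff (0# ∷ p *ₚ q) i
  coeff-∷* a p q i = trans (coeff-+ (map (a *_) q) _ i) (+-congʳ (coeff-map-* a q i))

  coeff-const* : ∀ a q i → coeff ((a ∷ []) *ₚ q) i ≈ a * coeff q i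
  coeff-const* a q i = trans (coeff-∷* a [] q i) (trans (+-congˡ (zeros i)) (+-identityʳ _))
    where
    zeros : ∀ i → coeff (0# ∷ []) i ≈ 0#
    zeros zero    = refl
    zeros (suc i) = refl

  coeff-++ˡ : ∀ p q r i → i ℕ.< length p → coeff (p ++ q) i ≡ coeff (p ++ r) i
  coeff-++ˡ (a ∷ p) q r zero    _       = ≡.refl
  coeff-++ˡ (a ∷ p) q r (suc i) (s≤s l) = coeff-++ˡ p q r i l

  coeff-++ʳ : ∀ p q i → coeff (p ++ q) (length p ℕ.+ i) ≡ coeff q i
  coeff-++ʳ []      q i = ≡.refl
  coeff-++ʳ (a ∷ p) q i = coeff-++ʳ p q i

  ∷-cong : ∀ {a b} p q → a ≈ b → p ≋ q → (a ∷ p) ≋ (b ∷ q)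
  ∷-cong p q a≈b p≋q zero    = a≈b
  ∷-cong p q a≈b p≋q (suc i) = p≋q i

  ≋-refl : ∀ p → p ≋ p
  ≋-refl p i = refl

  ≋-sym : ∀ p q → p ≋ q → q ≋ p
  ≋-sym p q p≋q i = sym (p≋q i)

  ≋-trans : ∀ p q r → p ≋ q → q ≋ r → p ≋ r
  ≋-trans p q r p≋q q≋r i = trans (p≋q i) (q≋r i)

  +ₚ-cong : ∀ p p′ q q′ → p ≋ p′ → q ≋ q′ → (p +ₚ q) ≋ (p′ +ₚ q′)
  +ₚ-cong p p′ q q′ e f i =
    trans (coeff-+ p q i) (trans (+-cong (e i) (f i)) (sym (coeff-+ p′ q′ i)))

  *ₚ-congˡ : ∀ p q q′ → q ≋ q′ → (p *ₚ q) ≋ (p *ₚ q′)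
  *ₚ-congˡ []      q q′ e i = refl
  *ₚ-congˡ (a ∷ p) q q′ e i = begin
    coeff ((a ∷ p) *ₚ q) i                  ≈⟨ coeff-∷* a p q i ⟩
    a * coeff q i + coeff (0# ∷ p *ₚ q) i   ≈⟨ +-cong (*-congˡ (e i)) (∷-cong _ _ refl (*ₚ-congˡ p q q′ e) i) ⟩
    a * coeff q′ i + coeff (0# ∷ p *ₚ q′) i ≈⟨ coeff-∷* a p q′ i ⟨
    coeff ((a ∷ p) *ₚ q′) i                 ∎

  *ₚ-zeroʳ : ∀ p → (p *ₚ []) ≋ []
  *ₚ-zeroʳ []      i       = refl
  *ₚ-zeroʳ (a ∷ p) zero    = refl
  *ₚ-zeroʳ (a ∷ p) (suc i) = *ₚ-zeroʳ p i

  -- The definition of `*ₚ` recurses on its first argument. This is the mirror recursion on the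
  -- second, from which commutativity follows by induction.
  *ₚ-∷ : ∀ p b q → (p *ₚ (b ∷ q)) ≋ (map (b *_) p +ₚ (0# ∷ p *ₚ q))
  *ₚ-∷ []      b q zero    = refl
  *ₚ-∷ []      b q (suc i) = refl
  *ₚ-∷ (a ∷ p) b q zero    = +-congʳ (*-comm a b)
  *ₚ-∷ (a ∷ p) b q (suc i) = begin
    coeff (map (a *_) q +ₚ p *ₚ (b ∷ q)) i                       ≈⟨ coeff-+ (map (a *_) q) _ i ⟩
    coeff (map (a *_) q) i + coeff (p *ₚ (b ∷ q)) i              ≈⟨ +-cong (coeff-map-* a q i) (*ₚ-∷ p b q i) ⟩
    a * coeff q i + coeff (map (b *_) p +ₚ (0# ∷ p *ₚ q)) i      ≈⟨ +-congˡ (coeff-+ (map (b *_) p) _ i) ⟩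
    a * coeff q i + (coeff (map (b *_) p) i + coeff (0# ∷ p *ₚ q) i) ≈⟨ x∙yz≈y∙xz _ _ _ ⟩
    coeff (map (b *_) p) i + (a * coeff q i + coeff (0# ∷ p *ₚ q) i) ≈⟨ +-congˡ (coeff-∷* a p q i) ⟨
    coeff (map (b *_) p) i + coeff ((a ∷ p) *ₚ q) i              ≈⟨ coeff-+ (map (b *_) p) _ i ⟨
    coeff (map (b *_) p +ₚ (a ∷ p) *ₚ q) i                       ∎

  *ₚ-comm : ∀ p q → (p *ₚ q) ≋ (q *ₚ p)
  *ₚ-comm []      q i = sym (*ₚ-zeroʳ q i)
  *ₚ-comm (a ∷ p) q i = trans
    (+ₚ-cong (map (a *_) q) (map (a *_) q) _ _ (λ _ → refl) (∷-cong _ _ refl (*ₚ-comm p q)) i)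
    (sym (*ₚ-∷ q a p i))

  -- Equal polynomials may be lists of different lengths, which makes induction along two equal
  -- first factors awkward; commutativity reduces that case to `*ₚ-congˡ`.
  *ₚ-cong : ∀ p p′ q q′ → p ≋ p′ → q ≋ q′ → (p *ₚ q) ≋ (p′ *ₚ q′)
  *ₚ-cong p p′ q q′ e f i = begin
    coeff (p *ₚ q) i   ≈⟨ *ₚ-congˡ p q q′ f i ⟩
    coeff (p *ₚ q′) i  ≈⟨ *ₚ-comm p q′ i ⟩
    coeff (q′ *ₚ p) i  ≈⟨ *ₚ-congˡ q′ p p′ e i ⟩
    coeff (q′ *ₚ p′) i ≈⟨ *ₚ-comm q′ p′ i ⟩
    coeff (p′ *ₚ q′) i ∎

  *ₚ-distribˡ : ∀ p q r → (p *ₚ (q +ₚ r)) ≋ (p *ₚ q +ₚ p *ₚ r)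
  *ₚ-distribˡ []      q r i = refl
  *ₚ-distribˡ (a ∷ p) q r i = begin
    coeff ((a ∷ p) *ₚ (q +ₚ r)) i
      ≈⟨ coeff-∷* a p (q +ₚ r) i ⟩
    a * coeff (q +ₚ r) i + coeff (0# ∷ p *ₚ (q +ₚ r)) i
      ≈⟨ +-cong (trans (*-congˡ (coeff-+ q r i)) (distribˡ a _ _)) (shift i) ⟩
    (a * coeff q i + a * coeff r i) + (coeff (0# ∷ p *ₚ q) i + coeff (0# ∷ p *ₚ r) i)
      ≈⟨ interchange _ _ _ _ ⟩
    (a * coeff q i + coeff (0# ∷ p *ₚ q) i) + (a * coeff r i + coeff (0# ∷ p *ₚ r) i)
      ≈⟨ +-cong (coeff-∷* a p q i) (coeff-∷* a p r i) ⟨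
    coeff ((a ∷ p) *ₚ q) i + coeff ((a ∷ p) *ₚ r) i
      ≈⟨ coeff-+ ((a ∷ p) *ₚ q) _ i ⟨
    coeff ((a ∷ p) *ₚ q +ₚ (a ∷ p) *ₚ r) i ∎
    where
    shift : ∀ i → coeff (0# ∷ p *ₚ (q +ₚ r)) i ≈ coeff (0# ∷ p *ₚ q) i + coeff (0# ∷ p *ₚ r) i
    shift zero    = sym (+-identityˡ 0#)
    shift (suc i) = trans (*ₚ-distribˡ p q r i) (coeff-+ (p *ₚ q) _ i)

  *ₚ-distribʳ : ∀ p q r → ((q +ₚ r) *ₚ p) ≋ (q *ₚ p +ₚ r *ₚ p)
  *ₚ-distribʳ p q r i = begin
    coeff ((q +ₚ r) *ₚ p) i     ≈⟨ *ₚ-comm (q +ₚ r) p i ⟩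
    coeff (p *ₚ (q +ₚ r)) i     ≈⟨ *ₚ-distribˡ p q r i ⟩
    coeff (p *ₚ q +ₚ p *ₚ r) i  ≈⟨ +ₚ-cong (p *ₚ q) (q *ₚ p) _ _ (*ₚ-comm p q) (*ₚ-comm p r) i ⟩
    coeff (q *ₚ p +ₚ r *ₚ p) i  ∎

  map-*-*ₚ : ∀ a q r → (map (a *_) q *ₚ r) ≋ map (a *_) (q *ₚ r)
  map-*-*ₚ a []      r i = refl
  map-*-*ₚ a (b ∷ q) r i = begin
    coeff ((a * b ∷ map (a *_) q) *ₚ r) i                             ≈⟨ coeff-∷* (a * b) (map (a *_) q) r i ⟩
    a * b * coeff r i + coeff (0# ∷ map (a *_) q *ₚ r) i              ≈⟨ +-cong (*-assoc a b _) (shift i) ⟩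
    a * (b * coeff r i) + a * coeff (0# ∷ q *ₚ r) i                   ≈⟨ distribˡ a _ _ ⟨
    a * (b * coeff r i + coeff (0# ∷ q *ₚ r) i)                       ≈⟨ *-congˡ (coeff-∷* b q r i) ⟨
    a * coeff ((b ∷ q) *ₚ r) i                                        ≈⟨ coeff-map-* a ((b ∷ q) *ₚ r) i ⟨
    coeff (map (a *_) ((b ∷ q) *ₚ r)) i                               ∎
    where
    shift : ∀ i → coeff (0# ∷ map (a *_) q *ₚ r) i ≈ a * coeff (0# ∷ q *ₚ r) i
    shift zero    = sym (zeroʳ a)
    shift (suc i) = trans (map-*-*ₚ a q r i) (coeff-map-* a (q *ₚ r) i)

  0∷-*ₚ : ∀ p q → ((0# ∷ p) *ₚ q) ≋ (0# ∷ p *ₚ q)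
  0∷-*ₚ p q i = trans (coeff-∷* 0# p q i) (trans (+-congʳ (zeroˡ _)) (+-identityˡ _))

  *ₚ-assoc : ∀ p q r → ((p *ₚ q) *ₚ r) ≋ (p *ₚ (q *ₚ r))
  *ₚ-assoc []      q r i = refl
  *ₚ-assoc (a ∷ p) q r i = begin
    coeff ((map (a *_) q +ₚ (0# ∷ p *ₚ q)) *ₚ r) i
      ≈⟨ *ₚ-distribʳ r (map (a *_) q) (0# ∷ p *ₚ q) i ⟩
    coeff (map (a *_) q *ₚ r +ₚ (0# ∷ p *ₚ q) *ₚ r) i
      ≈⟨ +ₚ-cong (map (a *_) q *ₚ r) (map (a *_) (q *ₚ r)) ((0# ∷ p *ₚ q) *ₚ r) (0# ∷ p *ₚ (q *ₚ r))
           (map-*-*ₚ a q r)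
           (λ j → trans (0∷-*ₚ (p *ₚ q) r j) (∷-cong _ _ refl (*ₚ-assoc p q r) j)) i ⟩
    coeff (map (a *_) (q *ₚ r) +ₚ (0# ∷ p *ₚ (q *ₚ r))) i ∎

  *ₚ-identityˡ : ∀ p → ((1# ∷ []) *ₚ p) ≋ p
  *ₚ-identityˡ p i = trans (coeff-const* 1# p i) (*-identityˡ _)

  polynomialRing : CommutativeRing c ℓ
  polynomialRing = record
    { Carrier = Poly
    ; _≈_ = _≋_
    ; _+_ = _+ₚ_
    ; _*_ = _*ₚ_
    ; -_ = map -_
    ; 0# = []
    ; 1# = 1# ∷ []
    ; isCommutativeRing = record
      { isRing = record
        { +-isAbelianGroup = record
          { isGroup = record
            { isMonoid = record
              { isSemigroup = record
                { isMagma = record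
                  { isEquivalence = record
                    { refl  = λ {p} → ≋-refl p
                    ; sym   = λ {p} {q} → ≋-sym p q
                    ; trans = λ {p} {q} {r} → ≋-trans p q r }
                  ; ∙-cong = λ {p} {p′} {q} {q′} → +ₚ-cong p p′ q q′ }
                ; assoc = λ p q r i → trans (coeff-+ (p +ₚ q) r i)
                    (trans (+-congʳ (coeff-+ p q i)) (trans (+-assoc _ _ _)
                    (sym (trans (coeff-+ p (q +ₚ r) i) (+-congˡ (coeff-+ q r i)))))) }
              ; identity = (λ p → ≋-refl p) ,
                  λ p i → trans (coeff-+ p [] i) (+-identityʳ _) }
            ; inverse =
                (λ p i → trans (coeff-+ (map -_ p) p i) (trans (+-congʳ (coeff-neg p i)) (-‿inverseˡ _))) ,
                (λ p i → trans (coeff-+ p (map -_ p) i) (trans (+-congˡ (coeff-neg p i)) (-‿inverseʳ _)))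
            ; ⁻¹-cong = λ {p} {q} e i →
                trans (coeff-neg p i) (trans (-‿cong (e i)) (sym (coeff-neg q i))) }
          ; comm = λ p q i → trans (coeff-+ p q i) (trans (+-comm _ _) (sym (coeff-+ q p i))) }
        ; *-cong = λ {p} {p′} {q} {q′} → *ₚ-cong p p′ q q′
        ; *-assoc = *ₚ-assoc
        ; *-identity = *ₚ-identityˡ ,
            λ p → ≋-trans (p *ₚ (1# ∷ [])) ((1# ∷ []) *ₚ p) p (*ₚ-comm p (1# ∷ [])) (*ₚ-identityˡ p)
        ; distrib = *ₚ-distribˡ , *ₚ-distribʳ }
      ; *-comm = *ₚ-comm } }

  eval-congʳ : ∀ p {v w} → v ≈ w → eval p v ≈ eval p w
  eval-congʳ []      e = refl
  eval-congʳ (a ∷ p) e = +-congˡ (*-cong e (eval-congʳ p e))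

  module _ (w : Carrier) where

    eval-≋[] : ∀ p → p ≋ [] → eval p w ≈ 0#
    eval-≋[] []      e = refl
    eval-≋[] (a ∷ p) e = begin
      a + w * eval p w ≈⟨ +-cong (e 0) (*-congˡ (eval-≋[] p (λ i → e (suc i)))) ⟩
      0# + w * 0#      ≈⟨ +-identityˡ _ ⟩
      w * 0#           ≈⟨ zeroʳ w ⟩
      0#               ∎

    eval-cong : ∀ p q → p ≋ q → eval p w ≈ eval q w
    eval-cong []      q       e = sym (eval-≋[] q (λ i → sym (e i)))
    eval-cong (a ∷ p) []      e = eval-≋[] (a ∷ p) e
    eval-cong (a ∷ p) (b ∷ q) e = +-cong (e 0) (*-congˡ (eval-cong p q (λ i → e (suc i))))

    eval-+ : ∀ p q → eval (p +ₚ q) w ≈ eval p w + eval q w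
    eval-+ []      q       = sym (+-identityˡ _)
    eval-+ (a ∷ p) []      = sym (+-identityʳ _)
    eval-+ (a ∷ p) (b ∷ q) = begin
      a + b + w * eval (p +ₚ q) w             ≈⟨ +-congˡ (trans (*-congˡ (eval-+ p q)) (distribˡ w _ _)) ⟩
      a + b + (w * eval p w + w * eval q w)   ≈⟨ interchange _ _ _ _ ⟩
      (a + w * eval p w) + (b + w * eval q w) ∎

    eval-map-* : ∀ a p → eval (map (a *_) p) w ≈ a * eval p w
    eval-map-* a []      = sym (zeroʳ a)
    eval-map-* a (b ∷ p) = begin
      a * b + w * eval (map (a *_) p) w ≈⟨ +-congˡ (*-congˡ (eval-map-* a p)) ⟩
      a * b + w * (a * eval p w)        ≈⟨ +-congˡ (x*yz≈y*xz w a _) ⟩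
      a * b + a * (w * eval p w)        ≈⟨ distribˡ a b _ ⟨
      a * (b + w * eval p w)            ∎

    eval-* : ∀ p q → eval (p *ₚ q) w ≈ eval p w * eval q w
    eval-* []      q = sym (zeroˡ _)
    eval-* (a ∷ p) q = begin
      eval (map (a *_) q +ₚ (0# ∷ p *ₚ q)) w           ≈⟨ eval-+ (map (a *_) q) _ ⟩
      eval (map (a *_) q) w + (0# + w * eval (p *ₚ q) w)
        ≈⟨ +-cong (eval-map-* a q) (trans (+-identityˡ _) (*-congˡ (eval-* p q))) ⟩
      a * eval q w + w * (eval p w * eval q w)         ≈⟨ +-congˡ (*-assoc w _ _) ⟨
      a * eval q w + w * eval p w * eval q w           ≈⟨ distribʳ _ a _ ⟨
      (a + w * eval p w) * eval q w                    ∎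

    eval-const : ∀ a → eval (a ∷ []) w ≈ a
    eval-const a = trans (+-congˡ (zeroʳ w)) (+-identityʳ a)

  -- The leading coefficient a may be zero.
  HasLead : Poly → ℕ → Carrier → Set ℓ
  HasLead p n a = coeff p n ≈ a × (∀ i → n ℕ.< i → coeff p i ≈ 0#)

  -- Allowing zero leads makes the rule valid over every commutative ring. It serves for x over
  -- `F[z]`, where the lead is a polynomial in z, and for z over the field.
  lead-* : ∀ p q {m n a b} → HasLead p m a → HasLead q n b → HasLead (p *ₚ q) (m ℕ.+ n) (a * b)
  lead-* [] q (0≈a , _) _ = trans (sym (zeroˡ _)) (*-congʳ 0≈a) , λ _ _ → refl
  -- All of `p` vanishes here, although the list need not be empty, so only the product of the
  -- constant term with `q` is left.
  lead-* (x ∷ p) q {zero} {n} {a} {b} (x≈a , p₀) (q≈b , q₀) =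
    trans (eq n) (*-cong x≈a q≈b) , λ i n<i → trans (eq i) (trans (*-congˡ (q₀ i n<i)) (zeroʳ x))
    where
    pq₀ : (p *ₚ q) ≋ []
    pq₀ = ≋-trans (p *ₚ q) ([] *ₚ q) [] (*ₚ-cong p [] q q (λ i → p₀ (suc i) (s≤s z≤n)) (≋-refl q)) (≋-refl [])
    tail₀ : ∀ i → coeff (0# ∷ p *ₚ q) i ≈ 0#
    tail₀ zero    = refl
    tail₀ (suc i) = pq₀ i
    eq : ∀ i → coeff ((x ∷ p) *ₚ q) i ≈ x * coeff q i
    eq i = trans (coeff-∷* x p q i) (trans (+-congˡ (tail₀ i)) (+-identityʳ _))
  lead-* (x ∷ p) q {suc m} {n} {a} {b} (p≈a , p₀) lq@(q≈b , q₀) =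
    trans (eq (m ℕ.+ n) (s≤s (ℕₚ.m≤n+m n m))) (proj₁ ih) , higher
    where
    ih = lead-* p q {m} {n} (p≈a , λ i m<i → p₀ (suc i) (s≤s m<i)) lq
    eq : ∀ i → n ℕ.< suc i → coeff ((x ∷ p) *ₚ q) (suc i) ≈ coeff (p *ₚ q) i
    eq i n<i = trans (coeff-∷* x p q (suc i))
      (trans (+-congʳ (trans (*-congˡ (q₀ (suc i) n<i)) (zeroʳ x))) (+-identityˡ _))
    higher : ∀ i → suc (m ℕ.+ n) ℕ.< i → coeff ((x ∷ p) *ₚ q) i ≈ 0#
    higher (suc i) (s≤s m+n<i) =
      trans (eq i (s≤s (ℕₚ.≤-trans (ℕₚ.m≤n+m n m) (ℕₚ.<⇒≤ m+n<i)))) (proj₂ ih i m+n<i)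

  open Exponentiation semiring public using () renaming (_^_ to _^ᶜ_)
  open Exponentiation (CommutativeRing.semiring polynomialRing) public using (_^_)

  X : Poly
  X = 0# ∷ 1# ∷ []

  lead-resp : ∀ p {n a b} → a ≈ b → HasLead p n a → HasLead p n b
  lead-resp p a≈b (e , p₀) = trans e a≈b , p₀

  lead-const : ∀ a → HasLead (a ∷ []) 0 a
  lead-const a = refl , λ where (suc i) _ → refl

  lead-X : HasLead X 1 1#
  lead-X = refl , λ where
    (suc (suc i)) _ → refl
    (suc zero) (s≤s ())

  lead-^ : ∀ p {n a} k → HasLead p n a → HasLead (p ^ k) (k ℕ.* n) (a ^ᶜ k)
  lead-^ p zero    l = lead-const 1#
  lead-^ p (suc k) l = lead-* p (p ^ k) l (lead-^ p k l)

  lead-monomial : ∀ {p q r s m n o t a b c d} i j k l →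
    HasLead p m a → HasLead q n b → HasLead r o c → HasLead s t d →
    HasLead (p ^ i *ₚ (q ^ j *ₚ (r ^ k *ₚ s ^ l))) (i ℕ.* m ℕ.+ (j ℕ.* n ℕ.+ (k ℕ.* o ℕ.+ l ℕ.* t)))
            (a ^ᶜ i * (b ^ᶜ j * (c ^ᶜ k * d ^ᶜ l)))
  lead-monomial {p} {q} {r} {s} i j k l lp lq lr ls =
    lead-* (p ^ i) (q ^ j *ₚ (r ^ k *ₚ s ^ l)) (lead-^ p i lp)
      (lead-* (q ^ j) (r ^ k *ₚ s ^ l) (lead-^ q j lq)
        (lead-* (r ^ k) (s ^ l) (lead-^ r k lr) (lead-^ s l ls)))

  1^≈1 : ∀ k → 1# ^ᶜ k ≈ 1#
  1^≈1 zero    = refl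
  1^≈1 (suc k) = trans (*-identityˡ _) (1^≈1 k)

  eval-^ : ∀ w p k → eval (p ^ k) w ≈ eval p w ^ᶜ k
  eval-^ w p zero    = eval-const w 1#
  eval-^ w p (suc k) = trans (eval-* w p (p ^ k)) (*-congˡ (eval-^ w p k))

-- Fil s d a says that a, multiplied by a factor of degree s, has degree at most d.

record Filtration {c ℓ : Level} (A : CommutativeRing c ℓ) : Set (Level.suc (c ⊔ ℓ)) where
  open CommutativeRing A hiding (_-_)
  field
    Fil       : ℕ → ℕ → Carrier → Set ℓ
    fil-resp  : ∀ {s d a b} → a ≈ b → Fil s d a → Fil s d b
    fil-0     : ∀ {s d} → Fil s d 0#
    fil-+     : ∀ {s d a b} → Fil s d a → Fil s d b → Fil s d (a + b)
    fil-*     : ∀ {s t d e a b} → Fil s d a → Fil t e b → Fil (s ℕ.+ t) (d ℕ.+ e) (a * b)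
    fil-1     : Fil 0 0 1#
    fil-shift : ∀ {s d a} t → Fil (s ℕ.+ t) (d ℕ.+ t) a → Fil s d a

  open Exponentiation semiring using (_^_)

  fil-^ : ∀ {d a} k → Fil 0 d a → Fil 0 (k ℕ.* d) (a ^ k)
  fil-^ zero    v = fil-1
  fil-^ (suc k) v = fil-* v (fil-^ k v)

  fil-monomial : ∀ {x y z w d₁ d₂ d₃ d₄} i j k l → Fil 0 d₁ x → Fil 0 d₂ y → Fil 0 d₃ z → Fil 0 d₄ w →
    Fil 0 (i ℕ.* d₁ ℕ.+ (j ℕ.* d₂ ℕ.+ (k ℕ.* d₃ ℕ.+ l ℕ.* d₄))) (x ^ i * (y ^ j * (z ^ k * w ^ l)))
  fil-monomial i j k l x y z w = fil-* (fil-^ i x) (fil-* (fil-^ j y) (fil-* (fil-^ k z) (fil-^ l w)))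

module WeightedFiltration {c ℓ : Level} {A : CommutativeRing c ℓ} (V : Filtration A) (W : ℕ) where
  open CommutativeRing A hiding (_-_)
  open PolynomialRing A
  open Filtration V

  -- The weight `W * i` of a power of x is charged to the factor `s` and not subtracted from the
  -- bound `d`. This avoids truncated subtraction and lets weightings be nested.
  Filₚ : ℕ → ℕ → Poly → Set ℓ
  Filₚ s d p = ∀ i → Fil (s ℕ.+ W ℕ.* i) d (coeff p i)

  private
    Fil-subst : ∀ {s t d a} → s ≡ t → Fil s d a → Fil t d a
    Fil-subst {d = d} {a} = subst (λ s → Fil s d a)

    tail : ∀ {s d a} p → Filₚ s d (a ∷ p) → Filₚ (s ℕ.+ W) d p
    tail {s} p v i = Fil-subst (eq s W i) (v (suc i))
      where
      eq : ∀ s W i → s ℕ.+ W ℕ.* suc i ≡ s ℕ.+ W ℕ.+ W ℕ.* i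
      eq = solve-∀

    head : ∀ {s d a} p → Filₚ s d (a ∷ p) → Fil s d a
    head {s} p v = Fil-subst (eq s W) (v 0)
      where
      eq : ∀ s W → s ℕ.+ W ℕ.* 0 ≡ s
      eq = solve-∀

  filₚ-* : ∀ {s t d e} p q → Filₚ s d p → Filₚ t e q → Filₚ (s ℕ.+ t) (d ℕ.+ e) (p *ₚ q)
  filₚ-* []      q v w i = fil-0
  filₚ-* {s} {t} {d} {e} (a ∷ p) q v w i =
    fil-resp (sym (coeff-∷* a p q i)) (fil-+ (Fil-subst (eq₁ s t W i) (fil-* (head p v) (w i))) (rest i))
    where
    eq₁ : ∀ s t W i → s ℕ.+ (t ℕ.+ W ℕ.* i) ≡ s ℕ.+ t ℕ.+ W ℕ.* i
    eq₁ = solve-∀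
    eq₂ : ∀ s t W i → s ℕ.+ W ℕ.+ t ℕ.+ W ℕ.* i ≡ s ℕ.+ t ℕ.+ W ℕ.* suc i
    eq₂ = solve-∀
    rest : ∀ i → Fil (s ℕ.+ t ℕ.+ W ℕ.* i) (d ℕ.+ e) (coeff (0# ∷ p *ₚ q) i)
    rest zero    = fil-0
    rest (suc i) = Fil-subst (eq₂ s t W i) (filₚ-* p q (tail p v) w i)

  weighted : Filtration polynomialRing
  weighted = record
    { Fil       = Filₚ
    ; fil-resp  = λ e v i → fil-resp (e i) (v i)
    ; fil-0     = λ i → fil-0
    ; fil-+     = λ {s} {d} {p} {q} v w i → fil-resp (sym (coeff-+ p q i)) (fil-+ (v i) (w i))
    ; fil-*     = λ {s} {t} {d} {e} {p} {q} → filₚ-* p q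
    ; fil-1     = λ where
        zero    → Fil-subst (≡.sym (ℕₚ.*-zeroʳ W)) fil-1
        (suc i) → fil-0
    ; fil-shift = λ {s} t v i → fil-shift t (Fil-subst (eq s t W i) (v i))
    }
    where
    eq : ∀ s t W i → s ℕ.+ t ℕ.+ W ℕ.* i ≡ s ℕ.+ W ℕ.* i ℕ.+ t
    eq = solve-∀

  -- A factor x of weight W is replaced by an element of degree at most W, so the degree cannot
  -- rise. In Horner's rule the extra W appears on both sides, and `fil-shift` removes it.
  fil-eval : ∀ {s d w} p → Fil 0 W w → Filₚ s d p → Fil s d (eval p w)
  fil-eval []      w∈ v = fil-0
  fil-eval {s} {d} (a ∷ p) w∈ v = fil-+ (head p v) (fil-shift W
    (Fil-subst (ℕₚ.+-identityˡ _) (Fil-d (ℕₚ.+-comm W d) (fil-* w∈ (fil-eval p w∈ (tail p v))))))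
    where
    Fil-d : ∀ {s d e a} → d ≡ e → Fil s d a → Fil s e a
    Fil-d {s} {a = a} = subst (λ d → Fil s d a)

module _ {c ℓ : Level} (A : CommutativeRing c ℓ) where
  open CommutativeRing A hiding (_-_)

  -- A nonzero constant has degree zero, so its product with a factor of degree s has degree s; for
  -- s > d the constant has to be zero.
  constantFiltration : Filtration A
  constantFiltration = record
    { Fil       = λ s d a → d ℕ.< s → a ≈ 0#
    ; fil-resp  = λ a≈b v d<s → trans (sym a≈b) (v d<s)
    ; fil-0     = λ _ → refl
    ; fil-+     = λ v w d<s → trans (+-cong (v d<s) (w d<s)) (+-identityˡ 0#)
    ; fil-*     = fil-*
    ; fil-1     = λ ()
    ; fil-shift = λ t v d<s → v (ℕₚ.+-monoˡ-< t d<s)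
    }
    where
    fil-* : ∀ {s t d e a b} → (d ℕ.< s → a ≈ 0#) → (e ℕ.< t → b ≈ 0#) →
            d ℕ.+ e ℕ.< s ℕ.+ t → a * b ≈ 0#
    fil-* {s} {t} {d} {e} v w d+e<s+t with d ℕₚ.<? s | e ℕₚ.<? t
    ... | yes d<s | _       = trans (*-congʳ (v d<s)) (zeroˡ _)
    ... | no  _   | yes e<t = trans (*-congˡ (w e<t)) (zeroʳ _)
    ... | no  d≮s | no  e≮t = contradiction d+e<s+t
      (ℕₚ.≤⇒≯ (ℕₚ.+-mono-≤ (ℕₚ.≮⇒≥ d≮s) (ℕₚ.≮⇒≥ e≮t)))

-- A measure that takes the maximum under sums. It bounds a product of polynomials by the sum of two
-- norms, however many terms are added up in each coefficient.
record Norm {c ℓ : Level} (R : RawRing c ℓ) : Set c where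
  open RawRing R
  field
    norm   : Carrier → ℕ
    norm-0 : norm 0# ≡ 0
    norm-1 : norm 1# ℕ.≤ 1
    norm-+ : ∀ a b → norm (a + b) ℕ.≤ norm a ℕ.⊔ norm b
    norm-* : ∀ a b → norm (a * b) ℕ.≤ norm a ℕ.+ norm b

module PolynomialNorm {c ℓ : Level} {R : RawRing c ℓ} (N : Norm R) where
  open RawRing R
  open Polynomial R
  open Norm N

  -- The maximum of the length of the list and the norms of its entries; `suc (length p)` is the
  -- length of the whole list.
  normₚ : Poly → ℕ
  normₚ []      = 0
  normₚ (a ∷ p) = norm a ℕ.⊔ (suc (length p) ℕ.⊔ normₚ p)

  length≤normₚ : ∀ p → length p ℕ.≤ normₚ p
  length≤normₚ []      = z≤n
  length≤normₚ (a ∷ p) = ℕₚ.≤-trans (ℕₚ.m≤m⊔n (suc (length p)) (normₚ p)) (ℕₚ.m≤n⊔m (norm a) _)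

  coeffs≤normₚ : ∀ p → All (λ a → norm a ℕ.≤ normₚ p) p
  coeffs≤normₚ []      = []
  coeffs≤normₚ (a ∷ p) = ℕₚ.m≤m⊔n (norm a) _ ∷
    All.map (λ ≤p → ℕₚ.≤-trans ≤p (ℕₚ.≤-trans (ℕₚ.m≤n⊔m (suc (length p)) _) (ℕₚ.m≤n⊔m (norm a) _))) (coeffs≤normₚ p)

  normₚ-lub : ∀ {N} p → length p ℕ.≤ N → All (λ a → norm a ℕ.≤ N) p → normₚ p ℕ.≤ N
  normₚ-lub []      _ _        = z≤n
  normₚ-lub (a ∷ p) l (a≤ ∷ v) = ℕₚ.⊔-lub a≤ (ℕₚ.⊔-lub l (normₚ-lub p (ℕₚ.≤-trans (ℕₚ.n≤1+n _) l) v))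

  length-+ₚ : ∀ p q → length (p +ₚ q) ≡ length p ℕ.⊔ length q
  length-+ₚ []      q       = ≡.refl
  length-+ₚ (a ∷ p) []      = ≡.refl
  length-+ₚ (a ∷ p) (b ∷ q) = ≡.cong suc (length-+ₚ p q)

  All-+ₚ : ∀ {N} p q → All (λ a → norm a ℕ.≤ N) p → All (λ a → norm a ℕ.≤ N) q →
           All (λ a → norm a ℕ.≤ N) (p +ₚ q)
  All-+ₚ []      q       v        w        = w
  All-+ₚ (a ∷ p) []      v        w        = v
  All-+ₚ (a ∷ p) (b ∷ q) (a≤ ∷ v) (b≤ ∷ w) =
    ℕₚ.≤-trans (norm-+ a b) (ℕₚ.⊔-lub a≤ b≤) ∷ All-+ₚ p q v w

  length-*ₚ : ∀ p q → length (p *ₚ q) ℕ.≤ length p ℕ.+ length q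
  length-*ₚ []      q = z≤n
  length-*ₚ (a ∷ p) q = begin
    length (map (a *_) q +ₚ (0# ∷ p *ₚ q))           ≡⟨ length-+ₚ (map (a *_) q) _ ⟩
    length (map (a *_) q) ℕ.⊔ suc (length (p *ₚ q))  ≡⟨ ≡.cong (ℕ._⊔ _) (length-map (a *_) q) ⟩
    length q ℕ.⊔ suc (length (p *ₚ q))               ≤⟨ ℕₚ.⊔-lub (ℕₚ.m≤n+m _ (suc (length p))) (s≤s (length-*ₚ p q)) ⟩
    suc (length p) ℕ.+ length q                      ∎
    where open ℕₚ.≤-Reasoning

  All-*ₚ : ∀ {M N} p q → All (λ a → norm a ℕ.≤ M) p → All (λ a → norm a ℕ.≤ N) q →
           All (λ a → norm a ℕ.≤ M ℕ.+ N) (p *ₚ q)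
  All-*ₚ []      q v        w = []
  All-*ₚ {M} {N} (a ∷ p) q (a≤ ∷ v) w = All-+ₚ (map (a *_) q) _
    (Allₚ.map⁺ (All.map (λ {b} b≤ → ℕₚ.≤-trans (norm-* a b) (ℕₚ.+-mono-≤ a≤ b≤)) w))
    (ℕₚ.≤-trans (ℕₚ.≤-reflexive norm-0) z≤n ∷ All-*ₚ p q v w)

  polynomialNorm : Norm (Polynomial.rawRing R)
  polynomialNorm = record
    { norm   = normₚ
    ; norm-0 = ≡.refl
    ; norm-1 = ℕₚ.⊔-lub norm-1 ℕₚ.≤-refl
    ; norm-+ = λ p q → normₚ-lub (p +ₚ q)
        (ℕₚ.≤-trans (ℕₚ.≤-reflexive (length-+ₚ p q)) (ℕₚ.⊔-mono-≤ (length≤normₚ p) (length≤normₚ q)))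
        (All-+ₚ p q (All.map (λ ≤p → ℕₚ.≤-trans ≤p (ℕₚ.m≤m⊔n _ _)) (coeffs≤normₚ p))
                    (All.map (λ ≤q → ℕₚ.≤-trans ≤q (ℕₚ.m≤n⊔m (normₚ p) _)) (coeffs≤normₚ q)))
    ; norm-* = λ p q → normₚ-lub (p *ₚ q)
        (ℕₚ.≤-trans (length-*ₚ p q) (ℕₚ.+-mono-≤ (length≤normₚ p) (length≤normₚ q)))
        (All-*ₚ p q (coeffs≤normₚ p) (coeffs≤normₚ q))
    }

-- Divisibility, degrees and greatest common divisors

module RingDivisibility {c ℓ : Level} (A : CommutativeRing c ℓ) where
  open CommutativeRing A hiding (_-_)
  open Exponentiation semiring using (_^_)
  open RawMagmaDefinitions *-rawMagma public using (_∣_; _,_)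
  open MonoidDivisibility *-monoid public using () renaming (∣ʳ-refl to ∣-refl; ∣ʳ-trans to ∣-trans)
  open Exponentiation semiring public using (^-homo-*; ^-assocʳ; ^-congˡ)
  open CommutativeSemigroupProperties *-commutativeSemigroup using () renaming (interchange to *-interchange)
  open RingProperties ring using (-‿distribˡ-*; -‿involutive; -‿+-comm)

  ∣-resp : ∀ {h} x y → x ≈ y → h ∣ x → h ∣ y
  ∣-resp x y x≈y (q , e) = q , trans e x≈y

  ∣-0 : ∀ {h} → h ∣ 0#
  ∣-0 {h} = 0# , zeroˡ h

  ∣-+ : ∀ {h x y} → h ∣ x → h ∣ y → h ∣ x + y
  ∣-+ {h} (q , e) (r , f) = q + r , trans (distribʳ h q r) (+-cong e f)

  ∣-neg : ∀ {h x} → h ∣ x → h ∣ - x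
  ∣-neg {h} (q , e) = - q , trans (sym (-‿distribˡ-* q h)) (-‿cong e)

  ∣-*ˡ : ∀ {h y} x → h ∣ y → h ∣ x * y
  ∣-*ˡ {h} x (q , e) = x * q , trans (*-assoc x q h) (*-congˡ e)

  ∣-+-cancel : ∀ {h x y} → h ∣ x + y → h ∣ y → h ∣ x
  ∣-+-cancel {h} {x} {y} h∣x+y h∣y = ∣-resp (x + y + - y) x
    (trans (+-assoc x y (- y)) (trans (+-congˡ (-‿inverseʳ y)) (+-identityʳ x)))
    (∣-+ h∣x+y (∣-neg h∣y))

  ∣-flip : ∀ {h} x y → h ∣ x + - y → h ∣ y + - x
  ∣-flip x y h∣x-y = ∣-resp (- (x + - y)) (y + - x)
    (trans (sym (-‿+-comm x (- y))) (trans (+-congˡ (-‿involutive y)) (+-comm (- x) y))) (∣-neg h∣x-y)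

  *-mono-∣ : ∀ {g h x y} → g ∣ x → h ∣ y → g * h ∣ x * y
  *-mono-∣ {g} {h} (q , e) (r , f) = q * r , trans (*-interchange q r g h) (*-cong e f)

  ^-mono-∣ : ∀ {g x} k → g ∣ x → g ^ k ∣ x ^ k
  ^-mono-∣ zero    _   = ∣-refl
  ^-mono-∣ (suc k) g∣x = *-mono-∣ g∣x (^-mono-∣ k g∣x)

  ^-∣-^ : ∀ g {k m} → k ℕ.≤ m → g ^ k ∣ g ^ m
  ^-∣-^ g {k} {m} k≤m = g ^ (m ℕ.∸ k) , trans (sym (^-homo-* g (m ℕ.∸ k) k)) (reflexive (≡.cong (g ^_) (ℕₚ.m∸n+n≡m k≤m)))

  -- The exponents i and `k ∸ i` add up to at least k; for i beyond k the truncation leaves the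
  -- power of x alone, which is more than enough.
  ^-∣-^*^ : ∀ {g x y} k i → g ∣ x → g ∣ y → g ^ k ∣ x ^ i * y ^ (k ℕ.∸ i)
  ^-∣-^*^ {g} k i g∣x g∣y = ∣-trans (^-∣-^ g (ℕₚ.m≤n+m∸n k i))
    (∣-trans (1# , trans (*-identityˡ _) (^-homo-* g i (k ℕ.∸ i)))
      (*-mono-∣ (^-mono-∣ i g∣x) (^-mono-∣ (k ℕ.∸ i) g∣y)))

  module _ where
    open PolynomialRing A renaming (_^_ to _P^_)

    module _ {h : Carrier} (w : Carrier) where

      ∣-eval-+ : ∀ P Q → h ∣ eval P w → h ∣ eval Q w → h ∣ eval (P +ₚ Q) w
      ∣-eval-+ P Q h∣P h∣Q = ∣-resp (eval P w + eval Q w) _ (sym (eval-+ w P Q)) (∣-+ h∣P h∣Q)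

      ∣-eval-*ˡ : ∀ P Q → h ∣ eval Q w → h ∣ eval (P *ₚ Q) w
      ∣-eval-*ˡ P Q h∣Q = ∣-resp (eval P w * eval Q w) _ (sym (eval-* w P Q)) (∣-*ˡ (eval P w) h∣Q)

    ∣-eval-^*^ : ∀ {g} w f p k i → g ∣ eval f w → g ∣ p →
                 g ^ᶜ k ∣ eval (f P^ i *ₚ (p ∷ []) P^ (k ℕ.∸ i)) w
    ∣-eval-^*^ w f p k i g∣f g∣p = ∣-resp _ _
      (sym (trans (eval-* w (f P^ i) ((p ∷ []) P^ (k ℕ.∸ i))) (*-cong (eval-^ w f i)
        (trans (eval-^ w (p ∷ []) (k ℕ.∸ i)) (^-congˡ (k ℕ.∸ i) (eval-const w p))))))
      (^-∣-^*^ k i g∣f g∣p)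

    -- f(w) is (f - g)(w) + g(w), and h divides every coefficient of f - g.
    ∣-eval-≡mod : ∀ {h} f g w → (∀ i → h ∣ coeff f i + - coeff g i) → h ∣ eval g w → h ∣ eval f w
    ∣-eval-≡mod {h} f g w f≡g h∣g =
      ∣-resp (eval (f +ₚ map -_ g +ₚ g) w) (eval f w) (eval-cong w (f +ₚ map -_ g +ₚ g) f f-g+g≋f)
        (∣-resp (eval (f +ₚ map -_ g) w + eval g w) _ (sym (eval-+ w (f +ₚ map -_ g) g))
          (∣-+ (∣-eval (f +ₚ map -_ g) λ i → ∣-resp (coeff f i + - coeff g i) _
            (sym (trans (coeff-+ f (map -_ g) i) (+-congˡ (coeff-neg g i)))) (f≡g i)) h∣g))
      where
      ∣-eval : ∀ {h} p → (∀ i → h ∣ coeff p i) → h ∣ eval p w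
      ∣-eval []      v = ∣-0
      ∣-eval (a ∷ p) v = ∣-+ (v 0) (∣-*ˡ w (∣-eval p λ i → v (suc i)))
      f-g+g≋f : (f +ₚ map -_ g +ₚ g) ≋ f
      f-g+g≋f = P.trans {f +ₚ map -_ g +ₚ g} {f +ₚ (map -_ g +ₚ g)} {f} (P.+-assoc f (map -_ g) g)
        (P.trans {f +ₚ (map -_ g +ₚ g)} {f +ₚ []} {f}
          (P.+-cong {f} {f} {map -_ g +ₚ g} {[]} (P.refl {f}) (P.-‿inverseˡ g)) (P.+-identityʳ f))
        where module P = CommutativeRing polynomialRing

module _ {A : Set} (t : A → Bool) (r : A → A) where

  stripCons : A → List A → List A
  stripCons a []       = if t a then [] else r a ∷ []
  stripCons a (b ∷ bs) = a ∷ b ∷ bs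

  -- Deletes the longest suffix of elements passing the test and applies r to
  -- the last element that remains.
  strip : List A → List A
  strip = foldr stripCons []

module FieldPolynomials {ℓ₁ ℓ₂ : Level} (F : DiscreteField ℓ₁ ℓ₂) where
  open DiscreteField F using (_#_; _#?_; inverse; #⇒invertible; invertible⇒#; tight; #-irrefl)

  commutativeRing : CommutativeRing 0ℓ ℓ₁
  commutativeRing = record { isCommutativeRing = DiscreteField.isCommutativeRing F }

  open CommutativeRing commutativeRing hiding (_-_)
  open PolynomialRing commutativeRing public
  open SetoidReasoning setoid
  open RingProperties ring using (-0#≈0#; -‿distribˡ-*)

  module K = CommutativeRing polynomialRing
  open RingDivisibility polynomialRing public
  open GCD K.rawRing public using (IsGCD)

  isZero : Carrier → Bool
  isZero a = not (does (a #? 0#))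

  _≈0? : ∀ a → Dec (a ≈ 0#)
  a ≈0? with a #? 0#
  ... | yes a#0 = no λ a≈0 → #-irrefl a≈0 a#0
  ... | no ¬a#0 = yes (proj₁ (tight a 0#) ¬a#0)

  isZero-true : ∀ a → isZero a ≡ true → a ≈ 0#
  isZero-true a e with a #? 0#
  ... | no ¬a#0 = proj₁ (tight a 0#) ¬a#0

  isZero-false : ∀ a → isZero a ≡ false → ¬ a ≈ 0#
  isZero-false a e a≈0 with a #? 0#
  ... | yes a#0 = #-irrefl a≈0 a#0

  inverse-* : ∀ a → ¬ a ≈ 0# → inverse a * a ≈ 1#
  inverse-* a a≉0 with a #? 0#
  ... | no ¬a#0 = contradiction (proj₁ (tight a 0#) ¬a#0) a≉0
  ... | yes a#0 with #⇒invertible a#0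
  ... | b , b[a-0]≈1 , _ = trans (*-congˡ (sym (trans (+-congˡ -0#≈0#) (+-identityʳ a)))) b[a-0]≈1

  1≉0 : ¬ 1# ≈ 0#
  1≉0 1≈0 = #-irrefl 1≈0 (invertible⇒# (1# , inv , trans (*-comm _ 1#) inv))
    where
    inv : 1# * (1# + - 0#) ≈ 1#
    inv = trans (*-identityˡ _) (trans (+-congˡ -0#≈0#) (+-identityʳ 1#))

  *-≉0 : ∀ {a b} → ¬ a ≈ 0# → ¬ b ≈ 0# → ¬ a * b ≈ 0#
  *-≉0 {a} {b} a≉0 b≉0 ab≈0 = b≉0 (begin
    b                   ≈⟨ *-identityˡ b ⟨
    1# * b              ≈⟨ *-congʳ (inverse-* a a≉0) ⟨
    inverse a * a * b   ≈⟨ *-assoc _ a b ⟩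
    inverse a * (a * b) ≈⟨ *-congˡ ab≈0 ⟩
    inverse a * 0#      ≈⟨ zeroʳ _ ⟩
    0#                  ∎)

  lead⇒degree : ∀ {p n a} → HasLead p n a → ¬ a ≈ 0# → HasDegree p n
  lead⇒degree (p≈a , p₀) a≉0 = (λ p≈0 → a≉0 (trans (sym p≈a) p≈0)) , p₀

  degree-* : ∀ p q {m n} → HasDegree p m → HasDegree q n → HasDegree (p *ₚ q) (m ℕ.+ n)
  degree-* p q (p≉0 , p₀) (q≉0 , q₀) =
    lead⇒degree {p *ₚ q} (lead-* p q (refl , p₀) (refl , q₀)) (*-≉0 p≉0 q≉0)

  degree-1 : HasDegree (1# ∷ []) 0
  degree-1 = 1≉0 , λ where (suc m) _ → refl

  degree-^ : ∀ p {m} k → HasDegree p m → HasDegree (p ^ k) (k ℕ.* m)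
  degree-^ p zero    d = degree-1
  degree-^ p (suc k) d = degree-* p (p ^ k) d (degree-^ p k d)

  degree-cong : ∀ {p q n} → p ≋ q → HasDegree p n → HasDegree q n
  degree-cong {p} {q} {n} p≋q (p≉0 , p₀) =
    (λ q≈0 → p≉0 (trans (p≋q n) q≈0)) , λ i n<i → trans (sym (p≋q i)) (p₀ i n<i)

  degree-unique : ∀ {p m n} → HasDegree p m → HasDegree p n → m ≡ n
  degree-unique {p} {m} {n} (pm , pm₀) (pn , pn₀) with ℕₚ.<-cmp m n
  ... | tri< m<n _ _ = contradiction (pm₀ n m<n) pn
  ... | tri≈ _ m≡n _ = m≡n
  ... | tri> _ _ n<m = contradiction (pn₀ m n<m) pm

  coeff-≥length : ∀ p i → length p ℕ.≤ i → coeff p i ≈ 0#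
  coeff-≥length []      i       _       = refl
  coeff-≥length (a ∷ p) (suc i) (s≤s l) = coeff-≥length p i l

  degree? : ∀ p → p ≋ [] ⊎ ∃[ n ] HasDegree p n
  degree? []      = inj₁ (λ _ → refl)
  degree? (a ∷ p) with degree? p
  ... | inj₂ (n , p≉0 , p₀) = inj₂ (suc n , p≉0 , λ where (suc i) (s≤s n<i) → p₀ i n<i)
  ... | inj₁ p≋0 with a ≈0?
  ...   | yes a≈0 = inj₁ λ where
    zero    → a≈0
    (suc i) → p≋0 i
  ...   | no  a≉0 = inj₂ (0 , a≉0 , λ where (suc i) _ → p≋0 i)

  ∣⇒degree≤ : ∀ p q {m n} → p ∣ q → HasDegree p m → HasDegree q n → m ℕ.≤ n
  ∣⇒degree≤ p q {m} {n} (r , rp≋q) dp dq with degree? r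
  ... | inj₁ r≋0 = contradiction
    (trans (sym (rp≋q n)) (*ₚ-cong r [] p p r≋0 (λ _ → refl) n)) (proj₁ dq)
  ... | inj₂ (k , dr) = ℕₚ.≤-trans (ℕₚ.m≤n+m m k)
    (ℕₚ.≤-reflexive (degree-unique {q} (degree-cong {r *ₚ p} {q} rp≋q (degree-* r p dr dp)) dq))

  -- In this way divisibility by a power of g, together with a degree bound, becomes an exact root.
  ∣⇒≋[] : ∀ p q {m} → p ∣ q → HasDegree p m → (∀ i → m ℕ.≤ i → coeff q i ≈ 0#) → q ≋ []
  ∣⇒≋[] p q p∣q dp q₀ with degree? q
  ... | inj₁ q≋0 = q≋0
  ... | inj₂ (n , dq) = contradiction (q₀ n (∣⇒degree≤ p q p∣q dp dq)) (proj₁ dq)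

  -- The cofactor has degree zero, hence is a nonzero constant, and its inverse is the cofactor for
  -- the converse.
  ∣-same-degree : ∀ p q {m} → p ∣ q → HasDegree p m → HasDegree q m → q ∣ p
  ∣-same-degree p q {m} (r , rp≋q) dp dq with degree? r
  ... | inj₁ r≋0 = contradiction
    (trans (sym (rp≋q m)) (*ₚ-cong r [] p p r≋0 (λ _ → refl) m)) (proj₁ dq)
  ... | inj₂ (k , dr) = (b ∷ []) , λ i → begin
      coeff ((b ∷ []) *ₚ q) i        ≈⟨ coeff-const* b q i ⟩
      b * coeff q i                  ≈⟨ *-congˡ (rp≋q i) ⟨
      b * coeff (r *ₚ p) i           ≈⟨ *-congˡ (*ₚ-cong r (coeff r 0 ∷ []) p p r≋const (λ _ → refl) i) ⟩
      b * coeff ((coeff r 0 ∷ []) *ₚ p) i ≈⟨ *-congˡ (coeff-const* (coeff r 0) p i) ⟩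
      b * (coeff r 0 * coeff p i)    ≈⟨ *-assoc b _ _ ⟨
      b * coeff r 0 * coeff p i      ≈⟨ *-congʳ (inverse-* (coeff r 0) (subst (λ k → ¬ coeff r k ≈ 0#) k≡0 (proj₁ dr))) ⟩
      1# * coeff p i                 ≈⟨ *-identityˡ _ ⟩
      coeff p i                      ∎
    where
    b = inverse (coeff r 0)
    k≡0 : k ≡ 0
    k≡0 = ℕₚ.+-cancelʳ-≡ m k 0
      (degree-unique {q} (degree-cong {r *ₚ p} {q} rp≋q (degree-* r p dr dp)) dq)
    r≋const : r ≋ (coeff r 0 ∷ [])
    r≋const zero    = refl
    r≋const (suc i) = proj₂ dr (suc i) (ℕₚ.≤-<-trans (ℕₚ.≤-reflexive k≡0) (s≤s z≤n))

  opaque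
    trim : Poly → Poly
    trim = strip isZero Function.id

  Trimmed : Poly → Set ℓ₁
  Trimmed p = ∀ n → length p ≡ suc n → ¬ coeff p n ≈ 0#

  private
    stripCons-≋ : ∀ a p → stripCons isZero Function.id a p ≋ (a ∷ p)
    stripCons-≋ a (b ∷ p) i = refl
    stripCons-≋ a [] with isZero a in eq
    ... | false = λ _ → refl
    ... | true  = λ where
      zero    → sym (isZero-true a eq)
      (suc i) → refl

    stripCons-trimmed : ∀ a p → Trimmed p → Trimmed (stripCons isZero Function.id a p)
    stripCons-trimmed a (b ∷ p) t (suc n) e = t n (ℕₚ.suc-injective e)
    stripCons-trimmed a [] t with isZero a in eq
    ... | false = λ where zero _ → isZero-false a eq
    ... | true  = λ _ ()

  opaque
    unfolding trim

    trim-≋ : ∀ p → trim p ≋ p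
    trim-≋ []      i = refl
    trim-≋ (a ∷ p) i = trans (stripCons-≋ a (trim p) i) (∷-cong (trim p) p refl (trim-≋ p) i)

    trim-trimmed : ∀ p → Trimmed (trim p)
    trim-trimmed []      _ ()
    trim-trimmed (a ∷ p) = stripCons-trimmed a (trim p) (trim-trimmed p)

  trimmed-length≤ : ∀ p {N} → Trimmed p → (∀ i → N ℕ.≤ i → coeff p i ≈ 0#) → length p ℕ.≤ N
  trimmed-length≤ []      t p₀ = z≤n
  trimmed-length≤ (a ∷ p) t p₀ = ℕₚ.≰⇒> λ N≤n → t (length p) ≡.refl (p₀ (length p) N≤n)

  trimmed-degree : ∀ p {n} → Trimmed p → length p ≡ suc n → HasDegree p n
  trimmed-degree p t e = t _ e , λ i n<i → coeff-≥length p i (ℕₚ.≤-trans (ℕₚ.≤-reflexive e) n<i)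

  degree⇒trimmed-length : ∀ p {n} → Trimmed p → HasDegree p n → length p ≡ suc n
  degree⇒trimmed-length []      t d = contradiction refl (proj₁ d)
  degree⇒trimmed-length (a ∷ p) t d = ≡.cong suc (degree-unique {a ∷ p} (trimmed-degree (a ∷ p) t ≡.refl) d)

  trim-length≤ : ∀ p {N} → (∀ i → N ℕ.≤ i → coeff p i ≈ 0#) → length (trim p) ℕ.≤ N
  trim-length≤ p p₀ = trimmed-length≤ (trim p) (trim-trimmed p) λ i N≤i → trans (trim-≋ p i) (p₀ i N≤i)

  lead-X^ : ∀ k → HasLead (X ^ k) k 1#
  lead-X^ k = subst (λ n → HasLead (X ^ k) n 1#) (ℕₚ.*-identityʳ k)
    (lead-resp (X ^ k) (1^≈1 k) (lead-^ X k lead-X))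

  last : Poly → Carrier
  last p = coeff p (length (drop 1 p))

  lead-last : ∀ a p → HasLead (a ∷ p) (length p) (last (a ∷ p))
  lead-last a p = refl , coeff-≥length (a ∷ p)

  -- One term of long division, sign included: minus the ratio of the leading coefficients, times z
  -- to the difference of the lengths. The exponent is the length of what `drop` leaves, because
  -- programs hold exponents in unary.
  quotientTerm : Poly → Poly → Poly
  quotientTerm u v = (- (last u * inverse (last v)) ∷ []) *ₚ X ^ length (drop (length v) u)

  cancel : Poly → Poly → Poly
  cancel u v = trim (u +ₚ quotientTerm u v *ₚ v)

  -- As `v` is trimmed, its last coefficient is invertible and the top terms cancel. The alternative
  -- is an empty `v`, where Euclid's algorithm has already ended.
  cancel-length≤ : ∀ u v → Trimmed v → length v ℕ.≤ length u →
                   length (cancel u v) ℕ.≤ length u × (v ≡ [] ⊎ suc (length (cancel u v)) ℕ.≤ length u)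
  cancel-length≤ u [] t _ = trim-length≤ (u +ₚ quotientTerm u [] *ₚ []) (λ i u≤i → begin
      coeff (u +ₚ quotientTerm u [] *ₚ []) i            ≈⟨ coeff-+ u (quotientTerm u [] *ₚ []) i ⟩
      coeff u i + coeff (quotientTerm u [] *ₚ []) i     ≈⟨ +-cong (coeff-≥length u i u≤i) (*ₚ-zeroʳ (quotientTerm u []) i) ⟩
      0# + 0#                                           ≈⟨ +-identityˡ 0# ⟩
      0#                                                ∎) , inj₁ ≡.refl
  cancel-length≤ u@(a ∷ u′) v@(b ∷ v′) t (s≤s v≤u) = ℕₚ.≤-trans (ℕₚ.n≤1+n _) shorter , inj₂ shorter
    where
    c = - (last u * inverse (last v))
    k = length (drop (length v) u)
    quotient = quotientTerm u v
    k+v : k ℕ.+ length v′ ≡ length u′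
    k+v = ≡.trans (≡.cong (ℕ._+ length v′) (length-drop (length v′) u′)) (ℕₚ.m∸n+n≡m v≤u)
    lead : HasLead (quotient *ₚ v) (length u′) (c * 1# * last v)
    lead = subst (λ n → HasLead (quotient *ₚ v) n (c * 1# * last v)) k+v
      (lead-* quotient v (lead-* (c ∷ []) (X ^ k) (lead-const c) (lead-X^ k)) (lead-last b v′))
    top : last u + c * 1# * last v ≈ 0#
    top = begin
      last u + c * 1# * last v                            ≈⟨ +-congˡ (*-congʳ (*-identityʳ c)) ⟩
      last u + - (last u * inverse (last v)) * last v     ≈⟨ +-congˡ (-‿distribˡ-* _ _) ⟨
      last u + - (last u * inverse (last v) * last v)     ≈⟨ +-congˡ (-‿cong (*-assoc _ _ _)) ⟩
      last u + - (last u * (inverse (last v) * last v))   ≈⟨ +-congˡ (-‿cong (*-congˡ (inverse-* (last v) (t (length v′) ≡.refl)))) ⟩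
      last u + - (last u * 1#)                            ≈⟨ +-congˡ (-‿cong (*-identityʳ _)) ⟩
      last u + - last u                                   ≈⟨ -‿inverseʳ _ ⟩
      0#                                                  ∎
    vanish : ∀ i → length u′ ℕ.≤ i → coeff (u +ₚ quotient *ₚ v) i ≈ 0#
    vanish i u≤i with ℕₚ.m≤n⇒m<n∨m≡n u≤i
    ... | inj₁ u<i = trans (coeff-+ u (quotient *ₚ v) i) (trans (+-cong (coeff-≥length u i u<i) (proj₂ lead i u<i)) (+-identityˡ 0#))
    ... | inj₂ ≡.refl = trans (coeff-+ u (quotient *ₚ v) i) (trans (+-congˡ (proj₁ lead)) top)
    shorter : suc (length (cancel u v)) ℕ.≤ length u
    shorter = s≤s (trim-length≤ (u +ₚ quotient *ₚ v) vanish)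

  ∣-cancel : ∀ {h} u v → h ∣ v → h ∣ u → h ∣ cancel u v
  ∣-cancel u v h∣v h∣u = ∣-resp (u +ₚ quotientTerm u v *ₚ v) (cancel u v)
    (λ i → sym (trim-≋ (u +ₚ quotientTerm u v *ₚ v) i)) (∣-+ h∣u (∣-*ˡ (quotientTerm u v) h∣v))

  ∣-cancel⁻ : ∀ {h} u v → h ∣ v → h ∣ cancel u v → h ∣ u
  ∣-cancel⁻ u v h∣v h∣c = ∣-+-cancel {x = u}
    (∣-resp (cancel u v) (u +ₚ quotientTerm u v *ₚ v) (trim-≋ (u +ₚ quotientTerm u v *ₚ v)) h∣c)
    (∣-*ˡ (quotientTerm u v) h∣v)

  -- The first argument is drop (length u) v, empty if v is not longer than u.
  reduceBy : Poly → Poly → Poly → Poly × Poly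
  reduceBy []      u v = cancel u v , v
  reduceBy (_ ∷ _) u v = u , cancel v u

  euclidStep : Poly × Poly → Poly × Poly
  euclidStep (u , v) = reduceBy (drop (length u) v) u v

  -- The invariant of the loop. `progress` is the potential argument: until a component is empty,
  -- every round shortens the pair by at least one. `lengths` is kept apart because rounds continue
  -- after the end, and the program needs a size bound there too.
  record EuclidState (x y : Poly) (rounds bound : ℕ) (st : Poly × Poly) : Set ℓ₁ where
    field
      trimmed₁ : Trimmed (proj₁ st)
      trimmed₂ : Trimmed (proj₂ st)
      to       : ∀ {h} → h ∣ x → h ∣ y → h ∣ proj₁ st × h ∣ proj₂ st
      from     : ∀ {h} → h ∣ proj₁ st → h ∣ proj₂ st → h ∣ x × h ∣ y
      lengths  : length (proj₁ st) ℕ.+ length (proj₂ st) ℕ.≤ bound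
      progress : (proj₁ st ≡ [] ⊎ proj₂ st ≡ []) ⊎
                 rounds ℕ.+ (length (proj₁ st) ℕ.+ length (proj₂ st)) ℕ.≤ bound

  open EuclidState

  []-length≤ : ∀ (p : Poly) → length p ℕ.≤ 0 → p ≡ []
  []-length≤ [] _ = ≡.refl

  reduceBy-state : ∀ {x y r b} d u v → d ≡ drop (length u) v →
                   EuclidState x y r b (u , v) → EuclidState x y (suc r) b (reduceBy d u v)
  reduceBy-state {r = r} [] u v eq s = record
    { trimmed₁ = trim-trimmed (u +ₚ quotientTerm u v *ₚ v)
    ; trimmed₂ = trimmed₂ s
    ; to       = λ h∣x h∣y → let h∣u , h∣v = to s h∣x h∣y in ∣-cancel u v h∣v h∣u , h∣v
    ; from     = λ h∣c h∣v → from s (∣-cancel⁻ u v h∣v h∣c) h∣v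
    ; lengths  = ℕₚ.≤-trans (ℕₚ.+-monoˡ-≤ (length v) (proj₁ shorter)) (lengths s)
    ; progress = progress′ (proj₂ shorter) (progress s)
    }
    where
    v≤u : length v ℕ.≤ length u
    v≤u = ℕₚ.m∸n≡0⇒m≤n (≡.trans (≡.sym (length-drop (length u) v)) (≡.cong length (≡.sym eq)))
    shorter = cancel-length≤ u v (trimmed₂ s) v≤u
    progress′ : v ≡ [] ⊎ suc (length (cancel u v)) ℕ.≤ length u → _ → _
    progress′ (inj₁ v≡[]) _ = inj₁ (inj₂ v≡[])
    progress′ (inj₂ _) (inj₁ (inj₂ v≡[])) = inj₁ (inj₂ v≡[])
    progress′ (inj₂ _) (inj₁ (inj₁ u≡[])) =
      inj₁ (inj₂ ([]-length≤ v (ℕₚ.≤-trans v≤u (ℕₚ.≤-reflexive (≡.cong length u≡[])))))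
    progress′ (inj₂ c<u) (inj₂ p) = inj₂ (ℕₚ.≤-trans
      (ℕₚ.≤-trans (ℕₚ.≤-reflexive (≡.sym (ℕₚ.+-suc r _))) (ℕₚ.+-monoʳ-≤ r (ℕₚ.+-monoˡ-≤ (length v) c<u))) p)
  reduceBy-state {r = r} {b} (e ∷ d) u v eq s = record
    { trimmed₁ = trimmed₁ s
    ; trimmed₂ = trim-trimmed (v +ₚ quotientTerm v u *ₚ u)
    ; to       = λ h∣x h∣y → let h∣u , h∣v = to s h∣x h∣y in h∣u , ∣-cancel v u h∣u h∣v
    ; from     = λ h∣u h∣c → from s h∣u (∣-cancel⁻ v u h∣u h∣c)
    ; lengths  = ℕₚ.≤-trans (ℕₚ.+-monoʳ-≤ (length u) (proj₁ shorter)) (lengths s)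
    ; progress = progress′ (proj₂ shorter) (progress s)
    }
    where
    u<v : length u ℕ.< length v
    u<v = ℕₚ.≰⇒> λ v≤u → contradiction
      (≡.trans (≡.cong length eq) (≡.trans (length-drop (length u) v) (ℕₚ.m≤n⇒m∸n≡0 v≤u))) (λ ())
    shorter = cancel-length≤ v u (trimmed₁ s) (ℕₚ.<⇒≤ u<v)
    progress′ : u ≡ [] ⊎ suc (length (cancel v u)) ℕ.≤ length v → _ → _
    progress′ (inj₁ u≡[]) _ = inj₁ (inj₁ u≡[])
    progress′ (inj₂ _) (inj₁ (inj₁ u≡[])) = inj₁ (inj₁ u≡[])
    progress′ (inj₂ _) (inj₁ (inj₂ v≡[])) =
      contradiction (ℕₚ.≤-trans u<v (ℕₚ.≤-reflexive (≡.cong length v≡[]))) (λ ())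
    progress′ (inj₂ c<v) (inj₂ p) = inj₂ (ℕₚ.≤-trans
      (ℕₚ.≤-trans (ℕₚ.≤-reflexive (≡.sym (≡.trans (≡.cong (r ℕ.+_) (ℕₚ.+-suc (length u) _)) (ℕₚ.+-suc r _))))
        (ℕₚ.+-monoʳ-≤ r (ℕₚ.+-monoʳ-≤ (length u) c<v))) p)

  euclid : ∀ {B : Set} → Poly × Poly → List B → Poly × Poly
  euclid = foldr (λ _ → euclidStep)

  euclid-state : ∀ {B : Set} x y (fuel : List B) →
    EuclidState x y (length fuel) (length (trim x) ℕ.+ length (trim y)) (euclid (trim x , trim y) fuel)
  euclid-state x y [] = record
    { trimmed₁ = trim-trimmed x
    ; trimmed₂ = trim-trimmed y
    ; to       = λ h∣x h∣y → ∣-resp x _ (λ i → sym (trim-≋ x i)) h∣x , ∣-resp y _ (λ i → sym (trim-≋ y i)) h∣y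
    ; from     = λ h∣x h∣y → ∣-resp (trim x) x (trim-≋ x) h∣x , ∣-resp (trim y) y (trim-≋ y) h∣y
    ; lengths  = ℕₚ.≤-refl
    ; progress = inj₂ ℕₚ.≤-refl
    }
  euclid-state x y (_ ∷ fuel) = reduceBy-state _ _ _ ≡.refl (euclid-state x y fuel)

  opaque
    -- The total length falls in every round until a component is empty, so its initial value is
    -- enough rounds, and `trim x ++ trim y` has that length. In the end the sum is the component
    -- that remains.
    gcd : Poly → Poly → Poly
    gcd x y = let st = euclid (trim x , trim y) (trim x ++ trim y) in proj₁ st +ₚ proj₂ st

  private
    sum-trimmed : ∀ u v → u ≡ [] ⊎ v ≡ [] → Trimmed u → Trimmed v → Trimmed (u +ₚ v)
    sum-trimmed u v (inj₁ ≡.refl) tu tv = tv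
    sum-trimmed [] v (inj₂ ≡.refl) tu tv = tv
    sum-trimmed (a ∷ u) v (inj₂ ≡.refl) tu tv = tu

    sum-gcd : ∀ u v → u ≡ [] ⊎ v ≡ [] → IsGCD (u +ₚ v) u v
    sum-gcd u v e = record
      { divides₁ = sum∣₁ u v e
      ; divides₂ = sum∣₂ u v e
      ; greatest = λ h h∣u h∣v → ∣-+ {h} {u} {v} h∣u h∣v
      }
      where
      sum∣₁ : ∀ u v → u ≡ [] ⊎ v ≡ [] → (u +ₚ v) ∣ u
      sum∣₁ u v (inj₁ ≡.refl) = ∣-0
      sum∣₁ [] v (inj₂ ≡.refl) = ∣-0
      sum∣₁ (a ∷ u) v (inj₂ ≡.refl) = ∣-refl
      sum∣₂ : ∀ u v → u ≡ [] ⊎ v ≡ [] → (u +ₚ v) ∣ v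
      sum∣₂ u v (inj₁ ≡.refl) = ∣-refl
      sum∣₂ u v (inj₂ ≡.refl) = ∣-0

    euclid-final : ∀ x y → let st = euclid (trim x , trim y) (trim x ++ trim y) in proj₁ st ≡ [] ⊎ proj₂ st ≡ []
    euclid-final x y with progress (euclid-state x y (trim x ++ trim y))
    ... | inj₁ done = done
    ... | inj₂ p    = inj₁ (exhausted u v S (subst (λ r → r ℕ.+ (length u ℕ.+ length v) ℕ.≤ S) (length-++ (trim x)) p))
      where
      S = length (trim x) ℕ.+ length (trim y)
      u = proj₁ (euclid (trim x , trim y) (trim x ++ trim y))
      v = proj₂ (euclid (trim x , trim y) (trim x ++ trim y))
      exhausted : ∀ u v S → S ℕ.+ (length u ℕ.+ length v) ℕ.≤ S → u ≡ []
      exhausted u v S p = []-length≤ u (ℕₚ.≤-trans (ℕₚ.m≤m+n (length u) (length v))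
        (ℕₚ.+-cancelˡ-≤ S (length u ℕ.+ length v) 0 (ℕₚ.≤-trans p (ℕₚ.≤-reflexive (≡.sym (ℕₚ.+-identityʳ S))))))

  opaque
    unfolding gcd

    gcd-trimmed : ∀ x y → Trimmed (gcd x y)
    gcd-trimmed x y = let s = euclid-state x y (trim x ++ trim y) in
      sum-trimmed _ _ (euclid-final x y) (trimmed₁ s) (trimmed₂ s)

    gcd-isGCD : ∀ x y → IsGCD (gcd x y) x y
    gcd-isGCD x y =
      let s = euclid-state x y (trim x ++ trim y)
          g = sum-gcd _ _ (euclid-final x y)
      in record
        { divides₁ = proj₁ (from s (IsGCD.divides₁ g) (IsGCD.divides₂ g))
        ; divides₂ = proj₂ (from s (IsGCD.divides₁ g) (IsGCD.divides₂ g))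
        ; greatest = λ h h∣x h∣y → let h∣u , h∣v = to s h∣x h∣y in IsGCD.greatest g h h∣u h∣v
        }

module _ {A : Set} (t : A → Bool) (r : A → A) where
  private
    stripCons-++ : ∀ a as b → stripCons t r a (as ++ b ∷ []) ≡ a ∷ as ++ b ∷ []
    stripCons-++ a []       b = ≡.refl
    stripCons-++ a (_ ∷ as) b = ≡.refl

  strip-split : ∀ as →
    (strip t r as ≡ [] × All (λ a → t a ≡ true) as) ⊎
    (∃[ pre ] ∃[ a ] ∃[ post ] as ≡ pre ++ a ∷ post × strip t r as ≡ pre ++ r a ∷ [] ×
       t a ≡ false × All (λ a → t a ≡ true) post)
  strip-split []       = inj₁ (≡.refl , [])
  strip-split (a ∷ as) with strip-split as
  ... | inj₂ (pre , b , post , as≡ , strip≡ , tb , tpost) =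
    inj₂ (a ∷ pre , b , post , ≡.cong (a ∷_) as≡ ,
      ≡.trans (≡.cong (stripCons t r a) strip≡) (stripCons-++ a pre (r b)) , tb , tpost)
  ... | inj₁ (strip≡ , tas) with t a in ta
  ...   | true  = inj₁ (≡.trans (≡.cong (stripCons t r a) strip≡) (≡.cong (λ b → if b then [] else r a ∷ []) ta) , ta ∷ tas)
  ...   | false = inj₂ ([] , a , as , ≡.refl ,
      ≡.trans (≡.cong (stripCons t r a) strip≡) (≡.cong (λ b → if b then [] else r a ∷ []) ta) , ta , tas)

-- Monic representatives modulo p

module Monicisation {ℓ₁ ℓ₂ : Level} (F : DiscreteField ℓ₁ ℓ₂) where
  open FieldPolynomials F
  open CommutativeRing commutativeRing hiding (_-_)
  open RingProperties ring using (-‿involutive)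
  private module B = PolynomialRing polynomialRing

  -- The gcd of c and p divides p, so for p nonzero it is as long as the trimmed p only if it is
  -- associated to p, that is, if p divides c.
  divisibleBy : Poly → Poly → Bool
  divisibleBy p c = null (drop (length (gcd c p)) (trim p))

  opaque
    -- Modulo p, the leading coefficient of a monic polynomial is the last one
    -- that is not divisible by p.
    monicise : Poly → B.Poly → B.Poly
    monicise p = strip (divisibleBy p) (λ _ → K.1#)

  module _ {p : Poly} {n : ℕ} (p-degree : HasDegree p n) where

    length-trim : length (trim p) ≡ suc n
    length-trim = degree⇒trimmed-length (trim p) (trim-trimmed p)
      (degree-cong {p} {trim p} (λ i → sym (trim-≋ p i)) p-degree)

    gcd-degree : ∀ c → ∃[ m ] HasDegree (gcd c p) m × length (gcd c p) ≡ suc m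
    gcd-degree c with degree? (gcd c p)
    ... | inj₂ (m , d) = m , d , degree⇒trimmed-length (gcd c p) (gcd-trimmed c p) d
    ... | inj₁ g≋0 with IsGCD.divides₂ (gcd-isGCD c p)
    ...   | q , qg≋p = contradiction
      (trans (sym (qg≋p n)) (trans (*ₚ-cong q q (gcd c p) [] (λ _ → refl) g≋0 n) (*ₚ-zeroʳ q n)))
      (proj₁ p-degree)

    private
      null-drop : ∀ (xs : Poly) m → null (drop m xs) ≡ true → length xs ℕ.≤ m
      null-drop []       m       _ = z≤n
      null-drop (x ∷ xs) (suc m) e = s≤s (null-drop xs m e)

      null-drop⁻ : ∀ (xs : Poly) m → null (drop m xs) ≡ false → m ℕ.< length xs
      null-drop⁻ (x ∷ xs) zero    e = s≤s z≤n
      null-drop⁻ (x ∷ xs) (suc m) e = s≤s (null-drop⁻ xs m e)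
      null-drop⁻ []       zero    ()
      null-drop⁻ []       (suc m) ()

    divisibleBy-true : ∀ c → divisibleBy p c ≡ true → p ∣ c
    divisibleBy-true c e with gcd-degree c
    ... | m , g-degree , length-g = ∣-trans
      (∣-same-degree (gcd c p) p (IsGCD.divides₂ g) (subst (HasDegree (gcd c p)) m≡n g-degree) p-degree)
      (IsGCD.divides₁ g)
      where
      g = gcd-isGCD c p
      m≡n : m ≡ n
      m≡n = ℕₚ.≤-antisym (∣⇒degree≤ (gcd c p) p (IsGCD.divides₂ g) g-degree p-degree)
        (ℕ.s≤s⁻¹ (ℕₚ.≤-trans (ℕₚ.≤-reflexive (≡.sym length-trim))
          (ℕₚ.≤-trans (null-drop (trim p) _ e) (ℕₚ.≤-reflexive length-g))))

    divisibleBy-false : ∀ c → divisibleBy p c ≡ false → ¬ p ∣ c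
    divisibleBy-false c e p∣c with gcd-degree c
    ... | m , g-degree , length-g = ℕₚ.<⇒≱ m<n
      (∣⇒degree≤ p (gcd c p) (IsGCD.greatest (gcd-isGCD c p) p p∣c ∣-refl) p-degree g-degree)
      where
      m<n : m ℕ.< n
      m<n = ℕ.s≤s⁻¹ (ℕₚ.≤-trans (ℕₚ.≤-trans (ℕₚ.≤-reflexive (≡.cong suc (≡.sym length-g))) (null-drop⁻ (trim p) _ e))
        (ℕₚ.≤-reflexive length-trim))

    module _ (n>0 : 0 ℕ.< n) where

      ∤1 : ¬ p ∣ K.1#
      ∤1 p∣1 = ℕₚ.<⇒≱ n>0 (∣⇒degree≤ p K.1# p∣1 p-degree degree-1)

      private
        ∣-coeff : ∀ cs → All (λ c → divisibleBy p c ≡ true) cs → ∀ i → p ∣ B.coeff cs i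
        ∣-coeff []       _        i       = ∣-0
        ∣-coeff (c ∷ cs) (e ∷ _)  zero    = divisibleBy-true c e
        ∣-coeff (c ∷ cs) (_ ∷ es) (suc i) = ∣-coeff cs es i

        +-neg-≋[] : ∀ u v → u ≋ v → (u +ₚ map -_ v) ≋ []
        +-neg-≋[] u v u≋v i = trans (coeff-+ u (map -_ v) i) (trans (+-cong (u≋v i) (coeff-neg v i)) (-‿inverseʳ _))

      module _ (f f′ : B.Poly) {d : ℕ} (f-monic : B.HasLead f d K.1#)
               (f≡f′ : ∀ i → p ∣ B.coeff f i +ₚ map -_ (B.coeff f′ i)) where

        private
          ∣-leading : ∀ {ℓ} {A : Set ℓ} → p ∣ B.coeff f′ d → A
          ∣-leading p∣f′d = contradiction
            (∣-resp (B.coeff f d) K.1# (proj₁ f-monic) (∣-+-cancel (f≡f′ d) (∣-neg p∣f′d))) ∤1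

          ∣-higher : ∀ i → d ℕ.< i → p ∣ B.coeff f′ i
          ∣-higher i d<i = ∣-resp (map -_ (map -_ c)) c (λ j → trans (coeff-neg (map -_ c) j)
              (trans (-‿cong (coeff-neg c j)) (-‿involutive (coeff c j))))
            (∣-neg (∣-resp (B.coeff f i +ₚ map -_ c) (map -_ c)
              (λ j → trans (coeff-+ (B.coeff f i) (map -_ c) j) (trans (+-congʳ (proj₂ f-monic i d<i j)) (+-identityˡ _)))
              (f≡f′ i)))
            where c = B.coeff f′ i

        -- The exact length is included because the program reads the degree d off the list.
        MonicForm : B.Poly → Set ℓ₁
        MonicForm h = B.HasLead h d K.1# × length h ≡ suc d × (∀ i → p ∣ B.coeff f i +ₚ map -_ (B.coeff h i))

        private
          -- Replacing `c` by 1 and what follows by 0 gives the coefficients that f itself has from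
          -- index d on; below d nothing changes.
          form : ∀ pre c post → f′ ≡ pre ++ c ∷ post → length pre ≡ d → MonicForm (pre ++ K.1# ∷ [])
          form pre c post f′≡ ≡.refl =
            ( (λ j → reflexive (≡.cong (λ q → coeff q j) at-d))
            , (λ i d<i j → reflexive (≡.cong (λ q → coeff q j) (above i d<i))))
            , ≡.trans (length-++ pre) (ℕₚ.+-comm (length pre) 1)
            , congruent
            where
            h = pre ++ K.1# ∷ []
            at-d : B.coeff h d ≡ K.1#
            at-d = ≡.trans (≡.cong (B.coeff h) (≡.sym (ℕₚ.+-identityʳ d))) (B.coeff-++ʳ pre (K.1# ∷ []) 0)
            above : ∀ i → d ℕ.< i → B.coeff h i ≡ []
            above i d<i = ≡.trans (≡.cong (B.coeff h) (≡.trans (≡.sym (ℕₚ.m+[n∸m]≡n d<i)) (≡.sym (ℕₚ.+-suc d _))))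
              (B.coeff-++ʳ pre (K.1# ∷ []) (suc (i ℕ.∸ suc d)))
            congruent : ∀ i → p ∣ B.coeff f i +ₚ map -_ (B.coeff h i)
            congruent i with ℕₚ.<-cmp i d
            ... | tri< i<d _ _ = subst (λ q → p ∣ B.coeff f i +ₚ map -_ q)
              (≡.trans (≡.cong (λ q → B.coeff q i) f′≡) (B.coeff-++ˡ pre (c ∷ post) (K.1# ∷ []) i i<d)) (f≡f′ i)
            ... | tri≈ _ ≡.refl _ = ∣-resp [] (B.coeff f d +ₚ map -_ (B.coeff h d))
              (λ j → sym (+-neg-≋[] (B.coeff f d) (B.coeff h d)
                (λ j → trans (proj₁ f-monic j) (reflexive (≡.cong (λ q → coeff q j) (≡.sym at-d)))) j)) ∣-0
            ... | tri> _ _ d<i = ∣-resp [] (B.coeff f i +ₚ map -_ (B.coeff h i))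
              (λ j → sym (+-neg-≋[] (B.coeff f i) (B.coeff h i)
                (λ j → trans (proj₂ f-monic i d<i j) (reflexive (≡.cong (λ q → coeff q j) (≡.sym (above i d<i))))) j)) ∣-0

        opaque
          unfolding monicise

          monicise-form : MonicForm (monicise p f′)
          monicise-form with strip-split (divisibleBy p) (λ _ → K.1#) f′
          ... | inj₁ (_ , all) = ∣-leading (∣-coeff f′ all d)
          ... | inj₂ (pre , c , post , f′≡ , strip≡ , c-false , post-true) =
            subst MonicForm (≡.sym strip≡) (form pre c post f′≡ length-pre)
            where
            at-c : B.coeff f′ (length pre) ≡ c
            at-c = ≡.trans (≡.cong₂ B.coeff f′≡ (≡.sym (ℕₚ.+-identityʳ (length pre)))) (B.coeff-++ʳ pre (c ∷ post) 0)
            length-pre : length pre ≡ d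
            -- The last coefficient that p does not divide stands at index d: above d all are
            -- multiples of p, and at d it is 1 modulo p, which p of positive degree does not
            -- divide.
            length-pre with ℕₚ.<-cmp (length pre) d
            ... | tri≈ _ e _ = e
            ... | tri> _ _ d<pre = contradiction (subst (p ∣_) at-c (∣-higher (length pre) d<pre)) (divisibleBy-false c c-false)
            ... | tri< pre<d _ _ = ∣-leading (subst (p ∣_) (≡.sym coeff≡) (∣-coeff post post-true (d ℕ.∸ suc (length pre))))
              where
              coeff≡ : B.coeff f′ d ≡ B.coeff post (d ℕ.∸ suc (length pre))
              coeff≡ = ≡.trans (≡.cong₂ B.coeff f′≡ (≡.trans (≡.sym (ℕₚ.m+[n∸m]≡n pre<d)) (≡.sym (ℕₚ.+-suc (length pre) _))))
                (B.coeff-++ʳ pre (c ∷ post) (suc (d ℕ.∸ suc (length pre))))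

-- Counting, elimination and interpolation

-- The top index comes first, as in `downFrom`, so that the sums match the lengths of the lists
-- built below.
Σ< : ℕ → (ℕ → ℕ) → ℕ
Σ< zero    f = 0
Σ< (suc n) f = f n ℕ.+ Σ< n f

module Counting where
  open import Data.Nat.Base using (_+_; _*_; _∸_; _<_; _≤_; pred)
  open ℕₚ.≤-Reasoning

  length-concatMap-downFrom : ∀ {A : Set} (f : ℕ → List A) n →
    length (concatMap f (downFrom n)) ≡ Σ< n (λ i → length (f i))
  length-concatMap-downFrom f zero    = ≡.refl
  length-concatMap-downFrom f (suc n) = ≡.trans (length-++ (f n))
    (≡.cong (length (f n) +_) (length-concatMap-downFrom f n))

  Σ-cong : ∀ n {f g} → (∀ i → i < n → f i ≡ g i) → Σ< n f ≡ Σ< n g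
  Σ-cong zero    e = ≡.refl
  Σ-cong (suc n) e = ≡.cong₂ _+_ (e n ℕₚ.≤-refl) (Σ-cong n λ i i<n → e i (ℕₚ.m≤n⇒m≤1+n i<n))

  Σ-+ : ∀ n f g → Σ< n f + Σ< n g ≡ Σ< n (λ i → f i + g i)
  Σ-+ zero    f g = ≡.refl
  Σ-+ (suc n) f g = ≡.trans (interchange (f n) (Σ< n f) (g n) (Σ< n g))
    (≡.cong (f n + g n +_) (Σ-+ n f g))
    where open CommutativeSemigroupProperties ℕₚ.+-commutativeSemigroup

  Σ-*ˡ : ∀ c n f → Σ< n (λ i → c * f i) ≡ c * Σ< n f
  Σ-*ˡ c zero    f = ≡.sym (ℕₚ.*-zeroʳ c)
  Σ-*ˡ c (suc n) f = ≡.trans (≡.cong (c * f n +_) (Σ-*ˡ c n f)) (≡.sym (ℕₚ.*-distribˡ-+ c (f n) _))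

  Σ-const : ∀ n c → Σ< n (λ _ → c) ≡ n * c
  Σ-const zero    c = ≡.refl
  Σ-const (suc n) c = ≡.cong (c +_) (Σ-const n c)

  Σ-split : ∀ m n f → Σ< (m + n) f ≡ Σ< m (λ i → f (i + n)) + Σ< n f
  Σ-split zero    n f = ≡.refl
  Σ-split (suc m) n f = ≡.trans (≡.cong (f (m + n) +_) (Σ-split m n f)) (≡.sym (ℕₚ.+-assoc (f (m + n)) _ _))

  -- Division with remainder: every index below K d is j + i d for exactly one pair with j < d.
  Σ-blocks : ∀ K d f → Σ< K (λ i → Σ< d (λ j → f (j + i * d))) ≡ Σ< (K * d) f
  Σ-blocks zero    d f = ≡.refl
  Σ-blocks (suc K) d f = ≡.trans (≡.cong (Σ< d (λ j → f (j + K * d)) +_) (Σ-blocks K d f))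
    (≡.sym (Σ-split d (K * d) f))

  -- The terms are k, k - 1, ... and vanish from i = k on, so the triangular number bounds the sum
  -- for every K. The induction also carries the triangular number of the part not yet summed.
  Σ-descending : ∀ k K → 2 * Σ< K (λ i → k ∸ i) ≤ k * suc k
  Σ-descending k K = ℕₚ.≤-trans (ℕₚ.m≤m+n _ _) (stronger K)
    where
    step : ∀ t → 2 * t + pred t * suc (pred t) ≤ t * suc t
    step zero    = z≤n
    step (suc t) = ℕₚ.≤-reflexive (eq t)
      where
      eq : ∀ t → 2 * suc t + t * suc t ≡ suc t * suc (suc t)
      eq = solve-∀
    stronger : ∀ K → 2 * Σ< K (λ i → k ∸ i) + (k ∸ K) * suc (k ∸ K) ≤ k * suc k
    stronger zero    = ℕₚ.≤-refl
    stronger (suc K) = begin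
      2 * (k ∸ K + S) + (k ∸ suc K) * suc (k ∸ suc K)       ≡⟨ ≡.cong (λ t → 2 * (k ∸ K + S) + t * suc t) (ℕₚ.pred[m∸n]≡m∸[1+n] k K) ⟨
      2 * (k ∸ K + S) + pred (k ∸ K) * suc (pred (k ∸ K))   ≡⟨ eq (k ∸ K) S (pred (k ∸ K)) ⟩
      2 * S + (2 * (k ∸ K) + pred (k ∸ K) * suc (pred (k ∸ K))) ≤⟨ ℕₚ.+-monoʳ-≤ (2 * S) (step (k ∸ K)) ⟩
      2 * S + (k ∸ K) * suc (k ∸ K)                         ≤⟨ stronger K ⟩
      k * suc k                                             ∎
      where
      S = Σ< K (λ i → k ∸ i)
      eq : ∀ t S u → 2 * (t + S) + u * suc u ≡ 2 * S + (2 * t + u * suc u)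
      eq = solve-∀

  -- Without truncation, twice the sum of c - r ω over r < m is 2 m c - ω m (m - 1). Truncation only
  -- enlarges terms, and the negative part is moved to the other side.
  Σ-arithmetic : ∀ c ω m → 2 * m * c + ω * m ≤ 2 * Σ< m (λ r → c ∸ r * ω) + ω * m * m
  Σ-arithmetic c ω zero    = ℕₚ.≤-reflexive (≡.trans (ℕₚ.*-zeroʳ ω) (≡.sym (ℕₚ.*-zeroʳ (ω * 0))))
  Σ-arithmetic c ω (suc m) = begin
    2 * suc m * c + ω * suc m
      ≡⟨ eq₁ c ω m ⟩
    2 * m * c + ω * m + (2 * c + ω)
      ≤⟨ ℕₚ.+-mono-≤ (Σ-arithmetic c ω m) (ℕₚ.+-monoˡ-≤ ω (ℕₚ.*-monoʳ-≤ 2 (ℕₚ.m≤n+m∸n c (m * ω)))) ⟩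
    2 * S + ω * m * m + (2 * (m * ω + (c ∸ m * ω)) + ω)
      ≡⟨ eq₂ (c ∸ m * ω) ω m S ⟩
    2 * (c ∸ m * ω + S) + ω * suc m * suc m ∎
    where
    S = Σ< m (λ r → c ∸ r * ω)
    eq₁ : ∀ c ω m → 2 * suc m * c + ω * suc m ≡ 2 * m * c + ω * m + (2 * c + ω)
    eq₁ = solve-∀
    eq₂ : ∀ t ω m S → 2 * S + ω * m * m + (2 * (m * ω + t) + ω) ≡ 2 * (t + S) + ω * suc m * suc m
    eq₂ = solve-∀

  module _ (n d e ω W : ℕ) where
    -- `multiplicity` is the exponent k and `rows` the number m of powers of x. Twice the number of
    -- coefficients that may be kept is about 2 m k e - ω m², largest at m = ke/ω; in the critical
    -- case ω n d ≈ e² this is about n d (e + 1), a value that also makes sense for ω = 0. The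
    -- summand ke + kn in `weight` keeps the subtractions from `weight` from being truncated.
    multiplicity blocks rows weight : ℕ
    multiplicity = e * suc e
    blocks       = n * suc e
    rows         = blocks * d
    weight       = W * rows + (multiplicity * e + multiplicity * n)

    room : ∀ r → r < rows → multiplicity * e + multiplicity * n ≤ weight ∸ W * r
    room r r<m = ℕₚ.≤-trans (ℕₚ.≤-reflexive (≡.sym (ℕₚ.m+n∸m≡n (W * rows) _)))
      (ℕₚ.∸-monoʳ-≤ weight (ℕₚ.*-monoʳ-≤ W (ℕₚ.<⇒≤ r<m)))

    -- The first counts the exponents a for which x^j z^a f^i p^(k ∸ i) has weight less than
    -- `weight`. The second counts, for each x^r, the z-exponents from ke ∸ rω up to the weight
    -- limit, whose coefficients have to vanish.
    itemCount coordinateCount : ℕ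
    itemCount       = Σ< blocks λ i → Σ< d λ j → weight ∸ (W * (j + i * d) + (multiplicity ∸ i) * n)
    coordinateCount = Σ< rows λ r → (weight ∸ W * r) ∸ (multiplicity * e ∸ r * ω)

    private
      k = multiplicity
      width : ℕ → ℕ
      width r = weight ∸ W * r

      row< : ∀ i j → i < blocks → j < d → j + i * d < rows
      row< i j i<K j<d = ℕₚ.<-≤-trans (ℕₚ.+-monoˡ-< (i * d) j<d) (ℕₚ.*-monoˡ-≤ d i<K)

      -- Both counts are the same sum of widths minus a correction, so W cancels and only the
      -- corrections are compared: the z-degrees spent on powers of p, and the coefficients allowed
      -- to survive.
      deficit gain : ℕ
      deficit = Σ< blocks λ i → Σ< d λ _ → (k ∸ i) * n
      gain    = Σ< rows λ r → k * e ∸ r * ω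

      item-total : itemCount + deficit ≡ Σ< rows width
      item-total = ≡.trans (Σ-+ blocks _ _) (≡.trans (Σ-cong blocks λ i i<K →
        ≡.trans (Σ-+ d _ _) (Σ-cong d λ j j<d →
          ≡.trans (≡.cong (_+ (k ∸ i) * n) (≡.sym (ℕₚ.∸-+-assoc weight (W * (j + i * d)) _)))
            (ℕₚ.m∸n+n≡m (ℕₚ.≤-trans (ℕₚ.*-monoˡ-≤ n (ℕₚ.m∸n≤m k i)) (ℕₚ.≤-trans (ℕₚ.m≤n+m (k * n) (k * e))
              (room _ (row< i j i<K j<d)))))))
        (Σ-blocks blocks d width))

      coordinate-total : coordinateCount + gain ≡ Σ< rows width
      coordinate-total = ≡.trans (Σ-+ rows _ _) (Σ-cong rows λ r r<m → ℕₚ.m∸n+n≡m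
        (ℕₚ.≤-trans (ℕₚ.m∸n≤m (k * e) (r * ω)) (ℕₚ.≤-trans (ℕₚ.m≤m+n (k * e) (k * n)) (room r r<m))))

      deficit≤ : 2 * deficit ≤ d * n * (k * suc k)
      deficit≤ = begin
        2 * deficit                             ≡⟨ ≡.cong (2 *_) (Σ-cong blocks λ i _ → ≡.trans (Σ-const d _) (eq₁ d n (k ∸ i))) ⟩
        2 * Σ< blocks (λ i → d * n * (k ∸ i))   ≡⟨ ≡.cong (2 *_) (Σ-*ˡ (d * n) blocks _) ⟩
        2 * (d * n * Σ< blocks (λ i → k ∸ i))   ≡⟨ eq₂ (d * n) _ ⟩
        d * n * (2 * Σ< blocks (λ i → k ∸ i))   ≤⟨ ℕₚ.*-monoʳ-≤ (d * n) (Σ-descending k blocks) ⟩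
        d * n * (k * suc k)                     ∎
        where
        eq₁ : ∀ d n t → d * (t * n) ≡ d * n * t
        eq₁ = solve-∀
        eq₂ : ∀ x y → 2 * (x * y) ≡ x * (2 * y)
        eq₂ = solve-∀

    module _ (n>0 : 0 < n) (d>0 : 0 < d) (ωnd<e² : ω * (n * d) < e * e) where
      private
        -- The integers ω n d and e² differ by at least one; multiplied by e + 1, this pays for the
        -- term e and for strictness. The factor e + 1 in k is chosen for this.
        inner : e * (e * suc e) + e + ω * (n * d) * suc e < 2 * (e * suc e) * e + ω
        inner = begin-strict
          e * (e * suc e) + e + ω * (n * d) * suc e   <⟨ ℕₚ.n<1+n _ ⟩
          suc (e * (e * suc e) + e + ω * (n * d) * suc e) ≡⟨ eq₁ e (ω * (n * d)) ⟩
          e * (e * suc e) + suc (ω * (n * d)) * suc e ≤⟨ ℕₚ.+-monoʳ-≤ (e * (e * suc e)) (ℕₚ.*-monoˡ-≤ (suc e) ωnd<e²) ⟩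
          e * (e * suc e) + e * e * suc e             ≡⟨ eq₂ e ⟩
          2 * (e * suc e) * e                         ≤⟨ ℕₚ.m≤m+n _ ω ⟩
          2 * (e * suc e) * e + ω                     ∎
          where
          eq₁ : ∀ e x → suc (e * (e * suc e) + e + x * suc e) ≡ e * (e * suc e) + suc x * suc e
          eq₁ = solve-∀
          eq₂ : ∀ e → e * (e * suc e) + e * e * suc e ≡ 2 * (e * suc e) * e
          eq₂ = solve-∀

        -- Both sides share the factor n d (e + 1), and what remains is `inner`.
        outer : d * n * (k * suc k) + ω * rows * rows < 2 * rows * (k * e) + ω * rows
        outer = begin-strict
          d * n * (k * suc k) + ω * rows * rows
            ≡⟨ eq₁ n d e ω ⟩
          n * d * suc e * (e * (e * suc e) + e + ω * (n * d) * suc e)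
            <⟨ ℕₚ.*-monoʳ-< (n * d * suc e) {{ℕ.>-nonZero (ℕₚ.*-mono-< (ℕₚ.*-mono-< n>0 d>0) (s≤s z≤n))}} inner ⟩
          n * d * suc e * (2 * (e * suc e) * e + ω)
            ≡⟨ eq₂ n d e ω ⟩
          2 * rows * (k * e) + ω * rows ∎
          where
          eq₁ : ∀ n d e ω → d * n * (e * suc e * suc (e * suc e)) + ω * (n * suc e * d) * (n * suc e * d)
                ≡ n * d * suc e * (e * (e * suc e) + e + ω * (n * d) * suc e)
          eq₁ = solve-∀
          eq₂ : ∀ n d e ω → n * d * suc e * (2 * (e * suc e) * e + ω)
                ≡ 2 * (n * suc e * d) * (e * suc e * e) + ω * (n * suc e * d)
          eq₂ = solve-∀

        deficit<gain : deficit < gain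
        deficit<gain = ℕₚ.*-cancelˡ-< 2 deficit gain (ℕₚ.+-cancelʳ-< (ω * rows * rows) (2 * deficit) (2 * gain) (begin-strict
          2 * deficit + ω * rows * rows          ≤⟨ ℕₚ.+-monoˡ-≤ _ deficit≤ ⟩
          d * n * (k * suc k) + ω * rows * rows  <⟨ outer ⟩
          2 * rows * (k * e) + ω * rows          ≤⟨ Σ-arithmetic (k * e) ω rows ⟩
          2 * gain + ω * rows * rows             ∎))

      coordinateCount<itemCount : coordinateCount < itemCount
      coordinateCount<itemCount = ℕₚ.+-cancelʳ-< deficit coordinateCount itemCount (begin-strict
        coordinateCount + deficit <⟨ ℕₚ.+-monoʳ-< coordinateCount deficit<gain ⟩
        coordinateCount + gain    ≡⟨ ≡.trans coordinate-total (≡.sym item-total) ⟩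
        itemCount + deficit       ∎)

module _ {A : Set} {ℓ : Level} {P : A → Set ℓ} where

  All-concatMap-downFrom : ∀ (f : ℕ → List A) n → (∀ i → i ℕ.< n → All P (f i)) → All P (concatMap f (downFrom n))
  All-concatMap-downFrom f zero    h = []
  All-concatMap-downFrom f (suc n) h = Allₚ.++⁺ (h n ℕₚ.≤-refl)
    (All-concatMap-downFrom f n λ i i<n → h i (ℕₚ.m≤n⇒m≤1+n i<n))

  All-concatMap-downFrom⁻ : ∀ (f : ℕ → List A) n → All P (concatMap f (downFrom n)) → ∀ i → i ℕ.< n → All P (f i)
  All-concatMap-downFrom⁻ f (suc n) h i (s≤s i≤n) with Allₚ.++⁻ (f n) h | ℕₚ.m≤n⇒m<n∨m≡n i≤n
  ... | hₙ , _  | inj₂ ≡.refl = hₙ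
  ... | _  , h′ | inj₁ i<n    = All-concatMap-downFrom⁻ f n h′ i i<n

-- Gaussian elimination

module Elimination {ℓ₁ ℓ₂ : Level} (F : DiscreteField ℓ₁ ℓ₂) where
  open DiscreteField F using (inverse)
  open FieldPolynomials F using (commutativeRing; isZero; isZero-true; isZero-false; inverse-*)
  open CommutativeRing commutativeRing hiding (_-_)
  open RingProperties ring using (-‿distribˡ-*)
  open SetoidReasoning setoid

  module _ {Q : Set} (combine : Carrier → Q → Q → Q) where

    -- The first list holds the pivot once one has been found.
    eliminateCons : (Q → Carrier) → Q → List Q × List Q → List Q × List Q
    eliminateCons φ q ([]     , done) = if isZero (φ q) then ([] , q ∷ done) else (q ∷ [] , done)
    eliminateCons φ q (p ∷ ps , done) = p ∷ ps , combine (- (φ q * inverse (φ p))) q p ∷ done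

    eliminate : (Q → Carrier) → List Q → List Q × List Q
    eliminate φ = foldr (eliminateCons φ) ([] , [])

    eliminateAll : ∀ {Pos : Set} → (Pos → Q → Carrier) → List Q → List Pos → List Q
    eliminateAll coordinate = foldr λ x qs → proj₂ (eliminate (coordinate x) qs)

    module _ {ℓ ℓ′ : Level} {P : Q → Set ℓ} {P′ : Q → Set ℓ′}
             (P⊆P′ : ∀ {q} → P q → P′ q) (P-combine : ∀ c q p → P q → P p → P′ (combine c q p)) where

      eliminateCons-All : ∀ φ q st → P q → All P (proj₁ st) × All P′ (proj₂ st) →
        All P (proj₁ (eliminateCons φ q st)) × All P′ (proj₂ (eliminateCons φ q st))
      eliminateCons-All φ q (p ∷ ps , done) Pq (Pp ∷ Pps , Pdone) = Pp ∷ Pps , P-combine _ q p Pq Pp ∷ Pdone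
      eliminateCons-All φ q ([] , done) Pq (_ , Pdone) with isZero (φ q)
      ... | true  = [] , P⊆P′ Pq ∷ Pdone
      ... | false = Pq ∷ [] , Pdone

      -- A round combines an element only with the pivot, and both come from the input of the round,
      -- so the passage from P to P′ happens once per round.
      eliminate-All : ∀ φ qs → All P qs → All P (proj₁ (eliminate φ qs)) × All P′ (proj₂ (eliminate φ qs))
      eliminate-All φ []       []        = [] , []
      eliminate-All φ (q ∷ qs) (Pq ∷ Pqs) = eliminateCons-All φ q _ Pq (eliminate-All φ qs Pqs)

    eliminateAll-All : ∀ {Pos : Set} {ℓ} {P : Q → Set ℓ} → (∀ c q p → P q → P p → P (combine c q p)) →
      ∀ coordinate (xs : List Pos) qs → All P qs → All P (eliminateAll coordinate qs xs)
    eliminateAll-All P-combine coordinate []       qs Pqs = Pqs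
    eliminateAll-All P-combine coordinate (x ∷ xs) qs Pqs = proj₂ (eliminate-All (λ Pq → Pq) P-combine
      (coordinate x) _ (eliminateAll-All P-combine coordinate xs qs Pqs))

    eliminateCons-length : ∀ φ q st → length (proj₁ st) ℕ.≤ 1 →
      length (proj₁ (eliminateCons φ q st)) ℕ.≤ 1 ×
      length (proj₁ (eliminateCons φ q st)) ℕ.+ length (proj₂ (eliminateCons φ q st))
        ≡ suc (length (proj₁ st) ℕ.+ length (proj₂ st))
    eliminateCons-length φ q (p ∷ ps , done) l = l , ℕₚ.+-suc (suc (length ps)) (length done)
    eliminateCons-length φ q ([] , done) l with isZero (φ q)
    ... | true  = z≤n , ≡.refl
    ... | false = ℕₚ.≤-refl , ≡.refl

    eliminate-length : ∀ φ qs → length (proj₁ (eliminate φ qs)) ℕ.≤ 1 ×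
      length (proj₁ (eliminate φ qs)) ℕ.+ length (proj₂ (eliminate φ qs)) ≡ length qs
    eliminate-length φ []       = z≤n , ≡.refl
    eliminate-length φ (q ∷ qs) =
      let l , e = eliminate-length φ qs ; l′ , e′ = eliminateCons-length φ q (eliminate φ qs) l in l′ , ≡.trans e′ (≡.cong suc e)

    -- Each position costs at most the pivot of its round.
    eliminateAll-length : ∀ {Pos : Set} coordinate (xs : List Pos) qs →
      length qs ℕ.≤ length xs ℕ.+ length (eliminateAll coordinate qs xs)
    eliminateAll-length coordinate []       qs = ℕₚ.≤-refl
    eliminateAll-length coordinate (x ∷ xs) qs = ℕₚ.≤-trans (eliminateAll-length coordinate xs qs)
      (ℕₚ.≤-trans (ℕₚ.+-monoʳ-≤ (length xs) one) (ℕₚ.≤-reflexive (ℕₚ.+-suc (length xs) _)))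
      where
      rest = eliminateAll coordinate qs xs
      one : length rest ℕ.≤ suc (length (proj₂ (eliminate (coordinate x) rest)))
      one = let l , e = eliminate-length (coordinate x) rest in
        ℕₚ.≤-trans (ℕₚ.≤-reflexive (≡.sym e)) (ℕₚ.+-monoˡ-≤ _ l)

    module _ {Pos : Set} (coordinate : Pos → Q → Carrier)
             (coordinate-combine : ∀ x c q p → coordinate x (combine c q p) ≈ coordinate x q + c * coordinate x p) where

      Vanishes : Pos → Q → Set ℓ₁
      Vanishes x q = coordinate x q ≈ 0#

      vanishes-combine : ∀ x c q p → Vanishes x q → Vanishes x p → Vanishes x (combine c q p)
      vanishes-combine x c q p q≈0 p≈0 = begin
        coordinate x (combine c q p)        ≈⟨ coordinate-combine x c q p ⟩
        coordinate x q + c * coordinate x p ≈⟨ +-cong q≈0 (*-congˡ p≈0) ⟩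
        0# + c * 0#                         ≈⟨ +-identityˡ _ ⟩
        c * 0#                              ≈⟨ zeroʳ c ⟩
        0#                                  ∎

      eliminateCons-vanishes : ∀ x q st →
        All (λ p → ¬ Vanishes x p) (proj₁ st) × All (Vanishes x) (proj₂ st) →
        All (λ p → ¬ Vanishes x p) (proj₁ (eliminateCons (coordinate x) q st)) ×
        All (Vanishes x) (proj₂ (eliminateCons (coordinate x) q st))
      eliminateCons-vanishes x q (p ∷ ps , done) (p≉0 ∷ nz , z) = p≉0 ∷ nz , (begin
        coordinate x (combine (- (φq * inverse φp)) q p) ≈⟨ coordinate-combine x _ q p ⟩
        φq + - (φq * inverse φp) * φp                    ≈⟨ +-congˡ (-‿distribˡ-* _ _) ⟨
        φq + - (φq * inverse φp * φp)                    ≈⟨ +-congˡ (-‿cong (*-assoc _ _ _)) ⟩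
        φq + - (φq * (inverse φp * φp))                  ≈⟨ +-congˡ (-‿cong (*-congˡ (inverse-* φp p≉0))) ⟩
        φq + - (φq * 1#)                                 ≈⟨ +-congˡ (-‿cong (*-identityʳ φq)) ⟩
        φq + - φq                                        ≈⟨ -‿inverseʳ φq ⟩
        0#                                               ∎) ∷ z
        where
        φq = coordinate x q
        φp = coordinate x p
      eliminateCons-vanishes x q ([] , done) (_ , z) with isZero (coordinate x q) in eq
      ... | true  = [] , isZero-true _ eq ∷ z
      ... | false = isZero-false _ eq ∷ [] , z

      eliminate-vanishes : ∀ x qs →
        All (λ p → ¬ Vanishes x p) (proj₁ (eliminate (coordinate x) qs)) ×
        All (Vanishes x) (proj₂ (eliminate (coordinate x) qs))
      eliminate-vanishes x []       = [] , []
      eliminate-vanishes x (q ∷ qs) = eliminateCons-vanishes x q _ (eliminate-vanishes x qs)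

      -- Coordinates made zero in earlier rounds stay zero, since later rounds only form
      -- combinations.
      eliminateAll-vanishes : ∀ xs qs → All (λ x → All (Vanishes x) (eliminateAll coordinate qs xs)) xs
      eliminateAll-vanishes []       qs = []
      eliminateAll-vanishes (x ∷ xs) qs = proj₂ (eliminate-vanishes x rest) ∷
        All.map (λ {y} v → proj₂ (eliminate-All (λ v → v) (vanishes-combine y) (coordinate x) rest v))
          (eliminateAll-vanishes xs qs)
        where rest = eliminateAll coordinate qs xs

      -- Every element has a nonzero coordinate, at a position in S, where all
      -- later elements vanish. This makes the list linearly independent, and
      -- elimination preserves it because a pivot comes after the elements
      -- that it is subtracted from.
      data Triangular (S : Pos → Set) : List Q → Set ℓ₁ where
        []  : Triangular S []
        tri : ∀ {q qs} x → S x → ¬ Vanishes x q → All (Vanishes x) qs → Triangular S qs → Triangular S (q ∷ qs)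

      triangular-map : ∀ {S T qs} → (∀ {x} → S x → T x) → Triangular S qs → Triangular T qs
      triangular-map S⊆T []                 = []
      triangular-map S⊆T (tri x Sx q≉0 v t) = tri x (S⊆T Sx) q≉0 v (triangular-map S⊆T t)

      triangular-++ : ∀ {S T U : Pos → Set} {ps qs} → (∀ {x} → S x → U x) → (∀ {x} → T x → U x) →
        Triangular S ps → Triangular T qs → (∀ x → S x → All (Vanishes x) qs) → Triangular U (ps ++ qs)
      triangular-++ S⊆U T⊆U []                 t v = triangular-map T⊆U t
      triangular-++ S⊆U T⊆U (tri x Sx p≉0 w s) t v =
        tri x (S⊆U Sx) p≉0 (Allₚ.++⁺ w (v x Sx)) (triangular-++ S⊆U T⊆U s t v)

      -- `downFrom` lists the block of largest index first, so the witnesses of a block have to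
      -- vanish only on blocks of smaller index, as leading monomials do.
      triangular-concatMap : ∀ (f : ℕ → List Q) (S : ℕ → Pos → Set) n →
        (∀ i → i ℕ.< n → Triangular (S i) (f i)) →
        (∀ i j x → i ℕ.< j → j ℕ.< n → S j x → All (Vanishes x) (f i)) →
        Triangular (λ x → ∃[ i ] i ℕ.< n × S i x) (concatMap f (downFrom n))
      triangular-concatMap f S zero    t v = []
      triangular-concatMap f S (suc n) t v = triangular-++
        (λ Sx → n , ℕₚ.≤-refl , Sx) (λ (i , i<n , Sx) → i , ℕₚ.m≤n⇒m≤1+n i<n , Sx)
        (t n ℕₚ.≤-refl)
        (triangular-concatMap f S n (λ i i<n → t i (ℕₚ.m≤n⇒m≤1+n i<n)) λ i j x i<j j<n → v i j x i<j (ℕₚ.m≤n⇒m≤1+n j<n))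
        λ x Sx → All-concatMap-downFrom f n λ i i<n → v i n x i<n ℕₚ.≤-refl Sx

      eliminateCons-triangular : ∀ {S} y q st x → S x → ¬ Vanishes x q →
        All (Vanishes x) (proj₁ st) × All (Vanishes x) (proj₂ st) →
        Triangular S (proj₂ st) → Triangular S (proj₂ (eliminateCons (coordinate y) q st))
      eliminateCons-triangular y q (p ∷ ps , done) x Sx q≉0 (p≈0 ∷ _ , v) t = tri x Sx (λ ≈0 → q≉0 (begin
        coordinate x q              ≈⟨ +-identityʳ _ ⟨
        coordinate x q + 0#         ≈⟨ +-congˡ (trans (*-congˡ p≈0) (zeroʳ c)) ⟨
        coordinate x q + c * coordinate x p ≈⟨ coordinate-combine x c q p ⟨
        coordinate x (combine c q p) ≈⟨ ≈0 ⟩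
        0# ∎)) v t
        where c = - (coordinate y q * inverse (coordinate y p))
      eliminateCons-triangular y q ([] , done) x Sx q≉0 (_ , v) t with isZero (coordinate y q)
      ... | true  = tri x Sx q≉0 v t
      ... | false = t

      eliminate-triangular : ∀ {S} y {qs} → Triangular S qs → Triangular S (proj₂ (eliminate (coordinate y) qs))
      eliminate-triangular y []                            = []
      eliminate-triangular y {q ∷ qs} (tri x Sx q≉0 v t) = eliminateCons-triangular y q _ x Sx q≉0
        (eliminate-All (λ v → v) (vanishes-combine x) (coordinate y) qs v) (eliminate-triangular y t)

      eliminateAll-triangular : ∀ {S} xs {qs} → Triangular S qs → Triangular S (eliminateAll coordinate qs xs)
      eliminateAll-triangular []       t = t
      eliminateAll-triangular (x ∷ xs) t = eliminate-triangular x (eliminateAll-triangular xs t)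

-- Interpolation in a power of the ideal (f, p)

module Interpolation {ℓ₁ ℓ₂ : Level} (F : DiscreteField ℓ₁ ℓ₂) where
  open FieldPolynomials F
  open CommutativeRing commutativeRing hiding (_-_)
  open Elimination F
  module B = PolynomialRing polynomialRing

  coordinate : ℕ × ℕ → B.Poly → Carrier
  coordinate (r , a) Q = coeff (B.coeff Q r) a

  combine : Carrier → B.Poly → B.Poly → B.Poly
  combine c Q P = Q B.+ₚ (((c ∷ []) ∷ []) B.*ₚ P)

  coordinate-combine : ∀ x c Q P → coordinate x (combine c Q P) ≈ coordinate x Q + c * coordinate x P
  coordinate-combine (r , a) c Q P = trans (B.coeff-+ Q (((c ∷ []) ∷ []) B.*ₚ P) r a)
    (trans (coeff-+ (B.coeff Q r) (B.coeff (((c ∷ []) ∷ []) B.*ₚ P) r) a)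
      (+-congˡ (trans (B.coeff-const* (c ∷ []) P r a) (coeff-const* c (B.coeff P r) a))))

  item : B.Poly → Poly → ℕ → ℕ → ℕ → ℕ → B.Poly
  item f p k i j a = B.X B.^ j B.*ₚ ((X ∷ []) B.^ a B.*ₚ (f B.^ i B.*ₚ (p ∷ []) B.^ (k ℕ.∸ i)))

  module _ (n d e ω W : ℕ) where
    open Counting using () renaming (multiplicity to multiplicityOf; blocks to blocksOf; rows to rowsOf; weight to weightOf)
    private
      k = multiplicityOf n d e ω W
      K = blocksOf n d e ω W
      m = rowsOf n d e ω W
      L = weightOf n d e ω W

    itemRow : B.Poly → Poly → ℕ → ℕ → List B.Poly
    itemRow f p i j = concatMap (λ a → item f p k i j a ∷ [])
      (downFrom (L ℕ.∸ (W ℕ.* (j ℕ.+ i ℕ.* d) ℕ.+ (k ℕ.∸ i) ℕ.* n)))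

    items : B.Poly → Poly → List B.Poly
    items f p = concatMap (λ i → concatMap (itemRow f p i) (downFrom d)) (downFrom K)

    -- The z-exponents start at ke ∸ rω, the first that is too large when x has weight ω, and end
    -- with the last one of weight less than L when x has weight W.
    positionRow : ℕ → List (ℕ × ℕ)
    positionRow r = concatMap (λ a → (r , (k ℕ.* e ℕ.∸ r ℕ.* ω) ℕ.+ a) ∷ [])
      (downFrom ((L ℕ.∸ W ℕ.* r) ℕ.∸ (k ℕ.* e ℕ.∸ r ℕ.* ω)))

    positions : List (ℕ × ℕ)
    positions = concatMap positionRow (downFrom m)

    opaque
      interpolants : B.Poly → Poly → List B.Poly
      interpolants f p = eliminateAll combine coordinate (items f p) positions

    private
      open Counting using (length-concatMap-downFrom; Σ-cong; Σ-const)

      count : ∀ {A : Set} (f : ℕ → A) N → length (concatMap (λ a → f a ∷ []) (downFrom N)) ≡ N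
      count f N = ≡.trans (length-concatMap-downFrom (λ a → f a ∷ []) N) (≡.trans (Σ-const N 1) (ℕₚ.*-identityʳ N))

    length-items : ∀ f p → length (items f p) ≡ Counting.itemCount n d e ω W
    length-items f p = ≡.trans (length-concatMap-downFrom (λ i → concatMap (itemRow f p i) (downFrom d)) K)
      (Σ-cong K λ i _ → ≡.trans (length-concatMap-downFrom (itemRow f p i) d)
        (Σ-cong d λ j _ → count (item f p k i j) _))

    length-positions : length positions ≡ Counting.coordinateCount n d e ω W
    length-positions = ≡.trans (length-concatMap-downFrom positionRow m)
      (Σ-cong m λ r _ → count (λ a → (r , (k ℕ.* e ℕ.∸ r ℕ.* ω) ℕ.+ a)) _)

    module _ (f : B.Poly) (p : Poly) (f-lead : B.HasLead f d K.1#) (p-degree : HasDegree p n)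
             (f-weight : ∀ r a → W ℕ.* d ℕ.< W ℕ.* r ℕ.+ a → coordinate (r , a) f ≈ 0#) where

      private
        it = item f p k

        leadCoeff : ℕ → ℕ → ℕ → Poly
        leadCoeff i j a = (K.1# ^ j) *ₚ (X ^ a *ₚ (K.1# ^ i *ₚ p ^ (k ℕ.∸ i)))

        it-lead : ∀ i j a → B.HasLead (it i j a) (j ℕ.+ i ℕ.* d) (leadCoeff i j a)
        it-lead i j a = subst (λ r → B.HasLead (it i j a) r (leadCoeff i j a)) (eq j a (i ℕ.* d) (k ℕ.∸ i))
          (B.lead-monomial {B.X} {X ∷ []} {f} {p ∷ []} {a = K.1#} {X} {K.1#} {p} j a i (k ℕ.∸ i)
            B.lead-X (B.lead-const X) f-lead (B.lead-const p))
          where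
          eq : ∀ j a t b → j ℕ.* 1 ℕ.+ (a ℕ.* 0 ℕ.+ (t ℕ.+ b ℕ.* 0)) ≡ j ℕ.+ t
          eq = solve-∀

        leadCoeff-degree : ∀ i j a → HasDegree (leadCoeff i j a) (a ℕ.+ (k ℕ.∸ i) ℕ.* n)
        leadCoeff-degree i j a = subst (HasDegree (leadCoeff i j a)) (eq i j a ((k ℕ.∸ i) ℕ.* n))
          (degree-* (K.1# ^ j) (X ^ a *ₚ (K.1# ^ i *ₚ p ^ (k ℕ.∸ i))) (degree-^ K.1# j degree-1)
            (degree-* (X ^ a) (K.1# ^ i *ₚ p ^ (k ℕ.∸ i)) (degree-^ X a (lead⇒degree {X} lead-X 1≉0))
              (degree-* (K.1# ^ i) (p ^ (k ℕ.∸ i)) (degree-^ K.1# i degree-1) (degree-^ p (k ℕ.∸ i) p-degree))))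
          where
          eq : ∀ i j a t → j ℕ.* 0 ℕ.+ (a ℕ.* 1 ℕ.+ (i ℕ.* 0 ℕ.+ t)) ≡ a ℕ.+ t
          eq = solve-∀

        it-higher-x : ∀ i j a r α → j ℕ.+ i ℕ.* d ℕ.< r → coordinate (r , α) (it i j a) ≈ 0#
        it-higher-x i j a r α l = proj₂ (it-lead i j a) r l α

        it-top : ∀ i j a α → coordinate (j ℕ.+ i ℕ.* d , α) (it i j a) ≈ coeff (leadCoeff i j a) α
        it-top i j a α = proj₁ (it-lead i j a) α

        -- z gets weight one over the constants, and then x gets weight W over `F[z]`; nested, these
        -- give the weighted degree in both variables.
        V₁ : Filtration polynomialRing
        V₁ = WeightedFiltration.weighted (constantFiltration commutativeRing) 1

        V₂ : ℕ → Filtration B.polynomialRing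
        V₂ W = WeightedFiltration.weighted V₁ W

        open Filtration (V₂ W) using (Fil; fil-monomial)

        ≮ : ∀ {A : Set ℓ₁} {x y} → y ≡ x → x ℕ.< y → A
        ≮ y≡x x<y = contradiction x<y (ℕₚ.≤⇒≯ (ℕₚ.≤-reflexive y≡x))

        it-weight : ∀ i j a → Fil 0 (j ℕ.* W ℕ.+ (a ℕ.* 1 ℕ.+ (i ℕ.* (W ℕ.* d) ℕ.+ (k ℕ.∸ i) ℕ.* n))) (it i j a)
        it-weight i j a =
          fil-monomial {x = B.X} {X ∷ []} {f} {p ∷ []} j a i (k ℕ.∸ i) x-weight z-weight f-weight′ p-weight
          where
          x-weight : Fil 0 W B.X
          x-weight zero          a       _ = refl
          x-weight (suc zero)    zero    = ≮ (eq W)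
            where
            eq : ∀ W → W ℕ.* 1 ℕ.+ 0 ≡ W
            eq = solve-∀
          x-weight (suc zero)    (suc a) _ = refl
          x-weight (suc (suc r)) a       _ = refl
          z-weight : Fil 0 1 (X ∷ [])
          z-weight zero    zero          _ = refl
          z-weight zero    (suc zero)    = ≮ (≡.cong (ℕ._+ 1) (ℕₚ.*-zeroʳ W))
          z-weight zero    (suc (suc a)) _ = refl
          z-weight (suc r) a             _ = refl
          f-weight′ : Fil 0 (W ℕ.* d) f
          f-weight′ r a l = f-weight r a (ℕₚ.<-≤-trans l (ℕₚ.≤-reflexive (≡.cong (W ℕ.* r ℕ.+_) (ℕₚ.*-identityˡ a))))
          p-weight : Fil 0 n (p ∷ [])
          p-weight zero    a l = proj₂ p-degree a
            (ℕₚ.<-≤-trans l (ℕₚ.≤-reflexive (≡.trans (≡.cong (ℕ._+ (a ℕ.+ 0)) (ℕₚ.*-zeroʳ W)) (ℕₚ.+-identityʳ a))))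
          p-weight (suc r) a _ = refl

      itemRow-All : ∀ {ℓ} (P : B.Poly → Set ℓ) i j →
        (∀ a → a ℕ.< L ℕ.∸ (W ℕ.* (j ℕ.+ i ℕ.* d) ℕ.+ (k ℕ.∸ i) ℕ.* n) → P (it i j a)) → All P (itemRow f p i j)
      itemRow-All P i j h = All-concatMap-downFrom (λ a → it i j a ∷ []) _ λ a a< → h a a< ∷ []

      items-All : ∀ {ℓ} {P : B.Poly → Set ℓ} →
        (∀ i j a → i ℕ.< K → j ℕ.< d → a ℕ.< L ℕ.∸ (W ℕ.* (j ℕ.+ i ℕ.* d) ℕ.+ (k ℕ.∸ i) ℕ.* n) → P (it i j a)) →
        All P (items f p)
      items-All {P = P} h = All-concatMap-downFrom _ K λ i i<K → All-concatMap-downFrom (itemRow f p i) d λ j j<d →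
        itemRow-All P i j λ a a< → h i j a i<K j<d a<

      -- The witness of a product is its leading monomial. The x-exponent j + i d with j < d
      -- determines i and j, and for fixed i and j the z-exponent a + (k ∸ i) n determines a.
      items-triangular : Triangular combine coordinate coordinate-combine
        (λ x → ∃[ i ] i ℕ.< K × i ℕ.* d ℕ.≤ proj₁ x) (items f p)
      items-triangular = triangular-concatMap combine coordinate coordinate-combine
        (λ i → concatMap (itemRow f p i) (downFrom d)) (λ i x → i ℕ.* d ℕ.≤ proj₁ x) K
        (λ i _ → triangular-map combine coordinate coordinate-combine
          (λ (j , _ , x≡) → ℕₚ.≤-trans (ℕₚ.m≤n+m (i ℕ.* d) j) (ℕₚ.≤-reflexive (≡.sym x≡)))
          (triangular-concatMap combine coordinate coordinate-combine (itemRow f p i) (λ j x → proj₁ x ≡ j ℕ.+ i ℕ.* d) d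
            (λ j _ → triangular-map combine coordinate coordinate-combine (λ (a , _ , x≡) → ≡.cong proj₁ x≡) (row i j))
            λ j′ j x j′<j _ x≡ → itemRow-All (λ Q → coordinate x Q ≈ 0#) i j′ λ a _ →
              it-higher-x i j′ a (proj₁ x) (proj₂ x)
                (ℕₚ.<-≤-trans (ℕₚ.+-monoˡ-< (i ℕ.* d) j′<j) (ℕₚ.≤-reflexive (≡.sym x≡)))))
        λ i′ i x i′<i _ i*d≤x → All-concatMap-downFrom (itemRow f p i′) d λ j j<d → itemRow-All (λ Q → coordinate x Q ≈ 0#) i′ j λ a _ →
          it-higher-x i′ j a (proj₁ x) (proj₂ x)
            (ℕₚ.<-≤-trans (ℕₚ.+-monoˡ-< (i′ ℕ.* d) j<d) (ℕₚ.≤-trans (ℕₚ.*-monoˡ-≤ d i′<i) i*d≤x))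
        where
        row : ∀ i j → Triangular combine coordinate coordinate-combine
          (λ x → ∃[ a ] a ℕ.< L ℕ.∸ (W ℕ.* (j ℕ.+ i ℕ.* d) ℕ.+ (k ℕ.∸ i) ℕ.* n)
             × x ≡ (j ℕ.+ i ℕ.* d , a ℕ.+ (k ℕ.∸ i) ℕ.* n)) (itemRow f p i j)
        row i j = triangular-concatMap combine coordinate coordinate-combine (λ a → it i j a ∷ [])
          (λ a x → x ≡ (j ℕ.+ i ℕ.* d , a ℕ.+ (k ℕ.∸ i) ℕ.* n)) _
          (λ a _ → tri _ ≡.refl
            (λ ≈0 → proj₁ (leadCoeff-degree i j a) (trans (sym (it-top i j a _)) ≈0)) [] [])
          λ where
            a′ a _ a′<a _ ≡.refl → trans (it-top i j a′ _)
              (proj₂ (leadCoeff-degree i j a′) _ (ℕₚ.+-monoˡ-< ((k ℕ.∸ i) ℕ.* n) a′<a)) ∷ []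

      module _ (w g : Poly) (g∣p : g ∣ p) (g∣fw : g ∣ B.eval f w) (g-degree : HasDegree g e)
               (w-degree : ∀ i → ω ℕ.< i → coeff w i ≈ 0#)
               (n>0 : 0 ℕ.< n) (d>0 : 0 ℕ.< d) (ωnd<e² : ω ℕ.* (n ℕ.* d) ℕ.< e ℕ.* e) where

        private
          -- Three properties of the products that pass to linear combinations, hence to whatever
          -- elimination leaves.
          Divisible OfWeight OfHeight : B.Poly → Set ℓ₁
          Divisible Q = (g ^ k) ∣ B.eval Q w
          OfWeight Q = ∀ r a → L ℕ.≤ W ℕ.* r ℕ.+ a → coordinate (r , a) Q ≈ 0#
          OfHeight Q = ∀ r a → m ℕ.≤ r → coordinate (r , a) Q ≈ 0#

          result : List B.Poly
          result = eliminateAll combine coordinate (items f p) positions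

          it-divisible : ∀ i j a → Divisible (it i j a)
          it-divisible i j a = ∣-eval-*ˡ w (B.X B.^ j) (Za B.*ₚ fP) (∣-eval-*ˡ w Za fP
            (∣-eval-^*^ w f p k i g∣fw g∣p))
            where
            Za = (X ∷ []) B.^ a
            fP = f B.^ i B.*ₚ (p ∷ []) B.^ (k ℕ.∸ i)

          divisible-combine : ∀ c Q P → Divisible Q → Divisible P → Divisible (combine c Q P)
          divisible-combine c Q P dQ dP = ∣-eval-+ w Q (((c ∷ []) ∷ []) B.*ₚ P) dQ (∣-eval-*ˡ w ((c ∷ []) ∷ []) P dP)

          result-divisible : All Divisible result
          result-divisible = eliminateAll-All combine divisible-combine coordinate positions _
            (items-All λ i j a _ _ _ → it-divisible i j a)

          result-weight : All OfWeight result
          result-weight = eliminateAll-All combine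
            (λ c Q P v w r a l → vanishes-combine combine coordinate coordinate-combine (r , a) c Q P (v r a l) (w r a l))
            coordinate positions _
            (items-All λ i j a _ _ a< r α l → it-weight i j a r α (begin-strict
              j ℕ.* W ℕ.+ (a ℕ.* 1 ℕ.+ (i ℕ.* (W ℕ.* d) ℕ.+ (k ℕ.∸ i) ℕ.* n))
                ≡⟨ eq i j a W d ((k ℕ.∸ i) ℕ.* n) ⟩
              a ℕ.+ (W ℕ.* (j ℕ.+ i ℕ.* d) ℕ.+ (k ℕ.∸ i) ℕ.* n)
                <⟨ ℕₚ.m≤o∸n⇒m+n≤o (suc a) (ℕₚ.<⇒≤ (ℕₚ.m∸n≢0⇒n<m (ℕₚ.m<n⇒n≢0 a<))) a< ⟩
              L
                ≤⟨ l ⟩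
              W ℕ.* r ℕ.+ α
                ≡⟨ ≡.cong (W ℕ.* r ℕ.+_) (ℕₚ.*-identityˡ α) ⟨
              0 ℕ.+ W ℕ.* r ℕ.+ 1 ℕ.* α ∎))
            where
            open ℕₚ.≤-Reasoning
            eq : ∀ i j a W d t → j ℕ.* W ℕ.+ (a ℕ.* 1 ℕ.+ (i ℕ.* (W ℕ.* d) ℕ.+ t)) ≡ a ℕ.+ (W ℕ.* (j ℕ.+ i ℕ.* d) ℕ.+ t)
            eq = solve-∀

          result-height : All OfHeight result
          result-height = eliminateAll-All combine
            (λ c Q P v w r a l → vanishes-combine combine coordinate coordinate-combine (r , a) c Q P (v r a l) (w r a l))
            coordinate positions _
            (items-All λ i j a i<K j<d _ r α m≤r → it-higher-x i j a r α
              (ℕₚ.<-≤-trans (ℕₚ.<-≤-trans (ℕₚ.+-monoˡ-< (i ℕ.* d) j<d) (ℕₚ.*-monoˡ-≤ d i<K)) m≤r))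

          e>0 : 0 ℕ.< e
          e>0 = ℕₚ.n≢0⇒n>0 λ e≡0 → ℕₚ.n≮0 (subst (λ x → ω ℕ.* (n ℕ.* d) ℕ.< x ℕ.* x) e≡0 ωnd<e²)

          ke>0 : 0 ℕ.< k ℕ.* e
          ke>0 = ℕₚ.*-mono-< {0} {k} {0} {e} (ℕₚ.*-mono-< {0} {e} {0} {suc e} e>0 (s≤s z≤n)) e>0

          -- From x^m on, or from weight L on, no product has a nonzero coefficient; the region that
          -- remains consists of eliminated positions.
          result-degree : All (λ Q → ∀ r a → k ℕ.* e ℕ.≤ r ℕ.* ω ℕ.+ a → coordinate (r , a) Q ≈ 0#) result
          result-degree = All.tabulate λ {Q} Q∈ r a l → go Q r a l
            (All.lookup result-weight Q∈) (All.lookup result-height Q∈) λ r<m a< → All.lookup (lookup′ r<m a<) Q∈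
            where
            go : ∀ Q r a → k ℕ.* e ℕ.≤ r ℕ.* ω ℕ.+ a → OfWeight Q → OfHeight Q →
              (∀ {r a} → r ℕ.< m → a ℕ.< (L ℕ.∸ W ℕ.* r) ℕ.∸ (k ℕ.* e ℕ.∸ r ℕ.* ω) →
                coordinate (r , (k ℕ.* e ℕ.∸ r ℕ.* ω) ℕ.+ a) Q ≈ 0#) →
              coordinate (r , a) Q ≈ 0#
            go Q r a l weight height zero′ with m ℕₚ.≤? r | L ℕₚ.≤? W ℕ.* r ℕ.+ a
            ... | yes m≤r | _       = height r a m≤r
            ... | no  _   | yes L≤  = weight r a L≤
            ... | no  m≰r | no  L≰  = subst (λ b → coordinate (r , b) Q ≈ 0#) (ℕₚ.m+[n∸m]≡n lo≤a)
              (zero′ {r} {a ℕ.∸ lo} (ℕₚ.≰⇒> m≰r) (ℕₚ.∸-monoˡ-< {n = lo}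
                (ℕₚ.m+n≤o⇒m≤o∸n (suc a) (ℕₚ.≤-trans (ℕₚ.≤-reflexive (≡.cong suc (ℕₚ.+-comm a (W ℕ.* r)))) (ℕₚ.≰⇒> L≰))) lo≤a))
              where
              lo = k ℕ.* e ℕ.∸ r ℕ.* ω
              lo≤a : lo ℕ.≤ a
              lo≤a = ℕₚ.m≤n+o⇒m∸n≤o (k ℕ.* e) (r ℕ.* ω) l
            lookup′ : ∀ {r a} → r ℕ.< m → a ℕ.< (L ℕ.∸ W ℕ.* r) ℕ.∸ (k ℕ.* e ℕ.∸ r ℕ.* ω) →
              All (λ Q → coordinate (r , (k ℕ.* e ℕ.∸ r ℕ.* ω) ℕ.+ a) Q ≈ 0#) result
            lookup′ {r} {a} r<m a< = All.head (All-concatMap-downFrom⁻ _ _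
              (All-concatMap-downFrom⁻ positionRow m
                (eliminateAll-vanishes combine coordinate coordinate-combine positions (items f p)) r r<m) a a<)

          -- With weight ω for x, which bounds the degree of w, all monomials of Q stay below ke. So
          -- Q(w) has smaller degree than g^k, by which it is divisible.
          root : ∀ Q → Divisible Q → (∀ r a → k ℕ.* e ℕ.≤ r ℕ.* ω ℕ.+ a → coordinate (r , a) Q ≈ 0#) →
                 B.eval Q w ≋ []
          root Q div deg = ∣⇒≋[] (g ^ k) (B.eval Q w) div (degree-^ g k g-degree) λ a ke≤a →
            -- Filtrations have non-strict bounds, hence ke - 1; here ke > 0 is needed.
            WeightedFiltration.fil-eval V₁ ω {0} {ℕ.pred (k ℕ.* e)} {w} Q
              (λ i l → w-degree i (ℕₚ.<-≤-trans l (ℕₚ.≤-reflexive (ℕₚ.*-identityˡ i))))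
              (λ r a l → deg r a (ℕₚ.≤-trans (ℕₚ.≤-reflexive (≡.sym suc-pred))
                (ℕₚ.≤-trans l (ℕₚ.≤-reflexive (≡.cong₂ ℕ._+_ (ℕₚ.*-comm ω r) (ℕₚ.*-identityˡ a))))))
              a (ℕₚ.≤-trans (ℕₚ.≤-reflexive suc-pred) (ℕₚ.≤-trans ke≤a (ℕₚ.≤-reflexive (≡.sym (ℕₚ.*-identityˡ a)))))
            where
            suc-pred : suc (ℕ.pred (k ℕ.* e)) ≡ k ℕ.* e
            suc-pred = ℕₚ.suc-pred (k ℕ.* e) {{ℕ.>-nonZero ke>0}}

          nonempty : 0 ℕ.< length result
          nonempty = ℕₚ.+-cancelˡ-< (length positions) 0 (length result) (begin-strict
            length positions ℕ.+ 0                  ≡⟨ ℕₚ.+-identityʳ _ ⟩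
            length positions                        ≡⟨ length-positions ⟩
            Counting.coordinateCount n d e ω W      <⟨ Counting.coordinateCount<itemCount n d e ω W n>0 d>0 ωnd<e² ⟩
            Counting.itemCount n d e ω W            ≡⟨ length-items f p ⟨
            length (items f p)                      ≤⟨ eliminateAll-length combine coordinate positions (items f p) ⟩
            length positions ℕ.+ length result      ∎)
            where open ℕₚ.≤-Reasoning

          eliminated : ∃[ Q ] ∃[ Qs ] result ≡ Q ∷ Qs × ¬ (Q B.≋ []) × B.eval Q w ≋ []
          eliminated with result | nonempty | result-divisible | result-degree
                        | eliminateAll-triangular combine coordinate coordinate-combine positions items-triangular
          -- The head of a triangular list has a nonzero coordinate, so Q is not the zero
          -- polynomial.
          ... | Q ∷ Qs | _ | div ∷ _ | deg ∷ _ | tri x _ Q≉0 _ _ =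
            Q , Qs , ≡.refl , (λ Q≋[] → Q≉0 (Q≋[] (proj₁ x) (proj₂ x))) , root Q div deg

        opaque
          unfolding interpolants

          interpolant : ∃[ Q ] ∃[ Qs ] interpolants f p ≡ Q ∷ Qs × ¬ (Q B.≋ []) × B.eval Q w ≋ []
          interpolant = eliminated

-- Programs with polynomial running time

⌊log₂⌋-upper : ∀ n → n ℕ.< 2 ℕ.^ suc ⌊log₂ n ⌋
⌊log₂⌋-upper n = ℕₚ.≰⇒> λ 2^≤n → ℕₚ.<-irrefl ≡.refl
  (ℕₚ.≤-trans (ℕₚ.≤-reflexive (≡.sym (⌊log₂[2^n]⌋≡n (suc ⌊log₂ n ⌋)))) (⌊log₂⌋-mono-≤ 2^≤n))

-- One estimate for sums and products: m + n and m n are both at most (m + 1)(n + 1), and bit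
-- lengths add under multiplication.
⌊log₂⌋-sucs : ∀ m n {k} → k ℕ.≤ suc m ℕ.* suc n → ⌊log₂ k ⌋ ℕ.≤ suc ⌊log₂ m ⌋ ℕ.+ suc ⌊log₂ n ⌋
⌊log₂⌋-sucs m n {k} k≤ = begin
  ⌊log₂ k ⌋                                         ≤⟨ ⌊log₂⌋-mono-≤ k≤ ⟩
  ⌊log₂ suc m ℕ.* suc n ⌋                           ≤⟨ ⌊log₂⌋-mono-≤ (ℕₚ.*-mono-≤ (⌊log₂⌋-upper m) (⌊log₂⌋-upper n)) ⟩
  ⌊log₂ 2 ℕ.^ suc ⌊log₂ m ⌋ ℕ.* 2 ℕ.^ suc ⌊log₂ n ⌋ ⌋ ≡⟨ ≡.cong ⌊log₂_⌋ (ℕₚ.^-distribˡ-+-* 2 (suc ⌊log₂ m ⌋) (suc ⌊log₂ n ⌋)) ⟨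
  ⌊log₂ 2 ℕ.^ (suc ⌊log₂ m ⌋ ℕ.+ suc ⌊log₂ n ⌋) ⌋   ≡⟨ ⌊log₂[2^n]⌋≡n _ ⟩
  suc ⌊log₂ m ⌋ ℕ.+ suc ⌊log₂ n ⌋                   ∎
  where open ℕₚ.≤-Reasoning

module PolynomialTime {ℓ₁ ℓ₂ : Level} (F : DiscreteField ℓ₁ ℓ₂) (R : RootFinder F) where
  open Machine F R
  open ℕₚ.≤-Reasoning

  1≤size : ∀ A a → 1 ℕ.≤ size A a
  1≤size 𝔽        a       = s≤s z≤n
  1≤size bool     a       = s≤s z≤n
  1≤size nat      a       = s≤s z≤n
  1≤size (A ×̇ B)  (a , b) = ℕₚ.≤-trans (1≤size A a) (ℕₚ.m≤m+n _ _)
  1≤size (list A) as      = s≤s z≤n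

  -- Sizes are at least one, so exponents can be raised freely and a single monomial is as good as a
  -- polynomial.
  record Bounded (A : Ty) (g : ⟦ A ⟧ → ℕ) : Set where
    no-eta-equality
    pattern
    constructor bounded
    field
      constant exponent : ℕ
      bound : ∀ a → g a ℕ.≤ constant ℕ.* size A a ℕ.^ exponent

  private
    1≤size^ : ∀ A a k → 1 ℕ.≤ size A a ℕ.^ k
    1≤size^ A a zero    = s≤s z≤n
    1≤size^ A a (suc k) = ℕₚ.*-mono-≤ (1≤size A a) (1≤size^ A a k)

    ^-mono : ∀ A a {j k} → j ℕ.≤ k → size A a ℕ.^ j ℕ.≤ size A a ℕ.^ k
    ^-mono A a = ℕₚ.^-monoʳ-≤ (size A a) {{ℕ.>-nonZero (1≤size A a)}}

  module _ {A : Ty} where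
    opaque
      bounded-≤ : ∀ {g h} → (∀ a → g a ℕ.≤ h a) → Bounded A h → Bounded A g
      bounded-≤ g≤h (bounded C k h≤) = bounded C k λ a → ℕₚ.≤-trans (g≤h a) (h≤ a)

      bounded-const : ∀ n → Bounded A (λ _ → n)
      bounded-const n = bounded n 0 λ a → ℕₚ.≤-reflexive (≡.sym (ℕₚ.*-identityʳ n))

      bounded-size : Bounded A (size A)
      bounded-size = bounded 1 1 λ a → ℕₚ.≤-reflexive
        (≡.sym (≡.trans (ℕₚ.*-identityˡ _) (ℕₚ.*-identityʳ _)))

      bounded-+ : ∀ {g h} → Bounded A g → Bounded A h → Bounded A (λ a → g a ℕ.+ h a)
      bounded-+ {g} {h} (bounded C j g≤) (bounded D k h≤) = bounded (C ℕ.+ D) (j ℕ.+ k) λ a → begin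
        g a ℕ.+ h a
          ≤⟨ ℕₚ.+-mono-≤ (g≤ a) (h≤ a) ⟩
        C ℕ.* size A a ℕ.^ j ℕ.+ D ℕ.* size A a ℕ.^ k
          ≤⟨ ℕₚ.+-mono-≤ (ℕₚ.*-monoʳ-≤ C (^-mono A a (ℕₚ.m≤m+n j k))) (ℕₚ.*-monoʳ-≤ D (^-mono A a (ℕₚ.m≤n+m k j))) ⟩
        C ℕ.* size A a ℕ.^ (j ℕ.+ k) ℕ.+ D ℕ.* size A a ℕ.^ (j ℕ.+ k)
          ≡⟨ ℕₚ.*-distribʳ-+ (size A a ℕ.^ (j ℕ.+ k)) C D ⟨
        (C ℕ.+ D) ℕ.* size A a ℕ.^ (j ℕ.+ k) ∎

      bounded-* : ∀ {g h} → Bounded A g → Bounded A h → Bounded A (λ a → g a ℕ.* h a)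
      bounded-* {g} {h} (bounded C j g≤) (bounded D k h≤) = bounded (C ℕ.* D) (j ℕ.+ k) λ a → begin
        g a ℕ.* h a
          ≤⟨ ℕₚ.*-mono-≤ (g≤ a) (h≤ a) ⟩
        C ℕ.* size A a ℕ.^ j ℕ.* (D ℕ.* size A a ℕ.^ k)
          ≡⟨ ℕₚ.[m*n]*[o*p]≡[m*o]*[n*p] C _ D _ ⟩
        C ℕ.* D ℕ.* (size A a ℕ.^ j ℕ.* size A a ℕ.^ k)
          ≡⟨ ≡.cong (C ℕ.* D ℕ.*_) (ℕₚ.^-distribˡ-+-* (size A a) j k) ⟨
        C ℕ.* D ℕ.* size A a ℕ.^ (j ℕ.+ k) ∎

      bounded-^ : ∀ {g} k → Bounded A g → Bounded A (λ a → g a ℕ.^ k)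
      bounded-^ zero    b = bounded-const 1
      bounded-^ (suc k) b = bounded-* b (bounded-^ k b)

      bounded-∘ : ∀ {B h} (f : ⟦ A ⟧ → ⟦ B ⟧) → Bounded B h →
                  Bounded A (λ a → size B (f a)) → Bounded A (λ a → h (f a))
      bounded-∘ f (bounded D k h≤) b = bounded-≤ (λ a → h≤ (f a)) (bounded-* (bounded-const D) (bounded-^ k b))

  opaque
    bounded-proj₁ : ∀ {A B g} → Bounded A g → Bounded (A ×̇ B) (λ a → g (proj₁ a))
    bounded-proj₁ b = bounded-∘ proj₁ b (bounded-≤ (λ a → ℕₚ.m≤m+n _ _) bounded-size)

    bounded-proj₂ : ∀ {A B g} → Bounded B g → Bounded (A ×̇ B) (λ a → g (proj₂ a))
    bounded-proj₂ {A} b = bounded-∘ proj₂ b (bounded-≤ (λ a → ℕₚ.m≤n+m _ (size A (proj₁ a))) bounded-size)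

  infix 2 _↝_
  infixr 9 _∘ᵖ_
  infixr 4 _,ᵖ_

  -- The output size has to be recorded as well: pairing an input with itself doubles it at constant
  -- cost, so the cost alone does not bound what the next program receives.
  record _↝_ (A B : Ty) : Set where
    no-eta-equality
    field
      program      : A ⇒ B
      cost-bounded : Bounded A (cost program)
      size-bounded : Bounded A (λ a → size B (run program a))

    ⟪_⟫ : ⟦ A ⟧ → ⟦ B ⟧
    ⟪_⟫ = run program

  open _↝_ public

  private
    unit-cost : ∀ {A} → Bounded A (λ _ → 1)
    unit-cost = bounded-const 1

  idᵖ : ∀ {A} → A ↝ A
  idᵖ = record { program = id ; cost-bounded = unit-cost ; size-bounded = bounded-size }

  fstᵖ : ∀ {A B} → A ×̇ B ↝ A
  fstᵖ = record { program = fst ; cost-bounded = bounded-proj₁ unit-cost ; size-bounded = bounded-proj₁ bounded-size }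

  sndᵖ : ∀ {A B} → A ×̇ B ↝ B
  sndᵖ = record { program = snd ; cost-bounded = bounded-proj₂ unit-cost ; size-bounded = bounded-proj₂ bounded-size }

  _∘ᵖ_ : ∀ {A B C} → B ↝ C → A ↝ B → A ↝ C
  g ∘ᵖ f = record
    { program      = program g ∘ program f
    ; cost-bounded = bounded-+ (bounded-+ unit-cost (cost-bounded f))
                       (bounded-∘ ⟪ f ⟫ (cost-bounded g) (size-bounded f))
    ; size-bounded = bounded-∘ ⟪ f ⟫ (size-bounded g) (size-bounded f)
    }

  _,ᵖ_ : ∀ {A B C} → A ↝ B → A ↝ C → A ↝ B ×̇ C
  f ,ᵖ g = record
    { program      = ⟨ program f , program g ⟩
    ; cost-bounded = bounded-+ (bounded-+ unit-cost (cost-bounded f)) (cost-bounded g)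
    ; size-bounded = bounded-+ (size-bounded f) (size-bounded g)
    }

  private
    if-≤ : ∀ b {m n} → (if b then m else n) ℕ.≤ m ℕ.+ n
    if-≤ true      = ℕₚ.m≤m+n _ _
    if-≤ false {m} = ℕₚ.m≤n+m _ m

    size-if-≤ : ∀ {A} b {x y : ⟦ A ⟧} → size A (if b then x else y) ℕ.≤ size A x ℕ.+ size A y
    size-if-≤ true          = ℕₚ.m≤m+n _ _
    size-if-≤ {A} false {x} = ℕₚ.m≤n+m _ (size A x)

  condᵖ : ∀ {A B} → A ↝ bool → A ↝ B → A ↝ B → A ↝ B
  condᵖ {B = B} t f g = record
    { program      = cond (program t) (program f) (program g)
    ; cost-bounded = bounded-+ (bounded-+ unit-cost (cost-bounded t))
        (bounded-≤ (λ a → if-≤ (⟪ t ⟫ a)) (bounded-+ (cost-bounded f) (cost-bounded g)))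
    ; size-bounded = bounded-≤ (λ a → size-if-≤ {B} (⟪ t ⟫ a)) (bounded-+ (size-bounded f) (size-bounded g))
    }

  ttᵖ ffᵖ : ∀ {A} → A ↝ bool
  ttᵖ = record { program = tt ; cost-bounded = unit-cost ; size-bounded = unit-cost }
  ffᵖ = record { program = ff ; cost-bounded = unit-cost ; size-bounded = unit-cost }

  nilᵖ : ∀ {A B} → A ↝ list B
  nilᵖ = record { program = nil ; cost-bounded = unit-cost ; size-bounded = unit-cost }

  sizes : ∀ A → List ⟦ A ⟧ → ℕ
  sizes A as = List.sum (map (size A) as)

  consᵖ : ∀ {A B} → A ↝ B → A ↝ list B → A ↝ list B
  consᵖ {A} {B} f g = c ∘ᵖ (f ,ᵖ g)
    where
    c : B ×̇ list B ↝ list B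
    c = record
      { program      = cons
      ; cost-bounded = bounded-≤ (λ _ → ℕₚ.≤-refl) unit-cost
      ; size-bounded = bounded-≤ (λ (b , bs) → ℕₚ.≤-reflexive (≡.sym (ℕₚ.+-suc (size B b) _))) bounded-size
      }

  private
    -- Step programs see their context as left-nested pairs, so that every new variable is the last
    -- component; the machine nests to the right.
    regroup : ∀ {A B C D} → (A ×̇ B) ×̇ C ↝ D → A ×̇ B ×̇ C ↝ D
    regroup f = f ∘ᵖ ((fstᵖ ,ᵖ (fstᵖ ∘ᵖ sndᵖ)) ,ᵖ (sndᵖ ∘ᵖ sndᵖ))

  matchᵖ : ∀ {A B C} → A ↝ list B → A ↝ C → (A ×̇ B) ×̇ list B ↝ C → A ↝ C
  matchᵖ {A} {B} {C} e f g = m ∘ᵖ (idᵖ ,ᵖ e)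
    where
    -- Taking a list apart into head and tail leaves the total size unchanged, so a bound for that
    -- branch is a bound in terms of the whole input.
    cases : ∀ {h : ⟦ A ×̇ list B ⟧ → ℕ} {u v} → (∀ a → h (a , []) ℕ.≤ u a) →
            (∀ a b bs → h (a , b ∷ bs) ℕ.≤ v (a , b , bs)) →
            Bounded A u → Bounded (A ×̇ B ×̇ list B) v → Bounded (A ×̇ list B) h
    cases {h} {u} {v} h≤u h≤v bu (bounded D k v≤) =
      bounded-≤ h≤ (bounded-+ (bounded-proj₁ bu) (bounded-* (bounded-const D) (bounded-^ k bounded-size)))
      where
      h≤ : ∀ x → h x ℕ.≤ u (proj₁ x) ℕ.+ D ℕ.* size (A ×̇ list B) x ℕ.^ k
      h≤ (a , [])     = ℕₚ.≤-trans (h≤u a) (ℕₚ.m≤m+n _ _)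
      h≤ (a , b ∷ bs) = begin
        h (a , b ∷ bs)
          ≤⟨ h≤v a b bs ⟩
        v (a , b , bs)
          ≤⟨ v≤ _ ⟩
        D ℕ.* (size A a ℕ.+ (size B b ℕ.+ suc (sizes B bs))) ℕ.^ k
          ≡⟨ ≡.cong (λ s → D ℕ.* (size A a ℕ.+ s) ℕ.^ k) (ℕₚ.+-suc (size B b) _) ⟩
        D ℕ.* size (A ×̇ list B) (a , b ∷ bs) ℕ.^ k
          ≤⟨ ℕₚ.m≤n+m _ (u a) ⟩
        u a ℕ.+ D ℕ.* size (A ×̇ list B) (a , b ∷ bs) ℕ.^ k ∎

    m : A ×̇ list B ↝ C
    m = record
      { program      = match (program f) (program (regroup g))
      ; cost-bounded = cases (λ a → ℕₚ.≤-refl) (λ a b bs → ℕₚ.≤-refl)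
                         (bounded-+ unit-cost (cost-bounded f)) (bounded-+ unit-cost (cost-bounded (regroup g)))
      ; size-bounded = cases (λ a → ℕₚ.≤-refl) (λ a b bs → ℕₚ.≤-refl) (size-bounded f) (size-bounded (regroup g))
      }

  module _ {A B C} (e : A ↝ list B) (f : A ↝ C) (g : (A ×̇ B) ×̇ list B ↝ C) (a : ⟦ A ⟧) where

    matchᵖ-[] : ⟪ e ⟫ a ≡ [] → ⟪ matchᵖ e f g ⟫ a ≡ ⟪ f ⟫ a
    matchᵖ-[] eq rewrite eq = ≡.refl

    matchᵖ-∷ : ∀ {b bs} → ⟪ e ⟫ a ≡ b ∷ bs → ⟪ matchᵖ e f g ⟫ a ≡ ⟪ g ⟫ ((a , b) , bs)
    matchᵖ-∷ eq rewrite eq = ≡.refl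

  zeroᵖ oneᵖ : ∀ {A} → A ↝ 𝔽
  zeroᵖ = record { program = zeroF ; cost-bounded = unit-cost ; size-bounded = unit-cost }
  oneᵖ  = record { program = oneF ; cost-bounded = unit-cost ; size-bounded = unit-cost }

  addFᵖ mulFᵖ : 𝔽 ×̇ 𝔽 ↝ 𝔽
  addFᵖ = record { program = addF ; cost-bounded = bounded-≤ (λ _ → ℕₚ.≤-refl) unit-cost ; size-bounded = unit-cost }
  mulFᵖ = record { program = mulF ; cost-bounded = bounded-≤ (λ _ → ℕₚ.≤-refl) unit-cost ; size-bounded = unit-cost }

  negFᵖ invFᵖ : 𝔽 ↝ 𝔽
  negFᵖ = record { program = negF ; cost-bounded = unit-cost ; size-bounded = unit-cost }
  invFᵖ = record { program = invF ; cost-bounded = unit-cost ; size-bounded = unit-cost }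

  isZeroᵖ : 𝔽 ↝ bool
  isZeroᵖ = record { program = isZeroF ; cost-bounded = unit-cost ; size-bounded = unit-cost }

  private
    size-nat-≤ : ∀ m n {k} → k ℕ.≤ suc m ℕ.* suc n → size nat k ℕ.≤ 1 ℕ.+ size (nat ×̇ nat) (m , n)
    size-nat-≤ m n k≤ = s≤s (⌊log₂⌋-sucs m n k≤)

    1+size : ∀ {A} → Bounded A (λ a → 1 ℕ.+ size A a)
    1+size = bounded-+ unit-cost bounded-size

  litᵖ : ∀ {A} → ℕ → A ↝ nat
  litᵖ n = record { program = lit n ; cost-bounded = bounded-const _ ; size-bounded = bounded-const _ }

  addℕᵖ mulℕᵖ : nat ×̇ nat ↝ nat
  addℕᵖ = record
    { program      = addℕ
    ; cost-bounded = bounded-≤ (λ _ → ℕₚ.≤-refl) bounded-size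
    ; size-bounded = bounded-≤ (λ (m , n) → size-nat-≤ m n
        (ℕₚ.≤-trans (ℕₚ.+-mono-≤ {m} (ℕₚ.n≤1+n m) (ℕₚ.m≤n*m n (suc m))) (ℕₚ.≤-reflexive (≡.sym (ℕₚ.*-suc (suc m) n))))) 1+size
    }
  mulℕᵖ = record
    { program      = mulℕ
    ; cost-bounded = bounded-≤ (λ _ → ℕₚ.≤-refl) bounded-size
    ; size-bounded = bounded-≤ (λ (m , n) → size-nat-≤ m n
        (ℕₚ.*-mono-≤ (ℕₚ.n≤1+n m) (ℕₚ.n≤1+n n))) 1+size
    }

  leqℕᵖ : nat ×̇ nat ↝ bool
  leqℕᵖ = record
    { program      = leqℕ
    ; cost-bounded = bounded-≤ (λ _ → ℕₚ.≤-refl) bounded-size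
    ; size-bounded = bounded-≤ (λ _ → ℕₚ.≤-refl) unit-cost
    }

  rootsᵖ : list (list 𝔽) ↝ list (list 𝔽)
  rootsᵖ = record
    { program      = roots
    ; cost-bounded = bounded-+ unit-cost time-bound
    ; size-bounded = bounded-≤ output≤time time-bound
    }
    where
    open RootFinder R
    time-bound : Bounded (list (list 𝔽)) time
    time-bound = bounded (proj₁ time-bounded) (proj₁ (proj₂ time-bounded)) (proj₂ (proj₂ time-bounded))

  sizes-++ : ∀ A as bs → sizes A (as ++ bs) ≡ sizes A as ℕ.+ sizes A bs
  sizes-++ A []       bs = ≡.refl
  sizes-++ A (a ∷ as) bs = ≡.trans (≡.cong (size A a ℕ.+_) (sizes-++ A as bs))
    (≡.sym (ℕₚ.+-assoc (size A a) _ _))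

  length≤size : ∀ A as → length as ℕ.≤ size (list A) as
  length≤size A []       = z≤n
  length≤size A (a ∷ as) = s≤s (ℕₚ.≤-trans (length≤size A as) (ℕₚ.+-monoˡ-≤ _ (1≤size A a)))

  private
    loopCost-≤ : ∀ {B C : Set} (f : B → C → C) (t : B → C → ℕ) c bs T →
      (∀ pre b post → bs ≡ pre ++ b ∷ post → t b (loop f c pre) ℕ.≤ T) →
      loopCost f t c bs ℕ.≤ length bs ℕ.* suc T
    loopCost-≤ f t c []       T h = z≤n
    loopCost-≤ f t c (b ∷ bs) T h = ℕₚ.+-mono-≤ (s≤s (h [] b bs ≡.refl))
      (loopCost-≤ f t (f b c) bs T λ pre b′ post e → h (b ∷ pre) b′ post (≡.cong (b ∷_) e))

  -- The accumulators of a loop are its results on the prefixes of the list, so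
  -- the hypothesis on the size of the result bounds them as well.
  foldlᵖ : ∀ {A B C} (z : A ↝ C) (s : (A ×̇ B) ×̇ C ↝ C) →
           Bounded (A ×̇ list B) (λ (a , bs) → size C (loop (λ b c → ⟪ s ⟫ ((a , b) , c)) (⟪ z ⟫ a) bs)) →
           A ×̇ list B ↝ C
  foldlᵖ {A} {B} {C} z s result-bounded = record
    { program      = foldl (program z) (program (regroup s))
    ; cost-bounded = bounded-≤ (λ x → ℕₚ.+-monoʳ-≤ (1 ℕ.+ cost (program z) (proj₁ x)) (rounds≤ x))
        (bounded-+ (bounded-+ unit-cost (bounded-proj₁ (cost-bounded z)))
          (bounded-* bounded-size (bounded-+ unit-cost
            (bounded-* (bounded-const Cₛ) (bounded-^ kₛ (bounded-+ (bounded-+ bounded-size bounded-size)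
              (bounded-* (bounded-const D) (bounded-^ k bounded-size))))))))
    ; size-bounded = bounded-≤ (λ _ → ℕₚ.≤-refl) result-bounded
    }
    where
    s′ = regroup s
    open Bounded result-bounded renaming (constant to D; exponent to k; bound to result≤)
    open Bounded (cost-bounded s′) renaming (constant to Cₛ; exponent to kₛ; bound to s≤)

    rounds≤ : ∀ x → let a , bs = x ; S = size (A ×̇ list B) x in
      loopCost (λ b c → ⟪ s ⟫ ((a , b) , c)) (λ b c → cost (program s′) (a , b , c)) (⟪ z ⟫ a) bs
        ℕ.≤ S ℕ.* suc (Cₛ ℕ.* (S ℕ.+ S ℕ.+ D ℕ.* S ℕ.^ k) ℕ.^ kₛ)
    rounds≤ x@(a , bs) = ℕₚ.≤-trans (loopCost-≤ _ _ _ bs _ round≤)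
      (ℕₚ.*-monoˡ-≤ _ (ℕₚ.≤-trans (length≤size B bs) (ℕₚ.m≤n+m _ (size A a))))
      where
      S = size (A ×̇ list B) x
      round≤ : ∀ pre b post → bs ≡ pre ++ b ∷ post →
        cost (program s′) (a , b , loop (λ b c → ⟪ s ⟫ ((a , b) , c)) (⟪ z ⟫ a) pre)
          ℕ.≤ Cₛ ℕ.* (S ℕ.+ S ℕ.+ D ℕ.* S ℕ.^ k) ℕ.^ kₛ
      round≤ pre b post ≡.refl = ℕₚ.≤-trans (s≤ _) (ℕₚ.*-monoʳ-≤ Cₛ (ℕₚ.^-monoˡ-≤ kₛ (begin
        size A a ℕ.+ (size B b ℕ.+ size C _)
          ≡⟨ ℕₚ.+-assoc (size A a) _ _ ⟨
        size A a ℕ.+ size B b ℕ.+ size C _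
          ≤⟨ ℕₚ.+-mono-≤ (ℕₚ.+-mono-≤ {size A a} (ℕₚ.m≤m+n _ _) sb≤) (ℕₚ.≤-trans (result≤ (a , pre))
               (ℕₚ.*-monoʳ-≤ D (ℕₚ.^-monoˡ-≤ k (ℕₚ.+-monoʳ-≤ (size A a) pre≤)))) ⟩
        S ℕ.+ S ℕ.+ D ℕ.* S ℕ.^ k ∎)))
        where
        all : size (list B) (pre ++ b ∷ post) ≡ suc (sizes B pre ℕ.+ (size B b ℕ.+ sizes B post))
        all = ≡.cong suc (sizes-++ B pre (b ∷ post))
        pre≤ : size (list B) pre ℕ.≤ size (list B) (pre ++ b ∷ post)
        pre≤ = ℕₚ.≤-trans (s≤s (ℕₚ.m≤m+n _ _)) (ℕₚ.≤-reflexive (≡.sym all))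
        sb≤ : size B b ℕ.≤ S
        sb≤ = begin
          size B b ≤⟨ ℕₚ.m≤m+n _ _ ⟩
          size B b ℕ.+ sizes B post ≤⟨ ℕₚ.m≤n+m _ (suc (sizes B pre)) ⟩
          suc (sizes B pre) ℕ.+ (size B b ℕ.+ sizes B post) ≡⟨ all ⟨
          size (list B) (pre ++ b ∷ post) ≤⟨ ℕₚ.m≤n+m _ (size A a) ⟩
          S ∎

  sizes-loop-∷ : ∀ B as bs → sizes B (loop _∷_ as bs) ≡ sizes B as ℕ.+ sizes B bs
  sizes-loop-∷ B as []       = ≡.sym (ℕₚ.+-identityʳ _)
  sizes-loop-∷ B as (b ∷ bs) = ≡.trans (sizes-loop-∷ B (b ∷ as) bs)
    (≡.trans (≡.cong (ℕ._+ sizes B bs) (ℕₚ.+-comm (size B b) _)) (ℕₚ.+-assoc (sizes B as) _ _))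

  private
    reverse : ∀ {B : Set} → List B → List B
    reverse = loop _∷_ []

    loop-reverse : ∀ {B C : Set} (f : B → C → C) c as bs →
                   loop f c (loop _∷_ as bs) ≡ loop f (foldr f c bs) as
    loop-reverse f c as []       = ≡.refl
    loop-reverse f c as (b ∷ bs) = loop-reverse f c (b ∷ as) bs

    foldr-reverse : ∀ {B C : Set} (f : B → C → C) c as bs →
                    foldr f c (loop _∷_ as bs) ≡ loop f (foldr f c as) bs
    foldr-reverse f c as []       = ≡.refl
    foldr-reverse f c as (b ∷ bs) = foldr-reverse f c (b ∷ as) bs

    reverseᵖ : ∀ {B} → list B ↝ list B
    reverseᵖ {B} = foldlᵖ {A = list B} nilᵖ (consᵖ (sndᵖ ∘ᵖ fstᵖ) sndᵖ)
      (bounded-≤ (λ (_ , bs) → ℕₚ.≤-reflexive (≡.cong suc (sizes-loop-∷ B [] bs))) (bounded-proj₂ bounded-size))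
      ∘ᵖ (idᵖ ,ᵖ idᵖ)

  -- The machine folds from the left only, so the list is reversed first. Reversal keeps the size,
  -- so a bound on right folds carries over.
  foldrᵖ : ∀ {A B C} (e : A ↝ list B) (z : A ↝ C) (s : (A ×̇ B) ×̇ C ↝ C) →
           Bounded (A ×̇ list B) (λ (a , bs) → size C (foldr (λ b c → ⟪ s ⟫ ((a , b) , c)) (⟪ z ⟫ a) bs)) →
           A ↝ C
  foldrᵖ {A} {B} {C} e z s result-bounded = foldlᵖ z s (bounded D k λ (a , bs) → begin
      size C (loop (λ b c → ⟪ s ⟫ ((a , b) , c)) (⟪ z ⟫ a) bs)
        ≡⟨ ≡.cong (size C) (foldr-reverse _ (⟪ z ⟫ a) [] bs) ⟨
      size C (foldr (λ b c → ⟪ s ⟫ ((a , b) , c)) (⟪ z ⟫ a) (reverse bs))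
        ≤⟨ result≤ (a , reverse bs) ⟩
      D ℕ.* (size A a ℕ.+ size (list B) (reverse bs)) ℕ.^ k
        ≡⟨ ≡.cong (λ n → D ℕ.* (size A a ℕ.+ suc n) ℕ.^ k) (sizes-loop-∷ B [] bs) ⟩
      D ℕ.* (size A a ℕ.+ size (list B) bs) ℕ.^ k ∎)
    ∘ᵖ (idᵖ ,ᵖ (reverseᵖ ∘ᵖ e))
    where open Bounded result-bounded renaming (constant to D; exponent to k; bound to result≤)

  -- The left-hand side is what ⟪ foldrᵖ e z s _ ⟫ a reduces to.
  foldrᵖ-correct : ∀ {A B C} (e : A ↝ list B) (z : A ↝ C) (s : (A ×̇ B) ×̇ C ↝ C) a →
    loop (λ b c → ⟪ s ⟫ ((a , b) , c)) (⟪ z ⟫ a) (loop _∷_ [] (⟪ e ⟫ a)) ≡ foldr (λ b c → ⟪ s ⟫ ((a , b) , c)) (⟪ z ⟫ a) (⟪ e ⟫ a)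
  foldrᵖ-correct e z s a = loop-reverse _ (⟪ z ⟫ a) [] (⟪ e ⟫ a)

  private
    foldr-∷ : ∀ {B : Set} {cs : List B} bs → foldr _∷_ cs bs ≡ bs ++ cs
    foldr-∷ []       = ≡.refl
    foldr-∷ (b ∷ bs) = ≡.cong (b ∷_) (foldr-∷ bs)

  opaque
    appendᵖ : ∀ {A B} → A ↝ list B → A ↝ list B → A ↝ list B
    appendᵖ {A} {B} f g = foldrᵖ f g (consᵖ (sndᵖ ∘ᵖ fstᵖ) sndᵖ)
      (bounded-≤ (λ (a , bs) → ℕₚ.≤-reflexive (≡.trans (≡.cong (size (list B)) (foldr-∷ bs))
          (≡.trans (≡.cong suc (sizes-++ B bs _)) (≡.trans (≡.cong suc (ℕₚ.+-comm (sizes B bs) _)) ≡.refl))))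
        (bounded-≤ (λ (a , bs) → ℕₚ.+-monoʳ-≤ (size (list B) (⟪ g ⟫ a)) (ℕₚ.n≤1+n (sizes B bs)))
          (bounded-+ (bounded-proj₁ (size-bounded g)) (bounded-proj₂ bounded-size))))

    appendᵖ-correct : ∀ {A B} (f g : A ↝ list B) a → ⟪ appendᵖ f g ⟫ a ≡ ⟪ f ⟫ a ++ ⟪ g ⟫ a
    appendᵖ-correct f g a = ≡.trans (foldrᵖ-correct f g (consᵖ (sndᵖ ∘ᵖ fstᵖ) sndᵖ) a) (foldr-∷ (⟪ f ⟫ a))

  opaque
    -- The outputs of the rounds are collected and never fed back, so the size bound of one round
    -- times the number of rounds bounds every accumulator.
    forᵖ : ∀ {A B C} → A ↝ list B → A ×̇ B ↝ list C → A ↝ list C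
    forᵖ {A} {B} {C} e f = foldrᵖ e nilᵖ step result-bounded
      where
      step : (A ×̇ B) ×̇ list C ↝ list C
      step = appendᵖ (f ∘ᵖ fstᵖ) sndᵖ
      open Bounded (size-bounded f) renaming (constant to D; exponent to k; bound to f≤)
      result≤ : ∀ a bs T → size (list B) bs ℕ.≤ T →
        size (list C) (foldr (λ b c → ⟪ step ⟫ ((a , b) , c)) [] bs) ℕ.≤ suc (length bs ℕ.* (D ℕ.* (size A a ℕ.+ T) ℕ.^ k))
      result≤ a []       T _  = s≤s z≤n
      result≤ a (b ∷ bs) T ≤T = begin
        size (list C) (⟪ step ⟫ ((a , b) , rest))
          ≡⟨ ≡.cong (size (list C)) (appendᵖ-correct (f ∘ᵖ fstᵖ) sndᵖ ((a , b) , rest)) ⟩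
        size (list C) (⟪ f ⟫ (a , b) ++ rest)
          ≡⟨ ≡.cong suc (sizes-++ C (⟪ f ⟫ (a , b)) rest) ⟩
        suc (sizes C (⟪ f ⟫ (a , b)) ℕ.+ sizes C rest)
          ≤⟨ ℕₚ.+-mono-≤ (f≤ (a , b)) (ℕ.s≤s⁻¹ (result≤ a bs T (ℕₚ.≤-trans (s≤s (ℕₚ.m≤n+m _ (size B b))) ≤T))) ⟩
        D ℕ.* (size A a ℕ.+ size B b) ℕ.^ k ℕ.+ length bs ℕ.* (D ℕ.* (size A a ℕ.+ T) ℕ.^ k)
          ≤⟨ ℕₚ.+-monoˡ-≤ _ (ℕₚ.*-monoʳ-≤ D (ℕₚ.^-monoˡ-≤ k (ℕₚ.+-monoʳ-≤ (size A a)
               (ℕₚ.≤-trans (ℕₚ.m≤m+n _ _) (ℕₚ.≤-trans (ℕₚ.n≤1+n _) ≤T))))) ⟩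
        D ℕ.* (size A a ℕ.+ T) ℕ.^ k ℕ.+ length bs ℕ.* (D ℕ.* (size A a ℕ.+ T) ℕ.^ k)
          ≤⟨ ℕₚ.n≤1+n _ ⟩
        suc (length (b ∷ bs) ℕ.* (D ℕ.* (size A a ℕ.+ T) ℕ.^ k)) ∎
        where
        rest : List ⟦ C ⟧
        rest = foldr (λ b c → ⟪ step ⟫ ((a , b) , c)) [] bs
      result-bounded : Bounded (A ×̇ list B) (λ (a , bs) → size (list C) (foldr (λ b c → ⟪ step ⟫ ((a , b) , c)) [] bs))
      result-bounded = bounded-≤
        (λ (a , bs) → ℕₚ.≤-trans (result≤ a bs _ ℕₚ.≤-refl)
          (s≤s (ℕₚ.*-monoˡ-≤ _ (ℕₚ.≤-trans (length≤size B bs) (ℕₚ.m≤n+m _ (size A a))))))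
        (bounded-+ unit-cost (bounded-* bounded-size (bounded-* (bounded-const D) (bounded-^ k bounded-size))))

    forᵖ-correct : ∀ {A B C} (e : A ↝ list B) (f : A ×̇ B ↝ list C) a →
                   ⟪ forᵖ e f ⟫ a ≡ concatMap (λ b → ⟪ f ⟫ (a , b)) (⟪ e ⟫ a)
    forᵖ-correct e f a = ≡.trans (foldrᵖ-correct e nilᵖ (appendᵖ (f ∘ᵖ fstᵖ) sndᵖ) a) (go (⟪ e ⟫ a))
      where
      go : ∀ bs → foldr (λ b c → ⟪ appendᵖ (f ∘ᵖ fstᵖ) sndᵖ ⟫ ((a , b) , c)) [] bs ≡ concatMap (λ b → ⟪ f ⟫ (a , b)) bs
      go []       = ≡.refl
      go (b ∷ bs) = ≡.trans (appendᵖ-correct (f ∘ᵖ fstᵖ) sndᵖ _) (≡.cong (⟪ f ⟫ (a , b) ++_) (go bs))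

-- Ring arithmetic as programs

module RingPrograms {ℓ₁ ℓ₂ : Level} (F : DiscreteField ℓ₁ ℓ₂) (R : RootFinder F) where
  open Machine F R
  open PolynomialTime F R
  open ℕₚ.≤-Reasoning

  opaque
    mapᵖ : ∀ {A B C} → A ↝ list B → A ×̇ B ↝ C → A ↝ list C
    mapᵖ e f = forᵖ e (consᵖ f nilᵖ)

    mapᵖ-correct : ∀ {A B C} (e : A ↝ list B) (f : A ×̇ B ↝ C) a →
                   ⟪ mapᵖ e f ⟫ a ≡ map (λ b → ⟪ f ⟫ (a , b)) (⟪ e ⟫ a)
    mapᵖ-correct e f a = ≡.trans (forᵖ-correct e (consᵖ f nilᵖ) a) (go (⟪ e ⟫ a))
      where
      go : ∀ bs → concatMap (λ b → ⟪ f ⟫ (a , b) ∷ []) bs ≡ map (λ b → ⟪ f ⟫ (a , b)) bs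
      go []       = ≡.refl
      go (b ∷ bs) = ≡.cong (_ ∷_) (go bs)

  -- Norms, unlike sizes, behave well under repeated multiplication. The two are polynomially
  -- related by `norm≤size` and `size≤norm`, where `depth` is the nesting depth of lists.
  record RingProgram (T : Ty) : Set (Level.suc ℓ₁) where
    infixl 7 _*_
    infixl 6 _+_
    infix  8 -_
    infix  4 _≈_
    field
      _≈_     : Rel ⟦ T ⟧ ℓ₁
      _+_ _*_ : ⟦ T ⟧ → ⟦ T ⟧ → ⟦ T ⟧
      -_      : ⟦ T ⟧ → ⟦ T ⟧
      0# 1#   : ⟦ T ⟧

    rawRing : RawRing 0ℓ ℓ₁
    rawRing = record
      { Carrier = ⟦ T ⟧ ; _≈_ = _≈_ ; _+_ = _+_ ; _*_ = _*_ ; -_ = -_ ; 0# = 0# ; 1# = 1# }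

    open RawSemiringDefinitions (RawRing.rawSemiring rawRing) public using (_^_)

    field
      add mul     : T ×̇ T ↝ T
      zeroˢ oneˢ  : ∀ {A} → A ↝ T
      add-correct : ∀ a b → ⟪ add ⟫ (a , b) ≡ a + b
      mul-correct : ∀ a b → ⟪ mul ⟫ (a , b) ≡ a * b
      zero-correct : ∀ {A} (x : ⟦ A ⟧) → ⟪ zeroˢ {A} ⟫ x ≡ 0#
      one-correct  : ∀ {A} (x : ⟦ A ⟧) → ⟪ oneˢ {A} ⟫ x ≡ 1#
      isNorm      : Norm rawRing
      depth       : ℕ

    open Norm isNorm public

    field
      norm≤size : ∀ a → norm a ℕ.≤ size T a
      size≤norm : ∀ a → size T a ℕ.≤ suc (norm a) ℕ.^ depth

    size-list≤ : ∀ {N} as → All (λ a → norm a ℕ.≤ N) as → size (list T) as ℕ.≤ suc (length as ℕ.* suc N ℕ.^ depth)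
    size-list≤ []       _        = ℕₚ.≤-refl
    size-list≤ (a ∷ as) (a≤ ∷ v) = s≤s (ℕₚ.+-mono-≤
      (ℕₚ.≤-trans (size≤norm a) (ℕₚ.^-monoˡ-≤ depth (s≤s a≤))) (ℕ.s≤s⁻¹ (size-list≤ as v)))

    norms≤size : ∀ as → All (λ a → norm a ℕ.≤ size (list T) as) as
    norms≤size []       = []
    norms≤size (a ∷ as) = ℕₚ.≤-trans (norm≤size a) (ℕₚ.≤-trans (ℕₚ.m≤m+n _ _) (ℕₚ.n≤1+n _)) ∷
      All.map (λ ≤as → ℕₚ.≤-trans ≤as (s≤s (ℕₚ.m≤n+m _ (size T a)))) (norms≤size as)

    bounded-norm : ∀ {A} (g : ⟦ A ⟧ → ⟦ T ⟧) {N} → (∀ a → norm (g a) ℕ.≤ N a) →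
                   Bounded A N → Bounded A (λ a → size T (g a))
    bounded-norm g norm≤ b = bounded-≤
      (λ a → ℕₚ.≤-trans (size≤norm (g a)) (ℕₚ.^-monoˡ-≤ depth (s≤s (norm≤ a))))
      (bounded-^ depth (bounded-+ (bounded-const 1) b))

    norm-bounded : ∀ {A} (f : A ↝ T) → Bounded A (λ a → norm (⟪ f ⟫ a))
    norm-bounded f = bounded-≤ (λ a → norm≤size (⟪ f ⟫ a)) (size-bounded f)

    -- Linear in the exponent, which programs hold in unary; the extra one is for the norm of 1.
    norm-^ : ∀ x n → norm (x ^ n) ℕ.≤ suc (n ℕ.* norm x)
    norm-^ x zero    = norm-1
    norm-^ x (suc n) = begin
      norm (x * x ^ n)                ≤⟨ norm-* x _ ⟩
      norm x ℕ.+ norm (x ^ n)         ≤⟨ ℕₚ.+-monoʳ-≤ (norm x) (norm-^ x n) ⟩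
      norm x ℕ.+ suc (n ℕ.* norm x)   ≡⟨ ℕₚ.+-suc (norm x) _ ⟩
      suc (suc n ℕ.* norm x)          ∎

    private
      foldr-^ : ∀ {B} x (us : List B) → foldr (λ _ c → ⟪ mul ⟫ (x , c)) 1# us ≡ x ^ length us
      foldr-^ x []       = ≡.refl
      foldr-^ x (u ∷ us) = ≡.trans (mul-correct x _) (≡.cong (x *_) (foldr-^ x us))

    opaque
      powᵖ : ∀ {A B} → A ↝ T → A ↝ list B → A ↝ T
      powᵖ {A} {B} f e = foldrᵖ e oneˢ (mul ∘ᵖ ((f ∘ᵖ fstᵖ ∘ᵖ fstᵖ) ,ᵖ sndᵖ))
        (bounded-≤ (λ (a , us) → ℕₚ.≤-reflexive (≡.cong (size T) (≡.trans (≡.cong (λ i → foldr (λ _ c → ⟪ mul ⟫ (⟪ f ⟫ a , c)) i us) (one-correct a)) (foldr-^ (⟪ f ⟫ a) us))))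
          (bounded-norm _ (λ (a , us) → norm-^ (⟪ f ⟫ a) (length us))
            (bounded-+ (bounded-const 1) (bounded-* (bounded-≤ (λ (_ , us) → length≤size B us) (bounded-proj₂ bounded-size))
              (bounded-proj₁ (norm-bounded f))))))

      powᵖ-correct : ∀ {A B} (f : A ↝ T) (e : A ↝ list B) a → ⟪ powᵖ f e ⟫ a ≡ ⟪ f ⟫ a ^ length (⟪ e ⟫ a)
      powᵖ-correct f e a = ≡.trans (foldrᵖ-correct e oneˢ (mul ∘ᵖ ((f ∘ᵖ fstᵖ ∘ᵖ fstᵖ) ,ᵖ sndᵖ)) a)
        (≡.trans (≡.cong (λ i → foldr (λ _ c → ⟪ mul ⟫ (⟪ f ⟫ a , c)) i (⟪ e ⟫ a)) (one-correct a)) (foldr-^ (⟪ f ⟫ a) (⟪ e ⟫ a)))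

  fieldProgram : RingProgram 𝔽
  fieldProgram = record
    { RawRing (DiscreteField.rawRing F) using (_≈_; _+_; _*_; -_; 0#; 1#)
    ; add          = addFᵖ
    ; mul          = mulFᵖ
    ; zeroˢ        = zeroᵖ
    ; oneˢ         = oneᵖ
    ; add-correct  = λ _ _ → ≡.refl
    ; mul-correct  = λ _ _ → ≡.refl
    ; zero-correct = λ _ → ≡.refl
    ; one-correct  = λ _ → ≡.refl
    ; isNorm       = record
      { norm   = λ _ → 0
      ; norm-0 = ≡.refl
      ; norm-1 = z≤n
      ; norm-+ = λ _ _ → z≤n
      ; norm-* = λ _ _ → z≤n }
    ; depth        = 0
    ; norm≤size    = λ _ → z≤n
    ; size≤norm    = λ _ → ℕₚ.≤-refl
    }

  module PolynomialProgram {T : Ty} (P : RingProgram T) where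
    open RingProgram P
    open Polynomial rawRing hiding (rawRing)
    open PolynomialNorm isNorm

    size≤normₚ : ∀ p → size (list T) p ℕ.≤ suc (normₚ p) ℕ.^ suc depth
    size≤normₚ p = begin
      size (list T) p                              ≤⟨ size-list≤ p (coeffs≤normₚ p) ⟩
      suc (length p ℕ.* suc (normₚ p) ℕ.^ depth)   ≤⟨ ℕₚ.+-mono-≤ (ℕₚ.m^n>0 (suc (normₚ p)) depth) (ℕₚ.*-monoˡ-≤ _ (length≤normₚ p)) ⟩
      suc (normₚ p) ℕ.^ suc depth                  ∎

    normₚ≤size : ∀ p → normₚ p ℕ.≤ size (list T) p
    normₚ≤size []      = z≤n
    normₚ≤size (a ∷ p) = ℕₚ.⊔-lub
      (ℕₚ.≤-trans (norm≤size a) (ℕₚ.≤-trans (ℕₚ.m≤m+n _ _) (ℕₚ.n≤1+n _)))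
      (ℕₚ.⊔-lub (length≤size T (a ∷ p)) (ℕₚ.≤-trans (normₚ≤size p) (s≤s (ℕₚ.m≤n+m _ (size T a)))))

    bounded-normₚ : ∀ {A} (g : ⟦ A ⟧ → Poly) {N} → (∀ a → normₚ (g a) ℕ.≤ N a) →
                    Bounded A N → Bounded A (λ a → size (list T) (g a))
    bounded-normₚ g norm≤ b = bounded-≤
      (λ a → ℕₚ.≤-trans (size≤normₚ (g a)) (ℕₚ.^-monoˡ-≤ (suc depth) (s≤s (norm≤ a))))
      (bounded-^ (suc depth) (bounded-+ (bounded-const 1) b))

    private
      -- A fold consumes a single list, so what is left of the other summand has to be part of the
      -- state.
      zip : (list T ×̇ T) ×̇ (list T ×̇ list T) ↝ list T ×̇ list T
      zip = matchᵖ (fstᵖ ∘ᵖ sndᵖ)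
        (nilᵖ ,ᵖ consᵖ (sndᵖ ∘ᵖ fstᵖ) (sndᵖ ∘ᵖ sndᵖ))
        (sndᵖ ,ᵖ consᵖ (add ∘ᵖ ((sndᵖ ∘ᵖ fstᵖ ∘ᵖ fstᵖ ∘ᵖ fstᵖ) ,ᵖ (sndᵖ ∘ᵖ fstᵖ)))
                       (sndᵖ ∘ᵖ sndᵖ ∘ᵖ fstᵖ ∘ᵖ fstᵖ))

      -- The second component collects the sum in reverse order.
      zipAll : Poly → Poly → Poly → Poly × Poly
      zipAll x p state = loop (λ b c → ⟪ zip ⟫ ((x , b) , c)) (state , []) p

      +ₚ-[] : ∀ p → p +ₚ [] ≡ p
      +ₚ-[] []      = ≡.refl
      +ₚ-[] (a ∷ p) = ≡.refl

      unzip : Poly × Poly → Poly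
      unzip (q , acc) = loop _∷_ q acc

      unzip-zip : ∀ x p q acc →
        unzip (loop (λ b c → ⟪ zip ⟫ ((x , b) , c)) (q , acc) p) ≡ loop _∷_ (p +ₚ q) acc
      unzip-zip x []      q       acc = ≡.refl
      unzip-zip x (a ∷ p) []      acc = ≡.trans (unzip-zip x p [] (a ∷ acc))
        (≡.cong (λ r → loop _∷_ (a ∷ r) acc) (+ₚ-[] p))
      unzip-zip x (a ∷ p) (b ∷ q) acc = ≡.trans (unzip-zip x p q _)
        (≡.cong (λ r → loop _∷_ (r ∷ p +ₚ q) acc) (add-correct a b))

      zip-size : ∀ q p → size (list T ×̇ list T) (zipAll q p q) ≡ suc (size (list T) (p +ₚ q))
      zip-size q p = ≡.trans (≡.cong suc (ℕₚ.+-suc _ _)) (≡.cong (λ n → suc (suc n))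
        (≡.trans (≡.sym (sizes-loop-∷ T _ (proj₂ (zipAll q p q)))) (≡.cong (sizes T) (unzip-zip q p q []))))

      norm-sum : ∀ (x : Poly × Poly) → normₚ (proj₂ x +ₚ proj₁ x) ℕ.≤ size (list T) (proj₂ x) ℕ.+ size (list T) (proj₁ x)
      norm-sum (q , p) = ℕₚ.≤-trans (Norm.norm-+ polynomialNorm p q)
        (ℕₚ.≤-trans (ℕₚ.m⊔n≤m+n (normₚ p) (normₚ q)) (ℕₚ.+-mono-≤ (normₚ≤size p) (normₚ≤size q)))

      zipAllᵖ : list T ×̇ list T ↝ list T ×̇ list T
      zipAllᵖ = foldlᵖ {A = list T} (idᵖ ,ᵖ nilᵖ) zip
        (bounded-≤ (λ (q , p) → ℕₚ.≤-reflexive (zip-size q p))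
          (bounded-+ (bounded-const 1) (bounded-normₚ (λ (q , p) → p +ₚ q) norm-sum
            (bounded-+ (bounded-proj₂ bounded-size) (bounded-proj₁ bounded-size)))))

      unzipᵖ : list T ×̇ list T ↝ list T
      unzipᵖ = foldlᵖ {A = list T} idᵖ (consᵖ (sndᵖ ∘ᵖ fstᵖ) sndᵖ)
        (bounded-≤ (λ (q , p) → ℕₚ.≤-trans (ℕₚ.≤-reflexive (≡.cong suc (sizes-loop-∷ T q p)))
            (ℕₚ.+-monoʳ-≤ (size (list T) q) (ℕₚ.n≤1+n (sizes T p))))
          (bounded-+ (bounded-proj₁ bounded-size) (bounded-proj₂ bounded-size)))

    opaque
      addₚ : list T ×̇ list T ↝ list T
      addₚ = unzipᵖ ∘ᵖ zipAllᵖ ∘ᵖ (sndᵖ ,ᵖ fstᵖ)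

      addₚ-correct : ∀ p q → ⟪ addₚ ⟫ (p , q) ≡ p +ₚ q
      addₚ-correct p q = unzip-zip q p q []

    opaque
      private
        multiplier : ((list T ×̇ list T) ×̇ T) ×̇ list T ↝ list T
        multiplier = sndᵖ ∘ᵖ fstᵖ ∘ᵖ fstᵖ

        scaleOne : (((list T ×̇ list T) ×̇ T) ×̇ list T) ×̇ T ↝ T
        scaleOne = mul ∘ᵖ ((sndᵖ ∘ᵖ fstᵖ ∘ᵖ fstᵖ) ,ᵖ sndᵖ)

        mulStep : ((list T ×̇ list T) ×̇ T) ×̇ list T ↝ list T
        mulStep = addₚ ∘ᵖ (mapᵖ multiplier scaleOne ,ᵖ consᵖ zeroˢ sndᵖ)

        mulStep-correct : ∀ x q a c → ⟪ mulStep ⟫ (((x , q) , a) , c) ≡ map (a *_) q +ₚ (0# ∷ c)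
        mulStep-correct x q a c = ≡.trans (addₚ-correct _ _) (≡.cong₂ (λ u v → u +ₚ (v ∷ c))
          (≡.trans (mapᵖ-correct multiplier scaleOne (((x , q) , a) , c)) (go q))
          (zero-correct {((list T ×̇ list T) ×̇ T) ×̇ list T} (((x , q) , a) , c)))
          where
          go : ∀ r → map (λ b → ⟪ mul ⟫ (a , b)) r ≡ map (a *_) r
          go []      = ≡.refl
          go (b ∷ r) = ≡.cong₂ _∷_ (mul-correct a b) (go r)

        foldr-*ₚ : ∀ x q p → foldr (λ a c → ⟪ mulStep ⟫ (((x , q) , a) , c)) [] p ≡ p *ₚ q
        foldr-*ₚ x q []      = ≡.refl
        foldr-*ₚ x q (a ∷ p) = ≡.trans (mulStep-correct x q a _)
          (≡.cong (λ r → map (a *_) q +ₚ (0# ∷ r)) (foldr-*ₚ x q p))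

      mulₚ : list T ×̇ list T ↝ list T
      mulₚ = foldrᵖ fstᵖ nilᵖ mulStep
        (bounded-≤ (λ ((x , q) , p) → ℕₚ.≤-reflexive (≡.cong (size (list T)) (foldr-*ₚ x q p)))
          (bounded-normₚ (λ ((x , q) , p) → p *ₚ q)
            (λ ((x , q) , p) → ℕₚ.≤-trans (Norm.norm-* polynomialNorm p q) (ℕₚ.+-mono-≤ (normₚ≤size p) (normₚ≤size q)))
            (bounded-+ (bounded-proj₂ bounded-size) (bounded-proj₁ (bounded-proj₂ bounded-size)))))

      mulₚ-correct : ∀ p q → ⟪ mulₚ ⟫ (p , q) ≡ p *ₚ q
      mulₚ-correct p q = ≡.trans (foldrᵖ-correct fstᵖ nilᵖ mulStep (p , q)) (foldr-*ₚ p q p)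

    polynomialProgram : RingProgram (list T)
    polynomialProgram = record
      { RawRing (Polynomial.rawRing rawRing) using (_≈_; _+_; _*_; -_; 0#; 1#)
      ; add          = addₚ
      ; mul          = mulₚ
      ; zeroˢ        = nilᵖ
      ; oneˢ         = consᵖ oneˢ nilᵖ
      ; add-correct  = addₚ-correct
      ; mul-correct  = mulₚ-correct
      ; zero-correct = λ _ → ≡.refl
      ; one-correct  = λ x → ≡.cong (_∷ []) (one-correct x)
      ; isNorm       = polynomialNorm
      ; depth        = suc depth
      ; norm≤size    = normₚ≤size
      ; size≤norm    = size≤normₚ
      }

    -- Every Horner round adds the norm of w, while adding a coefficient only takes a maximum.
    norm-eval : ∀ p w → norm (eval p w) ℕ.≤ normₚ p ℕ.+ length p ℕ.* norm w
    norm-eval p w = go p (coeffs≤normₚ p)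
      where
      go : ∀ {N} q → All (λ a → norm a ℕ.≤ N) q → norm (eval q w) ℕ.≤ N ℕ.+ length q ℕ.* norm w
      go []      _        = ℕₚ.≤-trans (ℕₚ.≤-reflexive norm-0) z≤n
      go {N} (a ∷ q) (a≤ ∷ v) = ℕₚ.≤-trans (norm-+ a (w * eval q w)) (ℕₚ.⊔-lub
        (ℕₚ.≤-trans a≤ (ℕₚ.m≤m+n N _))
        (begin
          norm (w * eval q w)                      ≤⟨ norm-* w _ ⟩
          norm w ℕ.+ norm (eval q w)               ≤⟨ ℕₚ.+-monoʳ-≤ (norm w) (go q v) ⟩
          norm w ℕ.+ (N ℕ.+ length q ℕ.* norm w)   ≡⟨ ℕₚ.+-assoc (norm w) N _ ⟨
          norm w ℕ.+ N ℕ.+ length q ℕ.* norm w     ≡⟨ ≡.cong (ℕ._+ length q ℕ.* norm w) (ℕₚ.+-comm (norm w) N) ⟩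
          N ℕ.+ norm w ℕ.+ length q ℕ.* norm w     ≡⟨ ℕₚ.+-assoc N (norm w) _ ⟩
          N ℕ.+ suc (length q) ℕ.* norm w          ∎))

    opaque
      private
        evalStep : ((list T ×̇ T) ×̇ T) ×̇ T ↝ T
        evalStep = add ∘ᵖ ((sndᵖ ∘ᵖ fstᵖ) ,ᵖ (mul ∘ᵖ ((sndᵖ ∘ᵖ fstᵖ ∘ᵖ fstᵖ) ,ᵖ sndᵖ)))

        foldr-eval : ∀ f w p → foldr (λ a v → ⟪ evalStep ⟫ (((f , w) , a) , v)) (⟪ zeroˢ {list T ×̇ T} ⟫ (f , w)) p ≡ eval p w
        foldr-eval f w []      = zero-correct {list T ×̇ T} (f , w)
        foldr-eval f w (a ∷ p) = ≡.trans (add-correct a _)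
          (≡.cong (a +_) (≡.trans (mul-correct w _) (≡.cong (w *_) (foldr-eval f w p))))

      evalᵖ : list T ×̇ T ↝ T
      evalᵖ = foldrᵖ fstᵖ zeroˢ evalStep
        (bounded-≤ (λ ((f , w) , p) → ℕₚ.≤-reflexive (≡.cong (size T) (foldr-eval f w p)))
          (bounded-norm (λ ((f , w) , p) → eval p w) (λ ((f , w) , p) → norm-eval p w)
            (bounded-+ (bounded-proj₂ (bounded-≤ normₚ≤size bounded-size))
              (bounded-* (bounded-proj₂ (bounded-≤ (length≤size T) bounded-size))
                (bounded-proj₁ (bounded-proj₂ (bounded-≤ norm≤size bounded-size)))))))

      evalᵖ-correct : ∀ p w → ⟪ evalᵖ ⟫ (p , w) ≡ eval p w
      evalᵖ-correct p w = ≡.trans (foldrᵖ-correct fstᵖ zeroˢ evalStep (p , w)) (foldr-eval p w p)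

  tailᵖ : ∀ {A C} → A ↝ list C → A ↝ list C
  tailᵖ f = matchᵖ f nilᵖ sndᵖ

  private
    dropStep : ∀ {A B C} → (A ×̇ B) ×̇ list C ↝ list C
    dropStep = tailᵖ sndᵖ

    size-dropStep : ∀ {A B C} x cs → size (list C) (⟪ dropStep {A} {B} {C} ⟫ (x , cs)) ℕ.≤ size (list C) cs
    size-dropStep         x []       = ℕₚ.≤-refl
    size-dropStep {C = C} x (c ∷ cs) = s≤s (ℕₚ.m≤n+m _ (size C c))

    dropStep-drop : ∀ {A B C} x n cs → ⟪ dropStep {A} {B} {C} ⟫ (x , drop n cs) ≡ drop (suc n) cs
    dropStep-drop x zero    []       = ≡.refl
    dropStep-drop x zero    (c ∷ cs) = ≡.refl
    dropStep-drop x (suc n) []       = ≡.refl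
    dropStep-drop x (suc n) (c ∷ cs) = dropStep-drop x n cs

    foldr-dropStep : ∀ {A B C} a cs us →
      foldr (λ b c → ⟪ dropStep {A} {B} {C} ⟫ ((a , b) , c)) cs us ≡ drop (length us) cs
    foldr-dropStep a cs []       = ≡.refl
    foldr-dropStep {A} {B} {C} a cs (u ∷ us) = ≡.trans
      (≡.cong (λ c → ⟪ dropStep {A} {B} {C} ⟫ ((a , u) , c)) (foldr-dropStep {A} {B} {C} a cs us))
      (dropStep-drop {A} {B} {C} (a , u) (length us) cs)

    size-dropSteps : ∀ {A B C} a cs us →
      size (list C) (foldr (λ b c → ⟪ dropStep {A} {B} {C} ⟫ ((a , b) , c)) cs us) ℕ.≤ size (list C) cs
    size-dropSteps a cs []       = ℕₚ.≤-refl
    size-dropSteps {A} {B} {C} a cs (u ∷ us) = ℕₚ.≤-trans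
      (size-dropStep {A} {B} {C} (a , u) (foldr (λ b c → ⟪ dropStep {A} {B} {C} ⟫ ((a , b) , c)) cs us))
      (size-dropSteps {A} {B} {C} a cs us)

  opaque
    dropᵖ : ∀ {A B C} → A ↝ list B → A ↝ list C → A ↝ list C
    dropᵖ {A} {B} {C} e f = foldrᵖ e f dropStep
      (bounded-≤ (λ (a , us) → size-dropSteps {A} {B} {C} a (⟪ f ⟫ a) us) (bounded-proj₁ (size-bounded f)))

    dropᵖ-correct : ∀ {A B C} (e : A ↝ list B) (f : A ↝ list C) a →
                    ⟪ dropᵖ e f ⟫ a ≡ drop (length (⟪ e ⟫ a)) (⟪ f ⟫ a)
    dropᵖ-correct {A} {B} {C} e f a = ≡.trans (foldrᵖ-correct e f dropStep a)
      (foldr-dropStep {A} {B} {C} a (⟪ f ⟫ a) (⟪ e ⟫ a))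

  module Coefficient {T : Ty} (P : RingProgram T) where
    open RingProgram P using (rawRing; 0#; zeroˢ; zero-correct)
    open Polynomial rawRing using (Poly; coeff)

    private
      coeff-drop : ∀ p n → (drop n p ≡ [] × coeff p n ≡ 0#) ⊎ (∃[ q ] drop n p ≡ coeff p n ∷ q)
      coeff-drop []      zero    = inj₁ (≡.refl , ≡.refl)
      coeff-drop []      (suc n) = inj₁ (≡.refl , ≡.refl)
      coeff-drop (a ∷ p) zero    = inj₂ (p , ≡.refl)
      coeff-drop (a ∷ p) (suc n) = coeff-drop p n

    opaque
      coeffᵖ : ∀ {A B} → A ↝ list T → A ↝ list B → A ↝ T
      coeffᵖ f e = matchᵖ (dropᵖ e f) zeroˢ (sndᵖ ∘ᵖ fstᵖ)

      coeffᵖ-correct : ∀ {A B} (f : A ↝ list T) (e : A ↝ list B) a →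
        ⟪ coeffᵖ f e ⟫ a ≡ coeff (⟪ f ⟫ a) (length (⟪ e ⟫ a))
      coeffᵖ-correct f e a with coeff-drop (⟪ f ⟫ a) (length (⟪ e ⟫ a))
      ... | inj₁ (d , c) = ≡.trans (matchᵖ-[] (dropᵖ e f) zeroˢ (sndᵖ ∘ᵖ fstᵖ) a (≡.trans (dropᵖ-correct e f a) d))
        (≡.trans (zero-correct a) (≡.sym c))
      ... | inj₂ (q , d) = matchᵖ-∷ (dropᵖ e f) zeroˢ (sndᵖ ∘ᵖ fstᵖ) a (≡.trans (dropᵖ-correct e f a) d)

-- Programs for polynomials and interpolation

module FieldPrograms {ℓ₁ ℓ₂ : Level} (F : DiscreteField ℓ₁ ℓ₂) (R : RootFinder F) where
  open DiscreteField F using (inverse)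
  open Machine F R
  open PolynomialTime F R
  open RingPrograms F R
  open FieldPolynomials F
  open Monicisation F
  open ℕₚ.≤-Reasoning

  private
    stripStep : ∀ {A B} → A ×̇ B ↝ bool → A ×̇ B ↝ B → (A ×̇ B) ×̇ list B ↝ list B
    stripStep t r = matchᵖ sndᵖ
      (condᵖ (t ∘ᵖ fstᵖ) nilᵖ (consᵖ (r ∘ᵖ fstᵖ) nilᵖ))
      (consᵖ (sndᵖ ∘ᵖ fstᵖ ∘ᵖ fstᵖ ∘ᵖ fstᵖ) (sndᵖ ∘ᵖ fstᵖ ∘ᵖ fstᵖ))

    stripStep-correct : ∀ {A B} (t : A ×̇ B ↝ bool) (r : A ×̇ B ↝ B) a b bs →
      ⟪ stripStep t r ⟫ ((a , b) , bs) ≡ stripCons (λ b → ⟪ t ⟫ (a , b)) (λ b → ⟪ r ⟫ (a , b)) b bs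
    stripStep-correct t r a b []       = ≡.refl
    stripStep-correct t r a b (_ ∷ bs) = ≡.refl

    foldr-stripStep : ∀ {A B} (t : A ×̇ B ↝ bool) (r : A ×̇ B ↝ B) a bs →
      foldr (λ b c → ⟪ stripStep t r ⟫ ((a , b) , c)) [] bs ≡ strip (λ b → ⟪ t ⟫ (a , b)) (λ b → ⟪ r ⟫ (a , b)) bs
    foldr-stripStep t r a []       = ≡.refl
    foldr-stripStep t r a (b ∷ bs) = ≡.trans (stripStep-correct t r a b (foldr (λ b c → ⟪ stripStep t r ⟫ ((a , b) , c)) [] bs))
      (≡.cong (stripCons (λ b → ⟪ t ⟫ (a , b)) (λ b → ⟪ r ⟫ (a , b)) b) (foldr-stripStep t r a bs))

    -- Only the last remaining element is changed, so a single value of `r` contributes, and M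
    -- bounds it.
    sizes-strip : ∀ {B} (t : ⟦ B ⟧ → Bool) (r : ⟦ B ⟧ → ⟦ B ⟧) bs M →
      (∀ b → size B b ℕ.≤ size (list B) bs → size B (r b) ℕ.≤ M) →
      sizes B (strip t r bs) ℕ.≤ sizes B bs ℕ.+ M
    sizes-strip t r []       M h = z≤n
    sizes-strip {B} t r (b ∷ bs) M h = go (strip t r bs)
        (sizes-strip {B} t r bs M λ c c≤ → h c (ℕₚ.≤-trans c≤ (s≤s (ℕₚ.m≤n+m _ (size B b)))))
      where
      go : ∀ cs → sizes B cs ℕ.≤ sizes B bs ℕ.+ M → sizes B (stripCons t r b cs) ℕ.≤ sizes B (b ∷ bs) ℕ.+ M
      go (c ∷ cs) ≤M = ℕₚ.≤-trans (ℕₚ.+-monoʳ-≤ (size B b) ≤M) (ℕₚ.≤-reflexive (≡.sym (ℕₚ.+-assoc (size B b) _ M)))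
      go [] _ with t b
      ... | true  = z≤n
      ... | false = begin
        size B (r b) ℕ.+ 0        ≡⟨ ℕₚ.+-identityʳ _ ⟩
        size B (r b)              ≤⟨ h b (ℕₚ.≤-trans (ℕₚ.m≤m+n _ _) (ℕₚ.n≤1+n _)) ⟩
        M                         ≤⟨ ℕₚ.m≤n+m M _ ⟩
        sizes B (b ∷ bs) ℕ.+ M    ∎

  opaque
    stripᵖ : ∀ {A B} → A ↝ list B → A ×̇ B ↝ bool → A ×̇ B ↝ B → A ↝ list B
    stripᵖ {A} {B} e t r = foldrᵖ e nilᵖ (stripStep t r)
      (bounded-≤ (λ (a , bs) → ℕₚ.≤-trans (ℕₚ.≤-reflexive (≡.cong (size (list B)) (foldr-stripStep t r a bs)))
          (s≤s (sizes-strip {B} (λ b → ⟪ t ⟫ (a , b)) (λ b → ⟪ r ⟫ (a , b)) bs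
            (C ℕ.* (size A a ℕ.+ size (list B) bs) ℕ.^ k) λ b b≤ → ℕₚ.≤-trans (Bounded.bound (size-bounded r) (a , b))
            (ℕₚ.*-monoʳ-≤ C (ℕₚ.^-monoˡ-≤ k (ℕₚ.+-monoʳ-≤ (size A a) b≤))))))
        (bounded-+ (bounded-proj₂ bounded-size) (bounded-* (bounded-const C) (bounded-^ k bounded-size))))
      where open Bounded (size-bounded r) renaming (constant to C; exponent to k)

    stripᵖ-correct : ∀ {A B} (e : A ↝ list B) (t : A ×̇ B ↝ bool) (r : A ×̇ B ↝ B) a →
      ⟪ stripᵖ e t r ⟫ a ≡ strip (λ b → ⟪ t ⟫ (a , b)) (λ b → ⟪ r ⟫ (a , b)) (⟪ e ⟫ a)
    stripᵖ-correct e t r a = ≡.trans (foldrᵖ-correct e nilᵖ (stripStep t r) a) (foldr-stripStep t r a (⟪ e ⟫ a))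

  module Kᵖ = RingProgram (PolynomialProgram.polynomialProgram fieldProgram)

  private
    size-𝔽s : ∀ (p : Poly) → size (list 𝔽) p ≡ suc (length p)
    size-𝔽s []      = ≡.refl
    size-𝔽s (a ∷ p) = ≡.cong suc (size-𝔽s p)

  opaque
    unfolding trim

    trimᵖ : ∀ {A} → A ↝ list 𝔽 → A ↝ list 𝔽
    trimᵖ e = stripᵖ e (isZeroᵖ ∘ᵖ sndᵖ) sndᵖ

    trimᵖ-correct : ∀ {A} (e : A ↝ list 𝔽) a → ⟪ trimᵖ e ⟫ a ≡ trim (⟪ e ⟫ a)
    trimᵖ-correct e a = stripᵖ-correct e (isZeroᵖ ∘ᵖ sndᵖ) sndᵖ a

  open Coefficient fieldProgram

  opaque
    lastᵖ : ∀ {A} → A ↝ list 𝔽 → A ↝ 𝔽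
    lastᵖ e = coeffᵖ e (tailᵖ e)

    tailᵖ-correct : ∀ {A C} (e : A ↝ list C) a → ⟪ tailᵖ e ⟫ a ≡ drop 1 (⟪ e ⟫ a)
    tailᵖ-correct e a = go _ ≡.refl
      where
      go : ∀ cs → ⟪ e ⟫ a ≡ cs → ⟪ tailᵖ e ⟫ a ≡ drop 1 cs
      go []       = matchᵖ-[] e nilᵖ sndᵖ a
      go (c ∷ cs) = matchᵖ-∷ e nilᵖ sndᵖ a

    lastᵖ-correct : ∀ {A} (e : A ↝ list 𝔽) a → ⟪ lastᵖ e ⟫ a ≡ last (⟪ e ⟫ a)
    lastᵖ-correct e a = ≡.trans (coeffᵖ-correct e (tailᵖ e) a)
      (≡.cong (λ us → coeff (⟪ e ⟫ a) (length us)) (tailᵖ-correct e a))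

  private
    ratioᵖ powerᵖ sumᵖ : ∀ {A} → A ↝ list 𝔽 → A ↝ list 𝔽 → A ↝ list 𝔽
    ratioᵖ u v = consᵖ (negFᵖ ∘ᵖ mulFᵖ ∘ᵖ (lastᵖ u ,ᵖ (invFᵖ ∘ᵖ lastᵖ v))) nilᵖ
    powerᵖ u v = Kᵖ.powᵖ (consᵖ zeroᵖ (consᵖ oneᵖ nilᵖ)) (dropᵖ v u)
    sumᵖ u v = Kᵖ.add ∘ᵖ (u ,ᵖ (Kᵖ.mul ∘ᵖ ((Kᵖ.mul ∘ᵖ (ratioᵖ u v ,ᵖ powerᵖ u v)) ,ᵖ v)))

  opaque
    cancelᵖ : ∀ {A} → A ↝ list 𝔽 → A ↝ list 𝔽 → A ↝ list 𝔽
    cancelᵖ u v = trimᵖ (sumᵖ u v)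

    cancelᵖ-correct : ∀ {A} (u v : A ↝ list 𝔽) a → ⟪ cancelᵖ u v ⟫ a ≡ cancel (⟪ u ⟫ a) (⟪ v ⟫ a)
    cancelᵖ-correct {A} u v a = ≡.trans (trimᵖ-correct (sumᵖ u v) a) (≡.cong trim
      (≡.trans (Kᵖ.add-correct (⟪ u ⟫ a) (⟪ Kᵖ.mul ⟫ (⟪ Kᵖ.mul ⟫ (ratio , power) , ⟪ v ⟫ a))) (≡.cong (⟪ u ⟫ a +ₚ_)
        (≡.trans (Kᵖ.mul-correct (⟪ Kᵖ.mul ⟫ (ratio , power)) (⟪ v ⟫ a)) (≡.cong (_*ₚ ⟪ v ⟫ a)
          (≡.trans (Kᵖ.mul-correct ratio power) (≡.cong₂ _*ₚ_
            (≡.cong₂ (λ x y → - (x * inverse y) ∷ []) (lastᵖ-correct u a) (lastᵖ-correct v a))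
            (≡.trans (Kᵖ.powᵖ-correct (consᵖ zeroᵖ (consᵖ oneᵖ nilᵖ)) (dropᵖ v u) a)
              (≡.cong (λ us → X ^ length us) (dropᵖ-correct v u a))))))))))
      where
      open DiscreteField F using (_*_; -_)
      ratio power : Poly
      ratio = ⟪ ratioᵖ u v ⟫ a
      power = ⟪ powerᵖ u v ⟫ a

  private
    U V : ∀ {A B} → (A ×̇ B) ×̇ (list 𝔽 ×̇ list 𝔽) ↝ list 𝔽
    U = fstᵖ ∘ᵖ sndᵖ
    V = sndᵖ ∘ᵖ sndᵖ

    euclidStepᵖ : ∀ {A B} → (A ×̇ B) ×̇ (list 𝔽 ×̇ list 𝔽) ↝ list 𝔽 ×̇ list 𝔽
    euclidStepᵖ = matchᵖ (dropᵖ U V) (cancelᵖ U V ,ᵖ V) ((U ,ᵖ cancelᵖ V U) ∘ᵖ fstᵖ ∘ᵖ fstᵖ)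

    euclidStepᵖ-correct : ∀ {A B} (x : ⟦ A ×̇ B ⟧) u v → ⟪ euclidStepᵖ {A} {B} ⟫ (x , u , v) ≡ euclidStep (u , v)
    euclidStepᵖ-correct {A} {B} x u v = go (drop (length u) v) (dropᵖ-correct U V γ)
      where
      Γ : Ty
      Γ = (A ×̇ B) ×̇ (list 𝔽 ×̇ list 𝔽)
      γ : ⟦ Γ ⟧
      γ = x , u , v
      bigger : (Γ ×̇ 𝔽) ×̇ list 𝔽 ↝ list 𝔽 ×̇ list 𝔽
      bigger = (U ,ᵖ cancelᵖ V U) ∘ᵖ fstᵖ ∘ᵖ fstᵖ
      go : ∀ d → ⟪ dropᵖ {Γ} U V ⟫ γ ≡ d → ⟪ euclidStepᵖ {A} {B} ⟫ γ ≡ reduceBy d u v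
      go []      eq = ≡.trans (matchᵖ-[] (dropᵖ {Γ} U V) (cancelᵖ U V ,ᵖ V) bigger γ eq)
        (≡.cong (_, v) (cancelᵖ-correct {Γ} U V γ))
      go (_ ∷ _) eq = ≡.trans (matchᵖ-∷ (dropᵖ {Γ} U V) (cancelᵖ U V ,ᵖ V) bigger γ eq)
        (≡.cong (u ,_) (cancelᵖ-correct {Γ} V U γ))

    foldr-euclidStepᵖ : ∀ {A B} (a : ⟦ A ⟧) st (us : List ⟦ B ⟧) →
      foldr (λ b c → ⟪ euclidStepᵖ {A} {B} ⟫ ((a , b) , c)) st us ≡ euclid st us
    foldr-euclidStepᵖ a st []       = ≡.refl
    foldr-euclidStepᵖ {A} {B} a st (b ∷ us) = ≡.trans
      (≡.cong (λ c → ⟪ euclidStepᵖ {A} {B} ⟫ ((a , b) , c)) (foldr-euclidStepᵖ {A} {B} a st us))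
      (euclidStepᵖ-correct {A} {B} (a , b) _ _)

    length-trim≤ : ∀ x → length (trim x) ℕ.≤ length x
    length-trim≤ x = trim-length≤ x (coeff-≥length x)

    euclidStartᵖ : list 𝔽 ×̇ list 𝔽 ↝ list 𝔽 ×̇ list 𝔽
    euclidStartᵖ = trimᵖ fstᵖ ,ᵖ trimᵖ sndᵖ

    euclidStartᵖ-correct : ∀ x y → ⟪ euclidStartᵖ ⟫ (x , y) ≡ (trim x , trim y)
    euclidStartᵖ-correct x y = ≡.cong₂ _,_ (trimᵖ-correct fstᵖ (x , y)) (trimᵖ-correct sndᵖ (x , y))

    -- The invariant on the total length holds after any number of rounds, hence for every
    -- intermediate state of the loop.
    size-euclid : ∀ x y (us : Poly) →
      size (list 𝔽 ×̇ list 𝔽) (euclid (trim x , trim y) us) ℕ.≤ size (list 𝔽 ×̇ list 𝔽) (x , y)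
    size-euclid x y us = begin
      size (list 𝔽) u ℕ.+ size (list 𝔽) v ≡⟨ ≡.cong₂ ℕ._+_ (size-𝔽s u) (size-𝔽s v) ⟩
      suc (length u) ℕ.+ suc (length v)   ≡⟨ ≡.cong suc (ℕₚ.+-suc (length u) (length v)) ⟩
      2 ℕ.+ (length u ℕ.+ length v)       ≤⟨ ℕₚ.+-monoʳ-≤ 2 (EuclidState.lengths (euclid-state x y us)) ⟩
      2 ℕ.+ (length (trim x) ℕ.+ length (trim y)) ≤⟨ ℕₚ.+-monoʳ-≤ 2 (ℕₚ.+-mono-≤ (length-trim≤ x) (length-trim≤ y)) ⟩
      2 ℕ.+ (length x ℕ.+ length y)       ≡⟨ ≡.cong suc (ℕₚ.+-suc (length x) (length y)) ⟨
      suc (length x) ℕ.+ suc (length y)   ≡⟨ ≡.cong₂ ℕ._+_ (size-𝔽s x) (size-𝔽s y) ⟨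
      size (list 𝔽) x ℕ.+ size (list 𝔽) y ∎
      where
      u = proj₁ (euclid (trim x , trim y) us)
      v = proj₂ (euclid (trim x , trim y) us)

    fuelᵖ : list 𝔽 ×̇ list 𝔽 ↝ list 𝔽
    fuelᵖ = appendᵖ (trimᵖ fstᵖ) (trimᵖ sndᵖ)

    run-euclid : ∀ x y (us : Poly) →
      foldr (λ b c → ⟪ euclidStepᵖ {list 𝔽 ×̇ list 𝔽} {𝔽} ⟫ (((x , y) , b) , c)) (⟪ euclidStartᵖ ⟫ (x , y)) us
        ≡ euclid (trim x , trim y) us
    run-euclid x y us = ≡.trans (foldr-euclidStepᵖ {list 𝔽 ×̇ list 𝔽} {𝔽} (x , y) _ us)
      (≡.cong (λ st → euclid st us) (euclidStartᵖ-correct x y))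

    euclidᵖ : list 𝔽 ×̇ list 𝔽 ↝ list 𝔽 ×̇ list 𝔽
    euclidᵖ = foldrᵖ fuelᵖ euclidStartᵖ euclidStepᵖ
      (bounded-≤ (λ ((x , y) , us) → ℕₚ.≤-trans
          (ℕₚ.≤-reflexive (≡.cong (size (list 𝔽 ×̇ list 𝔽)) (run-euclid x y us))) (size-euclid x y us))
        (bounded-proj₁ bounded-size))

  opaque
    unfolding gcd

    gcdᵖ : list 𝔽 ×̇ list 𝔽 ↝ list 𝔽
    gcdᵖ = Kᵖ.add ∘ᵖ euclidᵖ

    gcdᵖ-correct : ∀ x y → ⟪ gcdᵖ ⟫ (x , y) ≡ gcd x y
    gcdᵖ-correct x y = ≡.trans (Kᵖ.add-correct (proj₁ st) (proj₂ st)) (≡.cong (λ st → proj₁ st +ₚ proj₂ st)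
      (≡.trans (foldrᵖ-correct fuelᵖ euclidStartᵖ euclidStepᵖ (x , y)) (≡.trans (run-euclid x y (⟪ fuelᵖ ⟫ (x , y)))
        (≡.cong (euclid (trim x , trim y)) (≡.trans (appendᵖ-correct (trimᵖ fstᵖ) (trimᵖ sndᵖ) (x , y))
          (≡.cong₂ _++_ (trimᵖ-correct fstᵖ (x , y)) (trimᵖ-correct sndᵖ (x , y))))))))
      where
      st : Poly × Poly
      st = ⟪ euclidᵖ ⟫ (x , y)

  private
    nullᵖ : ∀ {A B} → A ↝ list B → A ↝ bool
    nullᵖ e = matchᵖ e ttᵖ ffᵖ

    nullᵖ-correct : ∀ {A B} (e : A ↝ list B) a → ⟪ nullᵖ e ⟫ a ≡ null (⟪ e ⟫ a)
    nullᵖ-correct e a = go _ ≡.refl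
      where
      go : ∀ bs → ⟪ e ⟫ a ≡ bs → ⟪ nullᵖ e ⟫ a ≡ null bs
      go []       = matchᵖ-[] e ttᵖ ffᵖ a
      go (_ ∷ bs) = matchᵖ-∷ e ttᵖ ffᵖ a

  opaque
    divisibleByᵖ : list 𝔽 ×̇ list 𝔽 ↝ bool
    divisibleByᵖ = nullᵖ (dropᵖ (gcdᵖ ∘ᵖ (sndᵖ ,ᵖ fstᵖ)) (trimᵖ fstᵖ))

    divisibleByᵖ-correct : ∀ p c → ⟪ divisibleByᵖ ⟫ (p , c) ≡ divisibleBy p c
    divisibleByᵖ-correct p c = ≡.trans (nullᵖ-correct (dropᵖ (gcdᵖ ∘ᵖ (sndᵖ ,ᵖ fstᵖ)) (trimᵖ fstᵖ)) (p , c))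
      (≡.cong null (≡.trans (dropᵖ-correct (gcdᵖ ∘ᵖ (sndᵖ ,ᵖ fstᵖ)) (trimᵖ fstᵖ) (p , c))
        (≡.cong₂ (λ g q → drop (length g) q) (gcdᵖ-correct c p) (trimᵖ-correct fstᵖ (p , c)))))

  private
    strip-cong : ∀ {A : Set} {t t′ : A → Bool} (r : A → A) → (∀ a → t a ≡ t′ a) → ∀ as → strip t r as ≡ strip t′ r as
    strip-cong r e []       = ≡.refl
    strip-cong {t = t} {t′} r e (a ∷ as) = ≡.trans (≡.cong (stripCons t r a) (strip-cong r e as)) (cons-cong a (strip t′ r as))
      where
      cons-cong : ∀ a bs → stripCons t r a bs ≡ stripCons t′ r a bs
      cons-cong a []       = ≡.cong (λ b → if b then [] else r a ∷ []) (e a)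
      cons-cong a (_ ∷ bs) = ≡.refl

  opaque
    unfolding monicise

    moniciseᵖ : list 𝔽 ×̇ list (list 𝔽) ↝ list (list 𝔽)
    moniciseᵖ = stripᵖ sndᵖ (divisibleByᵖ ∘ᵖ ((fstᵖ ∘ᵖ fstᵖ) ,ᵖ sndᵖ)) (consᵖ oneᵖ nilᵖ)

    moniciseᵖ-correct : ∀ p f → ⟪ moniciseᵖ ⟫ (p , f) ≡ monicise p f
    moniciseᵖ-correct p f = ≡.trans (stripᵖ-correct sndᵖ (divisibleByᵖ ∘ᵖ ((fstᵖ ∘ᵖ fstᵖ) ,ᵖ sndᵖ)) (consᵖ oneᵖ nilᵖ) (p , f))
      (strip-cong _ (divisibleByᵖ-correct p) f)

-- The unary counterpart of `downFrom`: the proper suffixes of a list of length n have the lengths n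
-- - 1, ..., 0.
suffixes : ∀ {B : Set} → List B → List (List B)
suffixes []       = []
suffixes (b ∷ bs) = bs ∷ suffixes bs

concatMap-suffixes : ∀ {B C D : Set} (h : C → D) (f : List B → List C) (g : ℕ → List D) →
  (∀ us → map h (f us) ≡ g (length us)) → ∀ bs → map h (concatMap f (suffixes bs)) ≡ concatMap g (downFrom (length bs))
concatMap-suffixes h f g e []       = ≡.refl
concatMap-suffixes h f g e (b ∷ bs) = ≡.trans (map-++ h (f bs) _) (≡.cong₂ _++_ (e bs) (concatMap-suffixes h f g e bs))

module InterpolationPrograms {ℓ₁ ℓ₂ : Level} (F : DiscreteField ℓ₁ ℓ₂) (R : RootFinder F) where
  open DiscreteField F using (inverse)
  open Machine F R
  open PolynomialTime F R
  open RingPrograms F R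
  open FieldPrograms F R
  open FieldPolynomials F
  open Elimination F
  open Interpolation F
  open ℕₚ.≤-Reasoning

  -- Lists of field elements serve as unary numbers, which bound the number of
  -- rounds of a loop by the size of its input.
  U : Ty
  U = list 𝔽

  sucᵘ : ∀ {A} → A ↝ U → A ↝ U
  sucᵘ = consᵖ zeroᵖ

  opaque
    addᵘ mulᵘ subᵘ : ∀ {A} → A ↝ U → A ↝ U → A ↝ U
    addᵘ = appendᵖ
    mulᵘ f g = forᵖ f (g ∘ᵖ fstᵖ)
    subᵘ f g = dropᵖ g f

  module _ {A : Ty} (f g : A ↝ U) (a : ⟦ A ⟧) where
    opaque
      unfolding addᵘ mulᵘ subᵘ

      addᵘ-length : length (⟪ addᵘ f g ⟫ a) ≡ length (⟪ f ⟫ a) ℕ.+ length (⟪ g ⟫ a)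
      addᵘ-length = ≡.trans (≡.cong length (appendᵖ-correct f g a)) (length-++ (⟪ f ⟫ a))

      mulᵘ-length : length (⟪ mulᵘ f g ⟫ a) ≡ length (⟪ f ⟫ a) ℕ.* length (⟪ g ⟫ a)
      mulᵘ-length = ≡.trans (≡.cong length (forᵖ-correct f (g ∘ᵖ fstᵖ) a)) (go (⟪ f ⟫ a))
        where
        go : ∀ (us : List ⟦ 𝔽 ⟧) → length (concatMap (λ _ → ⟪ g ⟫ a) us) ≡ length us ℕ.* length (⟪ g ⟫ a)
        go []       = ≡.refl
        go (u ∷ us) = ≡.trans (length-++ (⟪ g ⟫ a)) (≡.cong (length (⟪ g ⟫ a) ℕ.+_) (go us))

      subᵘ-length : length (⟪ subᵘ f g ⟫ a) ≡ length (⟪ f ⟫ a) ℕ.∸ length (⟪ g ⟫ a)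
      subᵘ-length = ≡.trans (≡.cong length (dropᵖ-correct g f a)) (length-drop (length (⟪ g ⟫ a)) (⟪ f ⟫ a))

  private
    suffixStep : ∀ {A B} → (A ×̇ B) ×̇ (list B ×̇ list (list B)) ↝ list B ×̇ list (list B)
    suffixStep = consᵖ (sndᵖ ∘ᵖ fstᵖ) (fstᵖ ∘ᵖ sndᵖ) ,ᵖ consᵖ (fstᵖ ∘ᵖ sndᵖ) (sndᵖ ∘ᵖ sndᵖ)

    foldr-suffixStep : ∀ {A B} a bs →
      foldr (λ b c → ⟪ suffixStep {A} {B} ⟫ ((a , b) , c)) ([] , []) bs ≡ (bs , suffixes bs)
    foldr-suffixStep a []       = ≡.refl
    foldr-suffixStep {A} {B} a (b ∷ bs) = ≡.cong (λ st → b ∷ proj₁ st , proj₁ st ∷ proj₂ st) (foldr-suffixStep {A} {B} a bs)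

    sizes-suffixes : ∀ B bs → sizes (list B) (suffixes bs) ℕ.≤ length bs ℕ.* size (list B) bs
    sizes-suffixes B []       = z≤n
    sizes-suffixes B (b ∷ bs) = ℕₚ.+-mono-≤ shorter
        (ℕₚ.≤-trans (sizes-suffixes B bs) (ℕₚ.*-monoʳ-≤ (length bs) shorter))
      where
      shorter : size (list B) bs ℕ.≤ size (list B) (b ∷ bs)
      shorter = s≤s (ℕₚ.m≤n+m _ (size B b))

    suffixesᵖ : ∀ {A B} → A ↝ list B → A ↝ list B ×̇ list (list B)
    suffixesᵖ {A} {B} e = foldrᵖ e (nilᵖ ,ᵖ nilᵖ) suffixStep
      (bounded-≤ (λ (a , bs) → ℕₚ.≤-trans
          (ℕₚ.≤-reflexive (≡.cong (size (list B ×̇ list (list B))) (foldr-suffixStep {A} {B} a bs)))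
          (ℕₚ.+-monoʳ-≤ (size (list B) bs) (s≤s (ℕₚ.≤-trans (sizes-suffixes B bs)
            (ℕₚ.*-monoˡ-≤ (size (list B) bs) (length≤size B bs))))))
        (bounded-proj₂ (bounded-+ bounded-size (bounded-+ (bounded-const 1) (bounded-* bounded-size bounded-size)))))

  opaque
    forBelowᵖ : ∀ {A B C} → A ↝ list B → A ×̇ list B ↝ list C → A ↝ list C
    forBelowᵖ e f = forᵖ (sndᵖ ∘ᵖ suffixesᵖ e) f

  module _ {A B C : Ty} (e : A ↝ list B) (f : A ×̇ list B ↝ list C) (a : ⟦ A ⟧) where
    opaque
      unfolding forBelowᵖ

      forBelowᵖ-map : ∀ {D : Set} (h : ⟦ C ⟧ → D) (g : ℕ → List D) → (∀ us → map h (⟪ f ⟫ (a , us)) ≡ g (length us)) →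
        map h (⟪ forBelowᵖ e f ⟫ a) ≡ concatMap g (downFrom (length (⟪ e ⟫ a)))
      forBelowᵖ-map h g eq = ≡.trans (≡.cong (map h) (≡.trans (forᵖ-correct (sndᵖ ∘ᵖ suffixesᵖ e) f a)
        (≡.cong (λ st → concatMap (λ b → ⟪ f ⟫ (a , b)) (proj₂ st)) (≡.trans
          (foldrᵖ-correct e (nilᵖ ,ᵖ nilᵖ) suffixStep a) (foldr-suffixStep {A} {B} a (⟪ e ⟫ a))))))
        (concatMap-suffixes h (λ us → ⟪ f ⟫ (a , us)) g eq (⟪ e ⟫ a))

      forBelowᵖ-correct : (g : ℕ → List ⟦ C ⟧) → (∀ us → ⟪ f ⟫ (a , us) ≡ g (length us)) →
        ⟪ forBelowᵖ e f ⟫ a ≡ concatMap g (downFrom (length (⟪ e ⟫ a)))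
      forBelowᵖ-correct g eq = ≡.trans (≡.sym (map-id _))
        (forBelowᵖ-map (λ c → c) g λ us → ≡.trans (map-id _) (eq us))

  -- p, f, n, d, e, ω, W
  Parameters : Ty
  Parameters = list 𝔽 ×̇ list (list 𝔽) ×̇ U ×̇ U ×̇ U ×̇ U ×̇ U

  module _ {A : Ty} (x : A ↝ Parameters) where
    pᵉ nᵉ dᵉ eᵉ ωᵉ Wᵉ multiplicityᵖ blocksᵖ rowsᵖ weightᵖ : A ↝ U
    fᵉ : A ↝ list (list 𝔽)
    pᵉ = fstᵖ ∘ᵖ x
    fᵉ = fstᵖ ∘ᵖ sndᵖ ∘ᵖ x
    nᵉ = fstᵖ ∘ᵖ sndᵖ ∘ᵖ sndᵖ ∘ᵖ x
    dᵉ = fstᵖ ∘ᵖ sndᵖ ∘ᵖ sndᵖ ∘ᵖ sndᵖ ∘ᵖ x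
    eᵉ = fstᵖ ∘ᵖ sndᵖ ∘ᵖ sndᵖ ∘ᵖ sndᵖ ∘ᵖ sndᵖ ∘ᵖ x
    ωᵉ = fstᵖ ∘ᵖ sndᵖ ∘ᵖ sndᵖ ∘ᵖ sndᵖ ∘ᵖ sndᵖ ∘ᵖ sndᵖ ∘ᵖ x
    Wᵉ = sndᵖ ∘ᵖ sndᵖ ∘ᵖ sndᵖ ∘ᵖ sndᵖ ∘ᵖ sndᵖ ∘ᵖ sndᵖ ∘ᵖ x
    multiplicityᵖ = mulᵘ eᵉ (sucᵘ eᵉ)
    blocksᵖ       = mulᵘ nᵉ (sucᵘ eᵉ)
    rowsᵖ         = mulᵘ blocksᵖ dᵉ
    weightᵖ       = addᵘ (mulᵘ Wᵉ rowsᵖ) (addᵘ (mulᵘ multiplicityᵖ eᵉ) (mulᵘ multiplicityᵖ nᵉ))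

    module _ (a : ⟦ A ⟧) where
      private
        n = length (⟪ nᵉ ⟫ a)
        d = length (⟪ dᵉ ⟫ a)
        e = length (⟪ eᵉ ⟫ a)
        ω = length (⟪ ωᵉ ⟫ a)
        W = length (⟪ Wᵉ ⟫ a)

      multiplicityᵖ-length : length (⟪ multiplicityᵖ ⟫ a) ≡ Counting.multiplicity n d e ω W
      multiplicityᵖ-length = mulᵘ-length eᵉ (sucᵘ eᵉ) a

      blocksᵖ-length : length (⟪ blocksᵖ ⟫ a) ≡ Counting.blocks n d e ω W
      blocksᵖ-length = mulᵘ-length nᵉ (sucᵘ eᵉ) a

      rowsᵖ-length : length (⟪ rowsᵖ ⟫ a) ≡ Counting.rows n d e ω W
      rowsᵖ-length = ≡.trans (mulᵘ-length blocksᵖ dᵉ a) (≡.cong (ℕ._* d) blocksᵖ-length)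

      weightᵖ-length : length (⟪ weightᵖ ⟫ a) ≡ Counting.weight n d e ω W
      weightᵖ-length = ≡.trans (addᵘ-length (mulᵘ Wᵉ rowsᵖ) (addᵘ (mulᵘ multiplicityᵖ eᵉ) (mulᵘ multiplicityᵖ nᵉ)) a)
        (≡.cong₂ ℕ._+_ (≡.trans (mulᵘ-length Wᵉ rowsᵖ a) (≡.cong (W ℕ.*_) rowsᵖ-length))
          (≡.trans (addᵘ-length (mulᵘ multiplicityᵖ eᵉ) (mulᵘ multiplicityᵖ nᵉ) a) (≡.cong₂ ℕ._+_
            (≡.trans (mulᵘ-length multiplicityᵖ eᵉ a) (≡.cong (ℕ._* e) multiplicityᵖ-length))
            (≡.trans (mulᵘ-length multiplicityᵖ nᵉ a) (≡.cong (ℕ._* n) multiplicityᵖ-length)))))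

  module Bᵖ = RingProgram (PolynomialProgram.polynomialProgram (PolynomialProgram.polynomialProgram fieldProgram))

  Bivariate : Ty
  Bivariate = list (list 𝔽)

  private
    xᵖ zᵖ : ∀ {A} → A ↝ Bivariate
    xᵖ = consᵖ nilᵖ (consᵖ (consᵖ oneᵖ nilᵖ) nilᵖ)
    zᵖ = consᵖ (consᵖ zeroᵖ (consᵖ oneᵖ nilᵖ)) nilᵖ

  opaque
    itemᵖ : ∀ {A} → A ↝ Bivariate → A ↝ list 𝔽 → A ↝ U → A ↝ U → A ↝ U → A ↝ U → A ↝ Bivariate
    itemᵖ f p k i j a = Bᵖ.mul ∘ᵖ (Bᵖ.powᵖ xᵖ j ,ᵖ (Bᵖ.mul ∘ᵖ (Bᵖ.powᵖ zᵖ a ,ᵖ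
      (Bᵖ.mul ∘ᵖ (Bᵖ.powᵖ f i ,ᵖ Bᵖ.powᵖ (consᵖ p nilᵖ) (subᵘ k i))))))

    itemᵖ-correct : ∀ {A} (f : A ↝ Bivariate) (p : A ↝ list 𝔽) (k i j a : A ↝ U) x →
      ⟪ itemᵖ f p k i j a ⟫ x ≡ item (⟪ f ⟫ x) (⟪ p ⟫ x) (length (⟪ k ⟫ x)) (length (⟪ i ⟫ x)) (length (⟪ j ⟫ x)) (length (⟪ a ⟫ x))
    itemᵖ-correct f p k i j a x = mul≡ (Bᵖ.powᵖ-correct xᵖ j x) (mul≡ (Bᵖ.powᵖ-correct zᵖ a x)
        (mul≡ (Bᵖ.powᵖ-correct f i x) (≡.trans (Bᵖ.powᵖ-correct (consᵖ p nilᵖ) (subᵘ k i) x)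
          (≡.cong ((⟪ p ⟫ x ∷ []) B.^_) (subᵘ-length k i x)))))
      where
      mul≡ : ∀ {P P′ Q Q′ : B.Poly} → P ≡ P′ → Q ≡ Q′ → ⟪ Bᵖ.mul ⟫ (P , Q) ≡ P′ B.*ₚ Q′
      mul≡ ≡.refl ≡.refl = Bᵖ.mul-correct _ _

  private
    δ₂ : ∀ {A B C} → (A ×̇ B) ×̇ C ↝ A
    δ₂ = fstᵖ ∘ᵖ fstᵖ

    δ₃ : ∀ {A B C D} → ((A ×̇ B) ×̇ C) ×̇ D ↝ A
    δ₃ = fstᵖ ∘ᵖ fstᵖ ∘ᵖ fstᵖ

    itemCountᵖ : (Parameters ×̇ U) ×̇ U ↝ U
    itemCountᵖ = subᵘ (weightᵖ δ₂) (addᵘ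
      (mulᵘ (Wᵉ δ₂) (addᵘ sndᵖ (mulᵘ (sndᵖ ∘ᵖ fstᵖ) (dᵉ δ₂))))
      (mulᵘ (subᵘ (multiplicityᵖ δ₂) (sndᵖ ∘ᵖ fstᵖ)) (nᵉ δ₂)))

    itemRowᵖ : (Parameters ×̇ U) ×̇ U ↝ list Bivariate
    itemRowᵖ = forBelowᵖ itemCountᵖ (consᵖ
      (itemᵖ (fᵉ δ₃) (pᵉ δ₃) (multiplicityᵖ δ₃) (sndᵖ ∘ᵖ fstᵖ ∘ᵖ fstᵖ) (sndᵖ ∘ᵖ fstᵖ) sndᵖ) nilᵖ)

  opaque
    itemsᵖ : Parameters ↝ list Bivariate
    itemsᵖ = forBelowᵖ (blocksᵖ idᵖ) (forBelowᵖ (dᵉ fstᵖ) itemRowᵖ)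

  lowᵖ : ∀ {A} → A ↝ Parameters → A ↝ U → A ↝ U
  lowᵖ x r = subᵘ (mulᵘ (multiplicityᵖ x) (eᵉ x)) (mulᵘ r (ωᵉ x))

  private
    positionCountᵖ : Parameters ×̇ U ↝ U
    positionCountᵖ = subᵘ (subᵘ (weightᵖ fstᵖ) (mulᵘ (Wᵉ fstᵖ) sndᵖ)) (lowᵖ fstᵖ sndᵖ)

    positionRowᵖ : Parameters ×̇ U ↝ list (U ×̇ U)
    positionRowᵖ = forBelowᵖ positionCountᵖ
      (consᵖ ((sndᵖ ∘ᵖ fstᵖ) ,ᵖ addᵘ (lowᵖ δ₂ (sndᵖ ∘ᵖ fstᵖ)) sndᵖ) nilᵖ)

  opaque
    positionsᵖ : Parameters ↝ list (U ×̇ U)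
    positionsᵖ = forBelowᵖ (rowsᵖ idᵖ) positionRowᵖ

  lengths : List (⟦ 𝔽 ⟧) × List (⟦ 𝔽 ⟧) → ℕ × ℕ
  lengths (r , a) = length r , length a

  module _ (x : ⟦ Parameters ⟧) where
    private
      p = proj₁ x
      f = proj₁ (proj₂ x)
      n = length (⟪ nᵉ idᵖ ⟫ x)
      d = length (⟪ dᵉ idᵖ ⟫ x)
      e = length (⟪ eᵉ idᵖ ⟫ x)
      ω = length (⟪ ωᵉ idᵖ ⟫ x)
      W = length (⟪ Wᵉ idᵖ ⟫ x)
      k = Counting.multiplicity n d e ω W
      L = Counting.weight n d e ω W

      itemCountᵖ-length : ∀ i j → length (⟪ itemCountᵖ ⟫ ((x , i) , j)) ≡
        L ℕ.∸ (W ℕ.* (length j ℕ.+ length i ℕ.* d) ℕ.+ (k ℕ.∸ length i) ℕ.* n)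
      itemCountᵖ-length i j = ≡.trans (subᵘ-length (weightᵖ δ₂) sum c) (≡.cong₂ ℕ._∸_ (weightᵖ-length δ₂ c)
        (≡.trans (addᵘ-length w·row excess c) (≡.cong₂ ℕ._+_
          (≡.trans (mulᵘ-length (Wᵉ δ₂) row c) (≡.cong (W ℕ.*_)
            (≡.trans (addᵘ-length sndᵖ (mulᵘ (sndᵖ ∘ᵖ fstᵖ) (dᵉ δ₂)) c)
              (≡.cong (length j ℕ.+_) (mulᵘ-length (sndᵖ ∘ᵖ fstᵖ) (dᵉ δ₂) c)))))
          (≡.trans (mulᵘ-length k-i (nᵉ δ₂) c) (≡.cong (ℕ._* n)
            (≡.trans (subᵘ-length (multiplicityᵖ δ₂) (sndᵖ ∘ᵖ fstᵖ) c)
              (≡.cong (ℕ._∸ length i) (multiplicityᵖ-length δ₂ c))))))))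
        where
        c : ⟦ (Parameters ×̇ U) ×̇ U ⟧
        c = (x , i) , j
        row k-i w·row excess sum : (Parameters ×̇ U) ×̇ U ↝ U
        row    = addᵘ sndᵖ (mulᵘ (sndᵖ ∘ᵖ fstᵖ) (dᵉ δ₂))
        k-i    = subᵘ (multiplicityᵖ δ₂) (sndᵖ ∘ᵖ fstᵖ)
        w·row  = mulᵘ (Wᵉ δ₂) row
        excess = mulᵘ k-i (nᵉ δ₂)
        sum    = addᵘ w·row excess

      lowᵖ-length : ∀ {A} (y : A ↝ Parameters) (r : A ↝ U) c → ⟪ y ⟫ c ≡ x →
        length (⟪ lowᵖ y r ⟫ c) ≡ k ℕ.* e ℕ.∸ length (⟪ r ⟫ c) ℕ.* ω
      lowᵖ-length y r c ≡.refl = ≡.trans (subᵘ-length (mulᵘ (multiplicityᵖ y) (eᵉ y)) (mulᵘ r (ωᵉ y)) c)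
        (≡.cong₂ ℕ._∸_ (≡.trans (mulᵘ-length (multiplicityᵖ y) (eᵉ y) c) (≡.cong (ℕ._* e) (multiplicityᵖ-length y c)))
          (mulᵘ-length r (ωᵉ y) c))

      positionCountᵖ-length : ∀ r → length (⟪ positionCountᵖ ⟫ (x , r)) ≡
        (L ℕ.∸ W ℕ.* length r) ℕ.∸ (k ℕ.* e ℕ.∸ length r ℕ.* ω)
      positionCountᵖ-length r = ≡.trans
        (subᵘ-length (subᵘ (weightᵖ fstᵖ) (mulᵘ (Wᵉ fstᵖ) sndᵖ)) (lowᵖ fstᵖ sndᵖ) (x , r))
        (≡.cong₂ ℕ._∸_
          (≡.trans (subᵘ-length (weightᵖ fstᵖ) (mulᵘ (Wᵉ fstᵖ) sndᵖ) (x , r))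
            (≡.cong₂ ℕ._∸_ (weightᵖ-length fstᵖ (x , r)) (mulᵘ-length (Wᵉ fstᵖ) sndᵖ (x , r))))
          (lowᵖ-length fstᵖ sndᵖ (x , r) ≡.refl))

    opaque
      unfolding itemsᵖ

      itemsᵖ-correct : ⟪ itemsᵖ ⟫ x ≡ items n d e ω W f p
      itemsᵖ-correct = ≡.trans (forBelowᵖ-correct (blocksᵖ idᵖ) (forBelowᵖ (dᵉ fstᵖ) itemRowᵖ) x
          (λ i → concatMap (itemRow n d e ω W f p i) (downFrom d)) λ i →
            forBelowᵖ-correct (dᵉ fstᵖ) itemRowᵖ (x , i) (itemRow n d e ω W f p (length i)) λ j →
              ≡.trans (forBelowᵖ-correct itemCountᵖ _ ((x , i) , j) (λ a → item f p k (length i) (length j) a ∷ []) λ a →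
                  ≡.cong (_∷ []) (≡.trans
                    (itemᵖ-correct (fᵉ δ₃) (pᵉ δ₃) (multiplicityᵖ δ₃) (sndᵖ ∘ᵖ fstᵖ ∘ᵖ fstᵖ) (sndᵖ ∘ᵖ fstᵖ) sndᵖ (((x , i) , j) , a))
                    (≡.cong (λ k → item f p k (length i) (length j) (length a)) (multiplicityᵖ-length δ₃ (((x , i) , j) , a)))))
                (≡.cong (λ N → concatMap (λ a → item f p k (length i) (length j) a ∷ []) (downFrom N)) (itemCountᵖ-length i j)))
        (≡.cong (λ N → concatMap (λ i → concatMap (itemRow n d e ω W f p i) (downFrom d)) (downFrom N)) (blocksᵖ-length idᵖ x))

    opaque
      unfolding positionsᵖ

      -- Stated through `lengths`, because different lists can represent the same unary number.
      positionsᵖ-correct : map lengths (⟪ positionsᵖ ⟫ x) ≡ positions n d e ω W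
      positionsᵖ-correct = ≡.trans (forBelowᵖ-map (rowsᵖ idᵖ) positionRowᵖ x lengths (positionRow n d e ω W) λ r →
          ≡.trans (forBelowᵖ-map positionCountᵖ _ (x , r) lengths
              (λ a → (length r , (k ℕ.* e ℕ.∸ length r ℕ.* ω) ℕ.+ a) ∷ []) λ a →
                ≡.cong (λ b → (length r , b) ∷ []) (≡.trans (addᵘ-length (lowᵖ δ₂ (sndᵖ ∘ᵖ fstᵖ)) sndᵖ ((x , r) , a))
                  (≡.cong (ℕ._+ length a) (lowᵖ-length δ₂ (sndᵖ ∘ᵖ fstᵖ) ((x , r) , a) ≡.refl))))
            (≡.cong (λ N → concatMap (λ a → (length r , (k ℕ.* e ℕ.∸ length r ℕ.* ω) ℕ.+ a) ∷ []) (downFrom N))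
              (positionCountᵖ-length r)))
        (≡.cong (λ N → concatMap (positionRow n d e ω W) (downFrom N)) (rowsᵖ-length idᵖ x))

-- Elimination as a program

module EliminationPrograms {ℓ₁ ℓ₂ : Level} (F : DiscreteField ℓ₁ ℓ₂) (R : RootFinder F) where
  open DiscreteField F using (inverse; _*_; -_; Carrier)
  open Machine F R
  open PolynomialTime F R
  open RingPrograms F R
  open FieldPrograms F R
  open InterpolationPrograms F R
  open FieldPolynomials F
  open Elimination F
  open Interpolation F
  open ℕₚ.≤-Reasoning

  Position State : Ty
  Position = U ×̇ U
  State    = list Bivariate ×̇ list Bivariate

  private
    module C₁ = Coefficient fieldProgram
    module C₂ = Coefficient (PolynomialProgram.polynomialProgram fieldProgram)

    φ : ⟦ Position ⟧ → B.Poly → Carrier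
    φ x = coordinate (lengths x)

  opaque
    coordinateᵖ : ∀ {A} → A ↝ Position → A ↝ Bivariate → A ↝ 𝔽
    coordinateᵖ x q = C₁.coeffᵖ (C₂.coeffᵖ q (fstᵖ ∘ᵖ x)) (sndᵖ ∘ᵖ x)

    coordinateᵖ-correct : ∀ {A} (x : A ↝ Position) (q : A ↝ Bivariate) a →
      ⟪ coordinateᵖ x q ⟫ a ≡ φ (⟪ x ⟫ a) (⟪ q ⟫ a)
    coordinateᵖ-correct x q a = ≡.trans (C₁.coeffᵖ-correct (C₂.coeffᵖ q (fstᵖ ∘ᵖ x)) (sndᵖ ∘ᵖ x) a)
      (≡.cong (λ c → coeff c (length (proj₂ (⟪ x ⟫ a)))) (C₂.coeffᵖ-correct q (fstᵖ ∘ᵖ x) a))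

    combineᵖ : ∀ {A} → A ↝ 𝔽 → A ↝ Bivariate → A ↝ Bivariate → A ↝ Bivariate
    combineᵖ c q p = Bᵖ.add ∘ᵖ (q ,ᵖ (Bᵖ.mul ∘ᵖ (consᵖ (consᵖ c nilᵖ) nilᵖ ,ᵖ p)))

    combineᵖ-correct : ∀ {A} (c : A ↝ 𝔽) (q p : A ↝ Bivariate) a →
      ⟪ combineᵖ c q p ⟫ a ≡ combine (⟪ c ⟫ a) (⟪ q ⟫ a) (⟪ p ⟫ a)
    combineᵖ-correct c q p a = ≡.trans (Bᵖ.add-correct (⟪ q ⟫ a) _)
      (≡.cong (⟪ q ⟫ a B.+ₚ_) (Bᵖ.mul-correct ((⟪ c ⟫ a ∷ []) ∷ []) (⟪ p ⟫ a)))

  private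
    Γ Δ : Ty
    Γ = ((Position ×̇ list Bivariate) ×̇ Bivariate) ×̇ State
    Δ = (Γ ×̇ Bivariate) ×̇ list Bivariate

    xᵉ : Γ ↝ Position
    xᵉ = fstᵖ ∘ᵖ fstᵖ ∘ᵖ fstᵖ

    qᵉ : Γ ↝ Bivariate
    qᵉ = sndᵖ ∘ᵖ fstᵖ

    pᵉ′ : Δ ↝ Bivariate
    pᵉ′ = sndᵖ ∘ᵖ fstᵖ

    γᵉ : Δ ↝ Γ
    γᵉ = fstᵖ ∘ᵖ fstᵖ

    choosePivot : Γ ↝ State
    choosePivot = condᵖ (isZeroᵖ ∘ᵖ coordinateᵖ xᵉ qᵉ)
      (nilᵖ ,ᵖ consᵖ qᵉ (sndᵖ ∘ᵖ sndᵖ)) (consᵖ qᵉ nilᵖ ,ᵖ (sndᵖ ∘ᵖ sndᵖ))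

    factor : Δ ↝ 𝔽
    factor = negFᵖ ∘ᵖ mulFᵖ ∘ᵖ (coordinateᵖ (xᵉ ∘ᵖ γᵉ) (qᵉ ∘ᵖ γᵉ) ,ᵖ (invFᵖ ∘ᵖ coordinateᵖ (xᵉ ∘ᵖ γᵉ) pᵉ′))

    subtractPivot : Δ ↝ State
    subtractPivot = (fstᵖ ∘ᵖ sndᵖ ∘ᵖ γᵉ) ,ᵖ consᵖ (combineᵖ factor (qᵉ ∘ᵖ γᵉ) pᵉ′) (sndᵖ ∘ᵖ sndᵖ ∘ᵖ γᵉ)

    eliminateStep : Γ ↝ State
    eliminateStep = matchᵖ (fstᵖ ∘ᵖ sndᵖ) choosePivot subtractPivot

    eliminateStep-correct : ∀ x qs q st →
      ⟪ eliminateStep ⟫ (((x , qs) , q) , st) ≡ eliminateCons combine (φ x) q st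
    eliminateStep-correct x qs q ([] , done) =
      ≡.cong (λ c → if isZero c then ([] , q ∷ done) else (q ∷ [] , done))
        (coordinateᵖ-correct xᵉ qᵉ (((x , qs) , q) , [] , done))
    eliminateStep-correct x qs q (p ∷ ps , done) = ≡.cong (λ r → p ∷ ps , r ∷ done)
      (≡.trans (combineᵖ-correct factor (qᵉ ∘ᵖ γᵉ) pᵉ′ δ)
        (≡.cong₂ (λ u v → combine (- (u * inverse v)) q p)
          (coordinateᵖ-correct (xᵉ ∘ᵖ γᵉ) (qᵉ ∘ᵖ γᵉ) δ) (coordinateᵖ-correct (xᵉ ∘ᵖ γᵉ) pᵉ′ δ)))
      where
      δ : ⟦ Δ ⟧
      δ = (((((x , qs) , q) , p ∷ ps , done)) , p) , ps

    foldr-eliminateStep : ∀ x qs₀ qs →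
      foldr (λ q st → ⟪ eliminateStep ⟫ (((x , qs₀) , q) , st)) ([] , []) qs ≡ eliminate combine (φ x) qs
    foldr-eliminateStep x qs₀ []       = ≡.refl
    foldr-eliminateStep x qs₀ (q ∷ qs) = ≡.trans
      (eliminateStep-correct x qs₀ q (foldr (λ q st → ⟪ eliminateStep ⟫ (((x , qs₀) , q) , st)) ([] , []) qs))
      (≡.cong (eliminateCons combine (φ x) q) (foldr-eliminateStep x qs₀ qs))

  -- A constant has norm one as a polynomial in z and x, whatever its value, so the product adds
  -- just one and the sum takes the maximum.
  norm-combine : ∀ {N} c Q P → Bᵖ.norm Q ℕ.≤ N → Bᵖ.norm P ℕ.≤ N → Bᵖ.norm (combine c Q P) ℕ.≤ suc N
  norm-combine c Q P Q≤N P≤N = ℕₚ.≤-trans (Bᵖ.norm-+ Q (((c ∷ []) ∷ []) B.*ₚ P)) (ℕₚ.⊔-lub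
    (ℕₚ.m≤n⇒m≤1+n Q≤N) (ℕₚ.≤-trans (Bᵖ.norm-* ((c ∷ []) ∷ []) P) (s≤s P≤N)))

  eliminate-norm : ∀ {N} x qs → All (λ q → Bᵖ.norm q ℕ.≤ N) qs →
    All (λ q → Bᵖ.norm q ℕ.≤ N) (proj₁ (eliminate combine (φ x) qs)) ×
    All (λ q → Bᵖ.norm q ℕ.≤ suc N) (proj₂ (eliminate combine (φ x) qs))
  eliminate-norm x qs = eliminate-All combine ℕₚ.m≤n⇒m≤1+n norm-combine (φ x) qs

  -- The norm bound grows by one per round and not by a factor, so elimination with one round per
  -- position stays polynomial.
  eliminateAll-norm : ∀ {N} xs qs → All (λ q → Bᵖ.norm q ℕ.≤ N) qs →
    All (λ q → Bᵖ.norm q ℕ.≤ length xs ℕ.+ N) (eliminateAll combine φ qs xs)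
  eliminateAll-norm []       qs v = v
  eliminateAll-norm (x ∷ xs) qs v = proj₂ (eliminate-norm x _ (eliminateAll-norm xs qs v))

  eliminateAll-length≤ : ∀ (xs : List ⟦ Position ⟧) qs → length (eliminateAll combine φ qs xs) ℕ.≤ length qs
  eliminateAll-length≤ []       qs = ℕₚ.≤-refl
  eliminateAll-length≤ (x ∷ xs) qs = begin
    length (proj₂ (eliminate combine (φ x) rest))  ≤⟨ ℕₚ.m≤n+m _ (length (proj₁ (eliminate combine (φ x) rest))) ⟩
    length (proj₁ (eliminate combine (φ x) rest)) ℕ.+ length (proj₂ (eliminate combine (φ x) rest))
                                                   ≡⟨ proj₂ (eliminate-length combine (φ x) rest) ⟩
    length rest                                    ≤⟨ eliminateAll-length≤ xs qs ⟩
    length qs                                      ∎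
    where
    rest : List B.Poly
    rest = eliminateAll combine φ qs xs

  private
    size-bivariates : ∀ {N M} qs → All (λ q → Bᵖ.norm q ℕ.≤ N) qs → length qs ℕ.≤ M →
      size (list Bivariate) qs ℕ.≤ suc (M ℕ.* suc N ℕ.^ Bᵖ.depth)
    size-bivariates qs v l = ℕₚ.≤-trans (Bᵖ.size-list≤ qs v) (s≤s (ℕₚ.*-monoˡ-≤ _ l))

    size-eliminate : ∀ x qs → let S = size (list Bivariate) qs ; E = suc (S ℕ.* suc (suc S) ℕ.^ Bᵖ.depth) in
      size State (eliminate combine (φ x) qs) ℕ.≤ E ℕ.+ E
    size-eliminate x qs = ℕₚ.+-mono-≤
      (size-bivariates _ (All.map ℕₚ.m≤n⇒m≤1+n (proj₁ norms)) (ℕₚ.≤-trans (ℕₚ.m≤m+n _ _) lengths≤))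
      (size-bivariates _ (proj₂ norms) (ℕₚ.≤-trans (ℕₚ.m≤n+m _ (length (proj₁ (eliminate combine (φ x) qs)))) lengths≤))
      where
      norms = eliminate-norm x qs (Bᵖ.norms≤size qs)
      lengths≤ : length (proj₁ (eliminate combine (φ x) qs)) ℕ.+ length (proj₂ (eliminate combine (φ x) qs))
                 ℕ.≤ size (list Bivariate) qs
      lengths≤ = ℕₚ.≤-trans (ℕₚ.≤-reflexive (proj₂ (eliminate-length combine (φ x) qs))) (length≤size Bivariate qs)

  opaque
    eliminateᵖ : Position ×̇ list Bivariate ↝ list Bivariate
    eliminateᵖ = sndᵖ ∘ᵖ foldrᵖ sndᵖ (nilᵖ ,ᵖ nilᵖ) eliminateStep
      (bounded-≤ (λ ((x , qs₀) , qs) → ℕₚ.≤-trans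
          (ℕₚ.≤-reflexive (≡.cong (size State) (foldr-eliminateStep x qs₀ qs))) (size-eliminate x qs))
        (bounded-proj₂ (bounded-+ E-bounded E-bounded)))
      where
      E-bounded : Bounded (list Bivariate) (λ qs → suc (size (list Bivariate) qs ℕ.*
        suc (suc (size (list Bivariate) qs)) ℕ.^ Bᵖ.depth))
      E-bounded = bounded-+ (bounded-const 1) (bounded-* bounded-size
        (bounded-^ Bᵖ.depth (bounded-+ (bounded-const 2) bounded-size)))

    eliminateᵖ-correct : ∀ x qs → ⟪ eliminateᵖ ⟫ (x , qs) ≡ proj₂ (eliminate combine (φ x) qs)
    eliminateᵖ-correct x qs = ≡.cong proj₂
      (≡.trans (foldrᵖ-correct sndᵖ (nilᵖ ,ᵖ nilᵖ) eliminateStep (x , qs)) (foldr-eliminateStep x qs qs))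

  private
    foldr-eliminateᵖ : ∀ qs xs →
      foldr (λ x qs → ⟪ eliminateᵖ ⟫ (x , qs)) qs xs ≡ eliminateAll combine φ qs xs
    foldr-eliminateᵖ qs []       = ≡.refl
    foldr-eliminateᵖ qs (x ∷ xs) = ≡.trans (eliminateᵖ-correct x _)
      (≡.cong (λ qs → proj₂ (eliminate combine (φ x) qs)) (foldr-eliminateᵖ qs xs))

    eliminateAll-map : ∀ qs xs → eliminateAll combine φ qs xs ≡ eliminateAll combine coordinate qs (map lengths xs)
    eliminateAll-map qs []       = ≡.refl
    eliminateAll-map qs (x ∷ xs) = ≡.cong (λ qs → proj₂ (eliminate combine (φ x) qs)) (eliminateAll-map qs xs)

    size-eliminateAll : ∀ qs xs → let S = size (list Bivariate) qs in
      size (list Bivariate) (eliminateAll combine φ qs xs)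
        ℕ.≤ suc (S ℕ.* suc (size (list Position) xs ℕ.+ S) ℕ.^ Bᵖ.depth)
    size-eliminateAll qs xs = size-bivariates _
      (All.map (λ ≤N → ℕₚ.≤-trans ≤N (ℕₚ.+-monoˡ-≤ _ (length≤size Position xs)))
        (eliminateAll-norm xs qs (Bᵖ.norms≤size qs)))
      (ℕₚ.≤-trans (eliminateAll-length≤ xs qs) (length≤size Bivariate qs))

    eliminateAllStep : (Parameters ×̇ Position) ×̇ list Bivariate ↝ list Bivariate
    eliminateAllStep = eliminateᵖ ∘ᵖ ((sndᵖ ∘ᵖ fstᵖ) ,ᵖ sndᵖ)

  opaque
    unfolding interpolants

    interpolantsᵖ : Parameters ↝ list Bivariate
    interpolantsᵖ = foldrᵖ positionsᵖ itemsᵖ eliminateAllStep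
      (bounded-≤ (λ (x , xs) → ℕₚ.≤-trans
          (ℕₚ.≤-reflexive (≡.cong (size (list Bivariate)) (foldr-eliminateᵖ (⟪ itemsᵖ ⟫ x) xs)))
          (size-eliminateAll (⟪ itemsᵖ ⟫ x) xs))
        (bounded-+ (bounded-const 1) (bounded-* (bounded-proj₁ (size-bounded itemsᵖ)) (bounded-^ Bᵖ.depth
          (bounded-+ (bounded-const 1) (bounded-+ (bounded-proj₂ bounded-size) (bounded-proj₁ (size-bounded itemsᵖ))))))))

    interpolantsᵖ-correct : ∀ x → ⟪ interpolantsᵖ ⟫ x ≡
      interpolants (length (⟪ nᵉ idᵖ ⟫ x)) (length (⟪ dᵉ idᵖ ⟫ x)) (length (⟪ eᵉ idᵖ ⟫ x))
        (length (⟪ ωᵉ idᵖ ⟫ x)) (length (⟪ Wᵉ idᵖ ⟫ x)) (⟪ fᵉ idᵖ ⟫ x) (⟪ pᵉ idᵖ ⟫ x)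
    interpolantsᵖ-correct x = ≡.trans (foldrᵖ-correct positionsᵖ itemsᵖ eliminateAllStep x)
      (≡.trans (foldr-eliminateᵖ (⟪ itemsᵖ ⟫ x) (⟪ positionsᵖ ⟫ x))
        (≡.trans (eliminateAll-map (⟪ itemsᵖ ⟫ x) (⟪ positionsᵖ ⟫ x))
          (≡.cong₂ (eliminateAll combine coordinate) (itemsᵖ-correct x) (positionsᵖ-correct x))))

-- The algorithm

open import Data.Integer.Base using (+_; -[1+_])
open import Data.Rational.Base using (ℚ; mkℚ; 0ℚ; 1ℚ; _/_; toℚᵘ)

private
  fraction : ∀ m k → toℚᵘ (+ m / suc k) ℚᵘ.≃ mkℚᵘ (+ m) k
  fraction m k = ℚₚ.toℚᵘ-fromℚᵘ (mkℚᵘ (+ m) k)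

  pos-*³ : ∀ x y z → (+ x) ℤ.* (+ y) ℤ.* (+ z) ≡ + (x ℕ.* y ℕ.* z)
  pos-*³ x y z = ≡.trans (≡.cong (ℤ._* + z) (≡.sym (ℤₚ.pos-* x y))) (≡.sym (ℤₚ.pos-* (x ℕ.* y) z))

module _ (a b-1 : ℕ) .(c : Coprime a (suc b-1)) where
  private
    β = mkℚ (+ a) b-1 c
    b = suc b-1

  -- With β = a/b, both sides are multiplied by b² d, which leaves a comparison of natural numbers
  -- that a program can test.
  degree-bound⇔ : ∀ m n d .{{_ : NonZero d}} →
    (+ m / 1 ℚ.< β ℚ.* β ℚ.* (+ n / d)) ⇔ (m ℕ.* (b ℕ.* (b ℕ.* d)) ℕ.< a ℕ.* (a ℕ.* n))
  degree-bound⇔ m n (suc d-1) = mk⇔ to from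
    where
    d = suc d-1
    rhs : ℚᵘ
    rhs = mkℚᵘ (+ a) b-1 ℚᵘ.* mkℚᵘ (+ a) b-1 ℚᵘ.* mkℚᵘ (+ n) d-1
    rhs≃ : toℚᵘ (β ℚ.* β ℚ.* (+ n / d)) ℚᵘ.≃ rhs
    rhs≃ = ℚᵘₚ.≃-trans (ℚₚ.toℚᵘ-homo-* (β ℚ.* β) (+ n / d))
      (ℚᵘₚ.*-cong {toℚᵘ (β ℚ.* β)} (ℚₚ.toℚᵘ-homo-* β β) (fraction n d-1))
    left≡ : (+ m) ℤ.* ℚᵘ.↧ rhs ≡ + (m ℕ.* (b ℕ.* (b ℕ.* d)))
    left≡ = ≡.trans (≡.sym (ℤₚ.pos-* m _)) (≡.cong (λ x → + (m ℕ.* x)) (ℕₚ.*-assoc b b d))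
    right≡ : ℚᵘ.↥ rhs ℤ.* (+ 1) ≡ + (a ℕ.* (a ℕ.* n))
    right≡ = ≡.trans (ℤₚ.*-identityʳ _) (≡.trans (pos-*³ a a n) (≡.cong +_ (ℕₚ.*-assoc a a n)))
    to : + m / 1 ℚ.< β ℚ.* β ℚ.* (+ n / d) → m ℕ.* (b ℕ.* (b ℕ.* d)) ℕ.< a ℕ.* (a ℕ.* n)
    to p with ℚᵘₚ.<-respʳ-≃ rhs≃ (ℚᵘₚ.<-respˡ-≃ (fraction m 0) (ℚₚ.toℚᵘ-mono-< p))
    ... | ℚᵘ.*<* q = ℤₚ.drop‿+<+ (≡.subst₂ ℤ._<_ left≡ right≡ q)
    from : m ℕ.* (b ℕ.* (b ℕ.* d)) ℕ.< a ℕ.* (a ℕ.* n) → + m / 1 ℚ.< β ℚ.* β ℚ.* (+ n / d)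
    from p = ℚₚ.toℚᵘ-cancel-< (ℚᵘₚ.<-respʳ-≃ (ℚᵘₚ.≃-sym rhs≃) (ℚᵘₚ.<-respˡ-≃ (ℚᵘₚ.≃-sym (fraction m 0))
      (ℚᵘ.*<* (≡.subst₂ ℤ._<_ (≡.sym left≡) (≡.sym right≡) (ℤ.+<+ p)))))

  gcd-bound⇔ : ∀ n e → (β ℚ.* (+ n / 1) ℚ.≤ + e / 1) ⇔ (a ℕ.* n ℕ.≤ b ℕ.* e)
  gcd-bound⇔ n e = mk⇔ to from
    where
    lhs : ℚᵘ
    lhs = mkℚᵘ (+ a) b-1 ℚᵘ.* mkℚᵘ (+ n) 0
    lhs≃ : toℚᵘ (β ℚ.* (+ n / 1)) ℚᵘ.≃ lhs
    lhs≃ = ℚᵘₚ.≃-trans (ℚₚ.toℚᵘ-homo-* β (+ n / 1))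
      (ℚᵘₚ.*-cong {toℚᵘ β} {toℚᵘ β} (ℚᵘₚ.≃-refl {toℚᵘ β}) (fraction n 0))
    left≡ : ℚᵘ.↥ lhs ℤ.* (+ 1) ≡ + (a ℕ.* n)
    left≡ = ≡.trans (ℤₚ.*-identityʳ _) (≡.sym (ℤₚ.pos-* a n))
    right≡ : (+ e) ℤ.* ℚᵘ.↧ lhs ≡ + (b ℕ.* e)
    right≡ = ≡.trans (≡.sym (ℤₚ.pos-* e _)) (≡.cong +_ (≡.trans (≡.cong (e ℕ.*_) (ℕₚ.*-identityʳ b)) (ℕₚ.*-comm e b)))
    to : β ℚ.* (+ n / 1) ℚ.≤ + e / 1 → a ℕ.* n ℕ.≤ b ℕ.* e
    to p with ℚᵘₚ.≤-respʳ-≃ (fraction e 0) (ℚᵘₚ.≤-respˡ-≃ lhs≃ (ℚₚ.toℚᵘ-mono-≤ p))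
    ... | ℚᵘ.*≤* q = ℤₚ.drop‿+≤+ (≡.subst₂ ℤ._≤_ left≡ right≡ q)
    from : a ℕ.* n ℕ.≤ b ℕ.* e → β ℚ.* (+ n / 1) ℚ.≤ + e / 1
    from p = ℚₚ.toℚᵘ-cancel-≤ (ℚᵘₚ.≤-respʳ-≃ (ℚᵘₚ.≃-sym (fraction e 0)) (ℚᵘₚ.≤-respˡ-≃ (ℚᵘₚ.≃-sym lhs≃)
      (ℚᵘ.*≤* (≡.subst₂ ℤ._≤_ (≡.sym left≡) (≡.sym right≡) (ℤ.+≤+ p)))))

-- Testing candidates

module Acceptance {ℓ₁ ℓ₂ : Level} (F : DiscreteField ℓ₁ ℓ₂) where
  open FieldPolynomials F
  open CommutativeRing commutativeRing hiding (_-_)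
  module B = PolynomialRing polynomialRing

  acceptTest : (a b n d m e : ℕ) → Bool
  acceptTest a b n d m e =
    if suc (m ℕ.* (b ℕ.* (b ℕ.* d))) ℕ.≤ᵇ a ℕ.* (a ℕ.* n) then a ℕ.* n ℕ.≤ᵇ b ℕ.* e else false

  module _ (p : Poly) (f : B.Poly) (n d a b : ℕ) where

    -- The two conditions with denominators cleared. The polynomial f is a parameter, since it will
    -- be exchanged for its monic representative.
    Solves : Poly → Set ℓ₁
    Solves w = (∀ m → HasDegree w m → m ℕ.* (b ℕ.* (b ℕ.* d)) ℕ.< a ℕ.* (a ℕ.* n)) ×
      (∃[ g ] ∃[ e ] IsGCD g (B.eval f w) p × HasDegree g e × a ℕ.* n ℕ.≤ b ℕ.* e)

    opaque
      -- `pred` of the length is the degree. The zero polynomial counts as having degree 0, which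
      -- passes the first test, as degree -∞ should, when a and n are positive.
      accept : Poly → Bool
      accept w = acceptTest a b n d (ℕ.pred (length (trim w))) (ℕ.pred (length (gcd (B.eval f w) p)))

    module _ (p-degree : HasDegree p n) where

      opaque
        unfolding accept

        accept-sound : ∀ w → accept w ≡ true → Solves w
        accept-sound w eq with suc (ℕ.pred (length (trim w)) ℕ.* (b ℕ.* (b ℕ.* d))) ℕ.≤ᵇ a ℕ.* (a ℕ.* n) in eq₁
        ... | true with Monicisation.gcd-degree F {p} {n} p-degree (B.eval f w)
        ...   | e , g-degree , length-g = degree-ok ,
          gcd (B.eval f w) p , e , gcd-isGCD (B.eval f w) p , g-degree ,
          subst (λ l → a ℕ.* n ℕ.≤ b ℕ.* ℕ.pred l) length-g (ℕₚ.≤ᵇ⇒≤ _ _ (subst T (≡.sym eq) tt))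
          where
          degree-ok : ∀ m → HasDegree w m → m ℕ.* (b ℕ.* (b ℕ.* d)) ℕ.< a ℕ.* (a ℕ.* n)
          degree-ok m w-degree = subst (λ l → ℕ.pred l ℕ.* (b ℕ.* (b ℕ.* d)) ℕ.< a ℕ.* (a ℕ.* n))
            (degree⇒trimmed-length (trim w) (trim-trimmed w) (degree-cong {w} {trim w} (λ i → sym (trim-≋ w i)) w-degree))
            (ℕₚ.≤ᵇ⇒≤ _ _ (subst T (≡.sym eq₁) tt))

        accept-complete : 0 ℕ.< a ℕ.* (a ℕ.* n) → ∀ w → Solves w → accept w ≡ true
        accept-complete 0<aan w (degree-ok , g , e , g-gcd , g-degree , an≤be) = both
          (ℕₚ.≤⇒≤ᵇ (small (length (trim w)) ≡.refl)) (ℕₚ.≤⇒≤ᵇ large)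
          where
          T⇒≡ : ∀ {x} → T x → x ≡ true
          T⇒≡ {true} _ = ≡.refl
          both : ∀ {x y} → T x → T y → (if x then y else false) ≡ true
          both {true} _ Ty = T⇒≡ Ty
          small : ∀ l → length (trim w) ≡ l → ℕ.pred l ℕ.* (b ℕ.* (b ℕ.* d)) ℕ.< a ℕ.* (a ℕ.* n)
          small zero    _ = 0<aan
          small (suc m) l = degree-ok m (degree-cong {trim w} {w} (trim-≋ w) (trimmed-degree (trim w) (trim-trimmed w) l))
          large : a ℕ.* n ℕ.≤ b ℕ.* ℕ.pred (length (gcd (B.eval f w) p))
          -- Greatest common divisors are unique only up to constants, but each of them divides the
          -- computed one, so the degree e of `g` is no larger.
          large with Monicisation.gcd-degree F {p} {n} p-degree (B.eval f w)
          ... | e′ , g′-degree , length-g′ = ℕₚ.≤-trans an≤be (ℕₚ.*-monoʳ-≤ b (ℕₚ.≤-trans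
            (∣⇒degree≤ g (gcd (B.eval f w) p) (IsGCD.greatest (gcd-isGCD (B.eval f w) p) g (IsGCD.divides₁ g-gcd) (IsGCD.divides₂ g-gcd))
              g-degree g′-degree)
            (ℕₚ.≤-reflexive (≡.sym (≡.cong ℕ.pred length-g′)))))

  gcd-cong : ∀ {g x y p} → (∀ {h} → h ∣ p → h ∣ x → h ∣ y) → (∀ {h} → h ∣ p → h ∣ y → h ∣ x) →
             IsGCD g x p → IsGCD g y p
  gcd-cong x⇒y y⇒x g-gcd = record
    { divides₁ = x⇒y (IsGCD.divides₂ g-gcd) (IsGCD.divides₁ g-gcd)
    ; divides₂ = IsGCD.divides₂ g-gcd
    ; greatest = λ h h∣y h∣p → IsGCD.greatest g-gcd h (y⇒x h∣p h∣y) h∣p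
    }

  solves-≋ : ∀ p f n d a b v w → v ≋ w → Solves p f n d a b v → Solves p f n d a b w
  solves-≋ p f n d a b v w v≋w (degree-ok , g , e , g-gcd , rest) =
    (λ m w-degree → degree-ok m (degree-cong {w} {v} (λ i → sym (v≋w i)) w-degree)) ,
    g , e , gcd-cong (λ _ → ∣-resp (B.eval f v) (B.eval f w) (B.eval-congʳ f {v} {w} v≋w))
      (λ _ → ∣-resp (B.eval f w) (B.eval f v) (B.eval-congʳ f {w} {v} λ i → sym (v≋w i))) g-gcd , rest

  -- A divisor of p divides f(w) exactly if it divides h(w), so both have the same greatest common
  -- divisors with p.
  solves-mod : ∀ p f h n d a b w → (∀ i → p ∣ B.coeff f i +ₚ map -_ (B.coeff h i)) →
               Solves p f n d a b w ⇔ Solves p h n d a b w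
  solves-mod p f h n d a b w f≡h = mk⇔
    (λ (degree-ok , g , e , g-gcd , rest) → degree-ok , g , e , gcd-cong f⇒h h⇒f g-gcd , rest)
    (λ (degree-ok , g , e , g-gcd , rest) → degree-ok , g , e , gcd-cong h⇒f f⇒h g-gcd , rest)
    where
    h⇒f : ∀ {q} → q ∣ p → q ∣ B.eval h w → q ∣ B.eval f w
    h⇒f q∣p = ∣-eval-≡mod f h w λ i → ∣-trans q∣p (f≡h i)
    f⇒h : ∀ {q} → q ∣ p → q ∣ B.eval f w → q ∣ B.eval h w
    f⇒h q∣p = ∣-eval-≡mod h f w λ i → ∣-flip (B.coeff f i) (B.coeff h i) (∣-trans q∣p (f≡h i))

⌊log₂⌋≤ : ∀ n → ⌊log₂ n ⌋ ℕ.≤ n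
⌊log₂⌋≤ n = ℕₚ.≤-trans (⌊log₂⌋-mono-≤ (n≤2^n n)) (ℕₚ.≤-reflexive (⌊log₂[2^n]⌋≡n n))
  where
  n≤2^n : ∀ n → n ℕ.≤ 2 ℕ.^ n
  n≤2^n zero    = z≤n
  n≤2^n (suc n) = ℕₚ.+-mono-≤ (ℕₚ.m^n>0 2 n) (ℕₚ.≤-trans (n≤2^n n) (ℕₚ.m≤m+n _ 0))

module Algorithm {ℓ₁ ℓ₂ : Level} (F : DiscreteField ℓ₁ ℓ₂) (R : RootFinder F) where
  open RootFinder R using (findRoots; findRoots-⇔)
  open Machine F R
  open PolynomialTime F R
  open RingPrograms F R
  open FieldPrograms F R
  open InterpolationPrograms F R
  open EliminationPrograms F R
  open FieldPolynomials F
  open CommutativeRing commutativeRing using (_≈_; 0#; refl; sym; trans; reflexive)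
  open Monicisation F
  open Acceptance F
  open Interpolation F using (interpolants; interpolant; coordinate)
  private module Eval = PolynomialProgram (PolynomialProgram.polynomialProgram fieldProgram)

  private
    foldr-length : ∀ {B : Set} (us : List B) → foldr (λ _ c → 1 ℕ.+ c) 0 us ≡ length us
    foldr-length []       = ≡.refl
    foldr-length (u ∷ us) = ≡.cong suc (foldr-length us)

  opaque
    lengthᵖ : ∀ {A B} → A ↝ list B → A ↝ nat
    lengthᵖ {A} {B} e = foldrᵖ e (litᵖ 0) (addℕᵖ ∘ᵖ (litᵖ 1 ,ᵖ sndᵖ))
      (bounded-≤ (λ (_ , us) → s≤s (ℕₚ.≤-trans (⌊log₂⌋≤ _)
          (ℕₚ.≤-trans (ℕₚ.≤-reflexive (foldr-length us)) (length≤size B us))))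
        (bounded-+ (bounded-const 1) (bounded-proj₂ bounded-size)))

    lengthᵖ-correct : ∀ {A B} (e : A ↝ list B) a → ⟪ lengthᵖ e ⟫ a ≡ length (⟪ e ⟫ a)
    lengthᵖ-correct e a = ≡.trans (foldrᵖ-correct e (litᵖ 0) (addℕᵖ ∘ᵖ (litᵖ 1 ,ᵖ sndᵖ)) a) (foldr-length (⟪ e ⟫ a))

  opaque
    hᵖ : Instance ↝ Bivariate
    hᵖ = moniciseᵖ ∘ᵖ (fstᵖ ,ᵖ (fstᵖ ∘ᵖ sndᵖ))

    hᵖ-correct : ∀ p f x → ⟪ hᵖ ⟫ (p , f , x) ≡ monicise p f
    hᵖ-correct p f x = moniciseᵖ-correct p f

  opaque
    -- The degree d is one less than the length of the monic representative. W is the total length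
    -- of all its coefficients, a crude bound for the length of each.
    nᵖ dᵖ Wᵖ : Instance ↝ U
    nᵖ = tailᵖ (trimᵖ fstᵖ)
    dᵖ = mapᵖ (tailᵖ hᵖ) zeroᵖ
    Wᵖ = forᵖ hᵖ sndᵖ

    nᵖ-length : ∀ p x → length (⟪ nᵖ ⟫ (p , x)) ≡ ℕ.pred (length (trim p))
    nᵖ-length p x = ≡.trans (≡.cong length (≡.trans (tailᵖ-correct (trimᵖ fstᵖ) (p , x)) (≡.cong (drop 1) (trimᵖ-correct fstᵖ (p , x)))))
      (length-drop 1 (trim p))

    dᵖ-length : ∀ x → length (⟪ dᵖ ⟫ x) ≡ ℕ.pred (length (⟪ hᵖ ⟫ x))
    dᵖ-length x = ≡.trans (≡.cong length (mapᵖ-correct (tailᵖ hᵖ) zeroᵖ x)) (≡.trans (length-map _ (⟪ tailᵖ hᵖ ⟫ x))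
      (≡.trans (≡.cong length (tailᵖ-correct hᵖ x)) (length-drop 1 (⟪ hᵖ ⟫ x))))

    length-coeff≤Wᵖ : ∀ x i → length (B.coeff (⟪ hᵖ ⟫ x) i) ℕ.≤ length (⟪ Wᵖ ⟫ x)
    length-coeff≤Wᵖ x i = ℕₚ.≤-trans (go (⟪ hᵖ ⟫ x) i) (ℕₚ.≤-reflexive (≡.cong length (≡.sym (forᵖ-correct hᵖ sndᵖ x))))
      where
      go : ∀ h i → length (B.coeff h i) ℕ.≤ length (concatMap (λ c → c) h)
      go []      i       = z≤n
      go (c ∷ h) zero    = ℕₚ.≤-trans (ℕₚ.m≤m+n _ _) (ℕₚ.≤-reflexive (≡.sym (length-++ c)))
      go (c ∷ h) (suc i) = ℕₚ.≤-trans (go h i) (ℕₚ.≤-trans (ℕₚ.m≤n+m _ (length c)) (ℕₚ.≤-reflexive (≡.sym (length-++ c))))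

  -- Pairs (e, ω) that belong to no solution may contribute arbitrary roots here; the final test
  -- discards the wrong ones.
  candidates : Poly → B.Poly → ℕ → ℕ → ℕ → List Poly
  candidates p h n d W = concatMap (λ e → concatMap (λ ω → concatMap findRoots (interpolants n d e ω W h p))
    (downFrom (suc n))) (downFrom (suc n))

  private
    δ : (Instance ×̇ U) ×̇ U ↝ Instance
    δ = fstᵖ ∘ᵖ fstᵖ

    parametersᵖ : (Instance ×̇ U) ×̇ U ↝ Parameters
    parametersᵖ = (fstᵖ ∘ᵖ δ) ,ᵖ (hᵖ ∘ᵖ δ) ,ᵖ (nᵖ ∘ᵖ δ) ,ᵖ (dᵖ ∘ᵖ δ) ,ᵖ (sndᵖ ∘ᵖ fstᵖ) ,ᵖ sndᵖ ,ᵖ (Wᵖ ∘ᵖ δ)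

    rootsOfᵖ : (Instance ×̇ U) ×̇ U ↝ Solution
    rootsOfᵖ = forᵖ (interpolantsᵖ ∘ᵖ parametersᵖ) (rootsᵖ ∘ᵖ sndᵖ)

  opaque
    candidatesᵖ : Instance ↝ Solution
    candidatesᵖ = forBelowᵖ (sucᵘ nᵖ) (forBelowᵖ (sucᵘ nᵖ ∘ᵖ fstᵖ) rootsOfᵖ)

    candidatesᵖ-correct : ∀ (x : ⟦ Instance ⟧) → ⟪ candidatesᵖ ⟫ x ≡
      candidates (proj₁ x) (⟪ hᵖ ⟫ x) (length (⟪ nᵖ ⟫ x)) (length (⟪ dᵖ ⟫ x)) (length (⟪ Wᵖ ⟫ x))
    candidatesᵖ-correct x = forBelowᵖ-correct (sucᵘ nᵖ) (forBelowᵖ (sucᵘ nᵖ ∘ᵖ fstᵖ) rootsOfᵖ) x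
        (λ e → concatMap (λ ω → concatMap findRoots (inter e ω)) (downFrom (suc n))) middle
      where
      n : ℕ
      n = length (⟪ nᵖ ⟫ x)
      inter : ℕ → ℕ → List B.Poly
      inter e ω = interpolants n (length (⟪ dᵖ ⟫ x)) e ω (length (⟪ Wᵖ ⟫ x)) (⟪ hᵖ ⟫ x) (proj₁ x)
      inner : ∀ us vs → ⟪ rootsOfᵖ ⟫ ((x , us) , vs) ≡ concatMap findRoots (inter (length us) (length vs))
      inner us vs = ≡.trans (forᵖ-correct (interpolantsᵖ ∘ᵖ parametersᵖ) (rootsᵖ ∘ᵖ sndᵖ) ((x , us) , vs))
        (≡.cong (concatMap findRoots) (interpolantsᵖ-correct (⟪ parametersᵖ ⟫ ((x , us) , vs))))
      middle : ∀ us → ⟪ forBelowᵖ (sucᵘ nᵖ ∘ᵖ fstᵖ) rootsOfᵖ ⟫ (x , us) ≡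
        concatMap (λ ω → concatMap findRoots (inter (length us) ω)) (downFrom (suc n))
      middle us = forBelowᵖ-correct (sucᵘ nᵖ ∘ᵖ fstᵖ) rootsOfᵖ (x , us) (λ ω → concatMap findRoots (inter (length us) ω)) (inner us)

  private
    aᵉ bᵉ : Instance ×̇ list 𝔽 ↝ nat
    aᵉ = fstᵖ ∘ᵖ sndᵖ ∘ᵖ sndᵖ ∘ᵖ fstᵖ
    bᵉ = sndᵖ ∘ᵖ sndᵖ ∘ᵖ sndᵖ ∘ᵖ fstᵖ

    opaque
      gᵉ : Instance ×̇ list 𝔽 ↝ list 𝔽
      gᵉ = gcdᵖ ∘ᵖ ((Eval.evalᵖ ∘ᵖ ((hᵖ ∘ᵖ fstᵖ) ,ᵖ sndᵖ)) ,ᵖ (fstᵖ ∘ᵖ fstᵖ))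

      gᵉ-correct : ∀ (x : ⟦ Instance ⟧) w → ⟪ gᵉ ⟫ (x , w) ≡ gcd (B.eval (⟪ hᵖ ⟫ x) w) (proj₁ x)
      gᵉ-correct x w = ≡.trans (gcdᵖ-correct (⟪ Eval.evalᵖ ⟫ (⟪ hᵖ ⟫ x , w)) (proj₁ x))
        (≡.cong (λ v → gcd v (proj₁ x)) (Eval.evalᵖ-correct (⟪ hᵖ ⟫ x) w))

    opaque
      nᵉ′ dᵉ′ degreeᵉ gcdDegreeᵉ : Instance ×̇ list 𝔽 ↝ nat
      nᵉ′        = lengthᵖ (nᵖ ∘ᵖ fstᵖ)
      dᵉ′        = lengthᵖ (dᵖ ∘ᵖ fstᵖ)
      degreeᵉ    = lengthᵖ (tailᵖ (trimᵖ sndᵖ))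
      gcdDegreeᵉ = lengthᵖ (tailᵖ gᵉ)

      nᵉ′-correct : ∀ (x : ⟦ Instance ⟧) w → ⟪ nᵉ′ ⟫ (x , w) ≡ length (⟪ nᵖ ⟫ x)
      nᵉ′-correct x w = lengthᵖ-correct (nᵖ ∘ᵖ fstᵖ) (x , w)

      dᵉ′-correct : ∀ (x : ⟦ Instance ⟧) w → ⟪ dᵉ′ ⟫ (x , w) ≡ length (⟪ dᵖ ⟫ x)
      dᵉ′-correct x w = lengthᵖ-correct (dᵖ ∘ᵖ fstᵖ) (x , w)

      degreeᵉ-correct : ∀ (x : ⟦ Instance ⟧) w → ⟪ degreeᵉ ⟫ (x , w) ≡ ℕ.pred (length (trim w))
      degreeᵉ-correct x w = ≡.trans (lengthᵖ-correct (tailᵖ (trimᵖ sndᵖ)) (x , w)) (≡.trans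
        (≡.cong length (≡.trans (tailᵖ-correct (trimᵖ sndᵖ) (x , w)) (≡.cong (drop 1) (trimᵖ-correct sndᵖ (x , w)))))
        (length-drop 1 (trim w)))

      gcdDegreeᵉ-correct : ∀ (x : ⟦ Instance ⟧) w →
        ⟪ gcdDegreeᵉ ⟫ (x , w) ≡ ℕ.pred (length (gcd (B.eval (⟪ hᵖ ⟫ x) w) (proj₁ x)))
      gcdDegreeᵉ-correct x w = ≡.trans (lengthᵖ-correct (tailᵖ gᵉ) (x , w)) (≡.trans
        (≡.cong length (≡.trans (tailᵖ-correct gᵉ (x , w)) (≡.cong (drop 1) (gᵉ-correct x w))))
        (length-drop 1 (gcd (B.eval (⟪ hᵖ ⟫ x) w) (proj₁ x))))

    infixl 7 _*ᵖ_
    _*ᵖ_ : ∀ {A} → A ↝ nat → A ↝ nat → A ↝ nat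
    f *ᵖ g = mulℕᵖ ∘ᵖ (f ,ᵖ g)

  opaque
    acceptᵖ : Instance ×̇ list 𝔽 ↝ bool
    acceptᵖ = condᵖ (leqℕᵖ ∘ᵖ ((addℕᵖ ∘ᵖ (litᵖ 1 ,ᵖ (degreeᵉ *ᵖ (bᵉ *ᵖ (bᵉ *ᵖ dᵉ′))))) ,ᵖ aᵉ *ᵖ (aᵉ *ᵖ nᵉ′)))
      (leqℕᵖ ∘ᵖ (aᵉ *ᵖ nᵉ′ ,ᵖ bᵉ *ᵖ gcdDegreeᵉ)) ffᵖ

    acceptᵖ-tests : ∀ p f a b w → ⟪ acceptᵖ ⟫ ((p , f , a , b) , w) ≡
      acceptTest a b (⟪ nᵉ′ ⟫ ((p , f , a , b) , w)) (⟪ dᵉ′ ⟫ ((p , f , a , b) , w))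
        (⟪ degreeᵉ ⟫ ((p , f , a , b) , w)) (⟪ gcdDegreeᵉ ⟫ ((p , f , a , b) , w))
    acceptᵖ-tests p f a b w = ≡.refl

  opaque
    unfolding accept

    acceptᵖ-correct : ∀ p f a b w → let x = p , f , a , b in
      ⟪ acceptᵖ ⟫ (x , w) ≡ accept p (⟪ hᵖ ⟫ x) (length (⟪ nᵖ ⟫ x)) (length (⟪ dᵖ ⟫ x)) a b w
    acceptᵖ-correct p f a b w = ≡.trans (acceptᵖ-tests p f a b w)
        (tests (nᵉ′-correct x w) (dᵉ′-correct x w) (degreeᵉ-correct x w) (gcdDegreeᵉ-correct x w))
      where
      x : ⟦ Instance ⟧
      x = p , f , a , b
      tests : ∀ {n n′ d d′ m m′ e e′} → n ≡ n′ → d ≡ d′ → m ≡ m′ → e ≡ e′ →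
        acceptTest a b n d m e ≡ acceptTest a b n′ d′ m′ e′
      tests ≡.refl ≡.refl ≡.refl ≡.refl = ≡.refl

  opaque
    solveᵖ : Instance ↝ Solution
    solveᵖ = forᵖ candidatesᵖ (condᵖ acceptᵖ (consᵖ sndᵖ nilᵖ) nilᵖ)

    solveᵖ-sound : ∀ (x : ⟦ Instance ⟧) w → Any (w ≋_) (⟪ solveᵖ ⟫ x) → ∃[ v ] w ≋ v × ⟪ acceptᵖ ⟫ (x , v) ≡ true
    solveᵖ-sound x w w∈ with Any.satisfied (Anyₚ.concatMap⁻ (λ v → if ⟪ acceptᵖ ⟫ (x , v) then v ∷ [] else [])
        {xs = ⟪ candidatesᵖ ⟫ x}
        (subst (Any (w ≋_)) (forᵖ-correct candidatesᵖ (condᵖ acceptᵖ (consᵖ sndᵖ nilᵖ) nilᵖ) x) w∈))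
    ... | v , w∈v with ⟪ acceptᵖ ⟫ (x , v) in eq
    ...   | true with w∈v
    ...     | here w≋v = v , w≋v , eq

    solveᵖ-complete : ∀ (x : ⟦ Instance ⟧) w → (∀ v → w ≋ v → ⟪ acceptᵖ ⟫ (x , v) ≡ true) → Any (w ≋_) (⟪ candidatesᵖ ⟫ x) →
                      Any (w ≋_) (⟪ solveᵖ ⟫ x)
    solveᵖ-complete x w accepted w∈ = subst (Any (w ≋_))
      (≡.sym (forᵖ-correct candidatesᵖ (condᵖ acceptᵖ (consᵖ sndᵖ nilᵖ) nilᵖ) x))
      (Anyₚ.concatMap⁺ (λ v → if ⟪ acceptᵖ ⟫ (x , v) then v ∷ [] else [])
        (Any.map (λ {v} w≋v → subst (λ t → Any (w ≋_) (if t then v ∷ [] else [])) (≡.sym (accepted v w≋v)) (here w≋v)) w∈))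

  private
    -- The zero polynomial has no degree; ω = 0 bounds it, and `g 0 < N` covers that case.
    degree-bound : ∀ {N} w (g : ℕ → ℕ) → g 0 ℕ.< N → (∀ m → HasDegree w m → g m ℕ.< N) →
      ∃[ ω ] (∀ i → ω ℕ.< i → coeff w i ≈ 0#) × g ω ℕ.< N
    degree-bound w g g0<N h with degree? w
    ... | inj₁ w≋0            = 0 , (λ i _ → w≋0 i) , g0<N
    ... | inj₂ (m , w-degree) = m , proj₂ w-degree , h m w-degree

    ∈-downFrom : ∀ {A : Set} {P : A → Set ℓ₁} (f : ℕ → List A) {n} i → i ℕ.< n → Any P (f i) →
                 Any P (concatMap f (downFrom n))
    ∈-downFrom f i i<n Pfi = Anyₚ.concatMap⁺ f (Anyₚ.applyDownFrom⁺ (λ i → i) Pfi i<n)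

    -- Monicity makes W d the weight of h: for r < d the coefficient has length at most W, which is
    -- at most W (d - r); at r = d it is 1, and beyond d it is zero.
    lead-weight : ∀ h d W → B.HasLead h d K.1# → (∀ i → length (B.coeff h i) ℕ.≤ W) →
      ∀ r a → W ℕ.* d ℕ.< W ℕ.* r ℕ.+ a → coordinate (r , a) h ≈ 0#
    lead-weight h d W h-lead length≤W r a l with ℕₚ.<-cmp r d
    ... | tri> _ _ d<r = proj₂ h-lead r d<r a
    ... | tri≈ _ ≡.refl _ = trans (proj₁ h-lead a) (constant a (ℕₚ.+-cancelˡ-< (W ℕ.* d) 0 a
      (ℕₚ.≤-<-trans (ℕₚ.≤-reflexive (ℕₚ.+-identityʳ _)) l)))
      where
      constant : ∀ a → 0 ℕ.< a → coeff K.1# a ≈ 0#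
      constant (suc a) _ = refl
    ... | tri< r<d _ _ = coeff-≥length (B.coeff h r) a (ℕₚ.≤-trans (length≤W r) (ℕₚ.<⇒≤
      (ℕₚ.+-cancelˡ-< (W ℕ.* r) W a (ℕₚ.≤-<-trans (ℕₚ.≤-trans
        (ℕₚ.≤-reflexive (≡.trans (ℕₚ.+-comm (W ℕ.* r) W) (≡.sym (ℕₚ.*-suc W r)))) (ℕₚ.*-monoʳ-≤ W r<d)) l))))

    -- From ω < β² n/d and β n ≤ e it follows that ω n d < (β n)² ≤ e²; the factor b² clears the
    -- denominator of β = a/b.
    ωnd<e² : ∀ {n d a b e ω} → 0 ℕ.< n → ω ℕ.* (b ℕ.* (b ℕ.* d)) ℕ.< a ℕ.* (a ℕ.* n) → a ℕ.* n ℕ.≤ b ℕ.* e →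
             ω ℕ.* (n ℕ.* d) ℕ.< e ℕ.* e
    ωnd<e² {n} {d} {a} {b} {e} {ω} n>0 ωbbd<aan an≤be = ℕₚ.*-cancelʳ-< (b ℕ.* b) _ _ (begin-strict
      ω ℕ.* (n ℕ.* d) ℕ.* (b ℕ.* b)    ≡⟨ eq₁ ω n d b ⟩
      n ℕ.* (ω ℕ.* (b ℕ.* (b ℕ.* d)))  <⟨ ℕₚ.*-monoʳ-< n {{ℕ.>-nonZero n>0}} ωbbd<aan ⟩
      n ℕ.* (a ℕ.* (a ℕ.* n))          ≡⟨ eq₂ a n ⟩
      a ℕ.* n ℕ.* (a ℕ.* n)            ≤⟨ ℕₚ.*-mono-≤ an≤be an≤be ⟩
      b ℕ.* e ℕ.* (b ℕ.* e)            ≡⟨ eq₃ b e ⟩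
      e ℕ.* e ℕ.* (b ℕ.* b)            ∎)
      where
      open ℕₚ.≤-Reasoning
      eq₁ : ∀ ω n d b → ω ℕ.* (n ℕ.* d) ℕ.* (b ℕ.* b) ≡ n ℕ.* (ω ℕ.* (b ℕ.* (b ℕ.* d)))
      eq₁ = solve-∀
      eq₂ : ∀ a n → n ℕ.* (a ℕ.* (a ℕ.* n)) ≡ a ℕ.* n ℕ.* (a ℕ.* n)
      eq₂ = solve-∀
      eq₃ : ∀ b e → b ℕ.* e ℕ.* (b ℕ.* e) ≡ e ℕ.* e ℕ.* (b ℕ.* b)
      eq₃ = solve-∀

    -- Cancelling n in ω n ≤ ω n d < e² ≤ n² shows that the search range for ω is large enough.
    ω<n : ∀ {n d e ω} → 0 ℕ.< d → e ℕ.≤ n → ω ℕ.* (n ℕ.* d) ℕ.< e ℕ.* e → ω ℕ.< n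
    ω<n {n} {d} {e} {ω} d>0 e≤n ωnd<e² = ℕₚ.*-cancelʳ-< n _ _ (begin-strict
      ω ℕ.* n         ≤⟨ ℕₚ.*-monoʳ-≤ ω (ℕₚ.m≤m*n n d {{ℕ.>-nonZero d>0}}) ⟩
      ω ℕ.* (n ℕ.* d) <⟨ ωnd<e² ⟩
      e ℕ.* e         ≤⟨ ℕₚ.*-mono-≤ e≤n e≤n ⟩
      n ℕ.* n         ∎)
      where open ℕₚ.≤-Reasoning

  -- The parameters that work for w are its own degree ω and the degree e of
  -- the greatest common divisor, so neither needs to be computed in advance.
  candidates-complete : ∀ p h n d a b W → HasDegree p n → B.HasLead h d K.1# →
    (∀ i → length (B.coeff h i) ℕ.≤ W) → 0 ℕ.< n → 0 ℕ.< d → 0 ℕ.< a →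
    ∀ w → Solves p h n d a b w → Any (w ≋_) (candidates p h n d W)
  candidates-complete p h n d a b W p-degree h-lead length≤W n>0 d>0 a>0 w (degree-ok , g , e , g-gcd , g-degree , an≤be) =
    ∈-downFrom (λ e → concatMap (λ ω → concatMap findRoots (interpolants n d e ω W h p)) (downFrom (suc n))) e (s≤s e≤n)
      (∈-downFrom (λ ω → concatMap findRoots (interpolants n d e ω W h p)) ω (ℕₚ.m≤n⇒m≤1+n (ω<n {n} {d} {e} {ω} d>0 e≤n lt))
        (subst (λ qs → Any (w ≋_) (concatMap findRoots qs)) (≡.sym (proj₁ (proj₂ (proj₂ found))))
          (Anyₚ.++⁺ˡ (Equivalence.from (findRoots-⇔ (proj₁ found) (proj₁ (proj₂ (proj₂ (proj₂ found)))) w)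
            (proj₂ (proj₂ (proj₂ (proj₂ found))))))))
    where
    bounds = degree-bound w (λ m → m ℕ.* (b ℕ.* (b ℕ.* d))) (ℕₚ.*-mono-< {0} {a} {0} a>0 (ℕₚ.*-mono-< {0} {a} {0} a>0 n>0)) degree-ok
    ω = proj₁ bounds
    lt : ω ℕ.* (n ℕ.* d) ℕ.< e ℕ.* e
    lt = ωnd<e² {n} {d} {a} {b} {e} {ω} n>0 (proj₂ (proj₂ bounds)) an≤be
    e≤n : e ℕ.≤ n
    e≤n = ∣⇒degree≤ g p (IsGCD.divides₂ g-gcd) g-degree p-degree
    found = interpolant n d e ω W h p h-lead p-degree (lead-weight h d W h-lead length≤W) w g
      (IsGCD.divides₂ g-gcd) (IsGCD.divides₁ g-gcd) g-degree (proj₁ (proj₂ bounds)) n>0 d>0 lt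

open import Data.Rational.Base using (_*_; _<_; _≤_)

theorem1p2 :
    ∀ {ℓ₁ ℓ₂} (F : DiscreteField ℓ₁ ℓ₂) (R : RootFinder F) →
    let open Problem F R in
    Σ[ algorithm ∈ (Instance ⇒ Solution) ] ∃[ C ] ∃[ k ]
      (∀ (n d : ℕ) .{{_ : NonZero d}} (p : K[z]) (f f′ : K[z][x]) (β : ℚ) →
       0 ℕ.< n → HasDegree p n →
       MonicOfDegree f d → f ≡ f′ mod p →
       0ℚ < β → β ≤ 1ℚ →
       let input = encode p f′ β in
       (∀ w →
          (w ∈ run algorithm input) ⇔
          ((∀ m → HasDegree w m → + m / 1 < β * β * (+ n / d)) ×
           (∃[ g ] ∃[ e ]
              IsGCD g (f at w) p × HasDegree g e × β * (+ n / 1) ≤ + e / 1)))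
       × cost algorithm input ℕ.≤ C ℕ.* size Instance input ℕ.^ k)
theorem1p2 F R = program solveᵖ , Bounded.constant (cost-bounded solveᵖ) , Bounded.exponent (cost-bounded solveᵖ) , main
  where
  open Problem F R
  open PolynomialTime F R
  open Algorithm F R
  open FieldPrograms F R
  open Monicisation F
  open Acceptance F

  main : ∀ (n d : ℕ) .{{_ : NonZero d}} (p : K[z]) (f f′ : K[z][x]) (β : ℚ) →
    0 ℕ.< n → HasDegree p n → MonicOfDegree f d → f ≡ f′ mod p → 0ℚ < β → β ≤ 1ℚ →
    let input = encode p f′ β in
    (∀ w → (w ∈ run (program solveᵖ) input) ⇔
      ((∀ m → HasDegree w m → + m / 1 < β * β * (+ n / d)) ×
       (∃[ g ] ∃[ e ] IsGCD g (f at w) p × HasDegree g e × β * (+ n / 1) ≤ + e / 1)))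
    × cost (program solveᵖ) input ℕ.≤ _
  main n d p f f′ β@(mkℚ -[1+ _ ] _ _) n>0 p-degree f-monic f≡f′ 0<β β≤1 with ℚₚ.drop-*<* 0<β
  ... | ()
  main n d p f f′ β@(mkℚ (+ zero) _ _) n>0 p-degree f-monic f≡f′ 0<β β≤1 with ℚₚ.drop-*<* 0<β
  ... | ℤ.+<+ ()
  main n d@(suc _) p f f′ β@(mkℚ (+ a@(suc _)) b-1 c) n>0 p-degree f-monic f≡f′ 0<β β≤1 =
    (λ w → mk⇔ (sound w) (complete w)) , Bounded.bound (cost-bounded solveᵖ) x
    where
    b = suc b-1
    x = encode p f′ β
    h = ⟪ hᵖ ⟫ x

    form : MonicForm p-degree n>0 f f′ f-monic f≡f′ h
    form = subst (MonicForm p-degree n>0 f f′ f-monic f≡f′) (≡.sym (hᵖ-correct p f′ _))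
      (monicise-form p-degree n>0 f f′ f-monic f≡f′)

    n≡ : length (⟪ nᵖ ⟫ x) ≡ n
    n≡ = ≡.trans (nᵖ-length p _) (≡.cong ℕ.pred (length-trim p-degree))

    d≡ : length (⟪ dᵖ ⟫ x) ≡ d
    d≡ = ≡.trans (dᵖ-length x) (≡.cong ℕ.pred (proj₁ (proj₂ form)))

    accept≡ : ∀ w → ⟪ acceptᵖ ⟫ (x , w) ≡ accept p h n d a b w
    accept≡ w = ≡.trans (acceptᵖ-correct p f′ a b w) (≡.cong₂ (λ n d → accept p h n d a b w) n≡ d≡)

    Target : K[z] → Set _
    Target w = (∀ m → HasDegree w m → + m / 1 < β * β * (+ n / d)) ×
      (∃[ g ] ∃[ e ] IsGCD g (f at w) p × HasDegree g e × β * (+ n / 1) ≤ + e / 1)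

    solves⇒target : ∀ w → Solves p f n d a b w → Target w
    solves⇒target w (degree-ok , g , e , g-gcd , g-degree , an≤be) =
      (λ m w-degree → Equivalence.from (degree-bound⇔ a b-1 c m n d) (degree-ok m w-degree)) ,
      g , e , g-gcd , g-degree , Equivalence.from (gcd-bound⇔ a b-1 c n e) an≤be

    target⇒solves : ∀ w → Target w → Solves p f n d a b w
    target⇒solves w (degree-ok , g , e , g-gcd , g-degree , βn≤e) =
      (λ m w-degree → Equivalence.to (degree-bound⇔ a b-1 c m n d) (degree-ok m w-degree)) ,
      g , e , g-gcd , g-degree , Equivalence.to (gcd-bound⇔ a b-1 c n e) βn≤e

    sound : ∀ w → w ∈ ⟪ solveᵖ ⟫ x → Target w
    sound w w∈ with solveᵖ-sound x w w∈
    ... | v , w≋v , accepted = solves⇒target w (Equivalence.from (solves-mod p f h n d a b w (proj₂ (proj₂ form)))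
      (solves-≋ p h n d a b v w (λ i → sym (w≋v i))
        (accept-sound p h n d a b p-degree v (≡.trans (≡.sym (accept≡ v)) accepted))))
      where open CommutativeRing (FieldPolynomials.commutativeRing F) using (sym)

    complete : ∀ w → Target w → w ∈ ⟪ solveᵖ ⟫ x
    complete w target = solveᵖ-complete x w
      -- Acceptance is shown for every list that represents w, as the root finder may return any of
      -- them.
      (λ v w≋v → ≡.trans (accept≡ v) (accept-complete p h n d a b p-degree
        (ℕₚ.*-mono-< {0} {a} {0} (s≤s z≤n) (ℕₚ.*-mono-< {0} {a} {0} (s≤s z≤n) n>0)) v (solves-≋ p h n d a b w v w≋v solves)))
      (subst (Any (w ≋_)) (≡.sym (≡.trans (candidatesᵖ-correct x)
          (≡.cong₂ (λ n d → candidates p h n d (length (⟪ Wᵖ ⟫ x))) n≡ d≡)))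
        (candidates-complete p h n d a b _ p-degree (proj₁ form) (length-coeff≤Wᵖ x) n>0 (s≤s z≤n) (s≤s z≤n) w solves))
      where
      solves : Solves p h n d a b w
      solves = Equivalence.to (solves-mod p f h n d a b w (proj₂ (proj₂ form))) (target⇒solves w target)
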